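{- Let $q$ be a prime. For any $j\in\mathbb{F}_q^{*}$ and any positive integer $N\le q$, let $T_{4,2}(N;j,q)$ denote the number of $8$-tuples $(b_1,\ldots,b_8)\in\mathbb{F}_q^8$ such that $$b_1+b_2+b_3+b_4=b_5+b_6+b_7+b_8 \quad\text{and}\quad b_i^2\in\{j,2j,\ldots,Nj\}\subseteq \mathbb{F}_q,\qquad i=1,\ldots,8.$$ Then $$ T_{4,2}(N;j,q) \le \left(\frac{N^{5/8}}{q^{1/8}}+\frac{N^{8}}{q^{1/2}}\right)N^{6+o(1)}+N^{5+o(1)}. $$
   Context: $\mathbb{F}_q$ is the field of $q$ elements, $q$ prime; integers are viewed in $\mathbb{F}_q$ by reduction modulo $q$, so $\{j,2j,\ldots,Nj\}$ is a subset of $\mathbb{F}_q$. For a quantity $V>1$, $V^{o(1)}$ (as $V\to\infty$) denotes a function $U$ of $V$ satisfying $|U|\le V^{\varepsilon}$ for every $\varepsilon>0$, provided $V$ is large enough in terms of $\varepsilon$; thus the bound means that for every $\varepsilon>0$ and all $N$ large enough in terms of $\varepsilon$ the inequality holds with $o(1)$ replaced by $\varepsilon$, uniformly over $q$ and $j$. -}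

module Defs where

import Algebra.Definitions.RawSemiring
open import Data.Fin.Base using (Fin; toℕ; finToFun)
open import Data.Fin.Patterns using (0F; 1F; 2F; 3F; 4F; 5F; 6F; 7F)
import Data.Fin.Properties as Fin
open import Data.Integer.Base using (ℤ; +_; -[1+_])
open import Data.List.Base using (List; length; filter; allFin; applyUpTo)
import Data.List.Membership.DecPropositional as DecMembership
open import Data.List.Membership.Propositional using (_∈_)
open import Data.Nat.Base as ℕ using (ℕ; suc; NonZero)
open import Data.Nat.DivMod using (_mod_)
open import Data.Nat.Properties using (m^n≢0)
open import Data.Product.Base using (_×_; ∃₂)
open import Data.Rational.Unnormalised.Base as ℚᵘ
  using (ℚᵘ; 0ℚᵘ; _/_; _≃_; ↥_; ↧ₙ_)
open import Function.Base using (_∘_)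
open import Level using (0ℓ)
open import Relation.Binary.PropositionalEquality.Core using (_≡_)
open import Relation.Nullary.Decidable using (Dec; _×-dec_)
open import Relation.Unary using (Pred)

𝔽 : ℕ → Set
𝔽 q = Fin q

module _ {q : ℕ} .{{_ : NonZero q}} where

  ⟦_⟧ : ℕ → 𝔽 q
  ⟦ n ⟧ = n mod q

  infixl 6 _+ₚ_
  infixl 7 _*ₚ_

  _+ₚ_ _*ₚ_ : 𝔽 q → 𝔽 q → 𝔽 q
  x +ₚ y = ⟦ toℕ x ℕ.+ toℕ y ⟧
  x *ₚ y = ⟦ toℕ x ℕ.* toℕ y ⟧

  -- {j, 2j, …, Nj}
  multiples : ℕ → 𝔽 q → List (𝔽 q)
  multiples N j = applyUpTo (λ i → ⟦ suc i ⟧ *ₚ j) N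

  IsSolution : ℕ → 𝔽 q → (Fin 8 → 𝔽 q) → Set
  IsSolution N j b =
    (b 0F +ₚ b 1F +ₚ b 2F +ₚ b 3F ≡ b 4F +ₚ b 5F +ₚ b 6F +ₚ b 7F)
    × (∀ i → b i *ₚ b i ∈ multiples N j)

  isSolution? : ∀ N j b → Dec (IsSolution N j b)
  isSolution? N j b =
    (b 0F +ₚ b 1F +ₚ b 2F +ₚ b 3F Fin.≟ b 4F +ₚ b 5F +ₚ b 6F +ₚ b 7F)
    ×-dec Fin.all? (λ i → (b i *ₚ b i) ∈? multiples N j)
    where open DecMembership (Fin._≟_ {q}) using (_∈?_)

-- finToFun is a bijection from Fin (q ^ 8) onto the 8-tuples over 𝔽 q.
T₄₂ : (N q : ℕ) .{{_ : NonZero q}} → 𝔽 q → ℕ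
T₄₂ N q j =
  length (filter (isSolution? N j ∘ finToFun {q} {8}) (allFin (q ℕ.^ 8)))

-- A nonnegative real x is represented by its open upper Dedekind cut, the
-- set of rationals c with x < c.
ℝ≥0 : Set₁
ℝ≥0 = Pred ℚᵘ 0ℓ

infixl 6 _+ᴿ_
infixl 7 _*ᴿ_
infixr 8 _^ᴿ_
infix  4 _≤ᴿ_

_+ᴿ_ : ℝ≥0 → ℝ≥0 → ℝ≥0
(X +ᴿ Y) c = ∃₂ λ a b → X a × Y b × c ≃ a ℚᵘ.+ b

-- This is the cut of the product because every element of X and of Y is
-- positive.
_*ᴿ_ : ℝ≥0 → ℝ≥0 → ℝ≥0
(X *ᴿ Y) c = ∃₂ λ a b → X a × Y b × c ≃ a ℚᵘ.* b

_^ᶻ_ : (n : ℕ) .{{_ : NonZero n}} → ℤ → ℚᵘ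
n ^ᶻ (+ k)    = + (n ℕ.^ k) / 1
n ^ᶻ -[1+ k ] = (+ 1 / (n ℕ.^ suc k)) {{m^n≢0 n (suc k)}}

open Algebra.Definitions.RawSemiring ℚᵘ.+-*-rawSemiring
  using () renaming (_^_ to _^ℚ_)

-- The positive real n^s with s = p/r rational: for rational c > 0,
-- n^(p/r) < c exactly when n^p < c^r.
_^ᴿ_ : (n : ℕ) .{{_ : NonZero n}} → ℚᵘ → ℝ≥0
(n ^ᴿ s) c = 0ℚᵘ ℚᵘ.< c × n ^ᶻ (↥ s) ℚᵘ.< c ^ℚ (↧ₙ s)

-- t ≤ x iff t ≤ c for every rational c > x.
_≤ᴿ_ : ℕ → ℝ≥0 → Set
t ≤ᴿ X = ∀ c → X c → + t / 1 ℚᵘ.≤ c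

{-# OPTIONS --safe #-}
module Submission where

-- Let S = {b : b² ∈ {j, …, Nj}}, so |S| ≤ 2N, and let Eₖ count the pairs (x, y) in
-- Sᵏ × Sᵏ with Σx = Σy. By Cauchy–Schwarz the number T of solutions is at most
-- |S|^(8-2k) Eₖ.
--
-- If Σ ±bᵢ = 0 with bᵢ² = nᵢ j (1 ≤ i ≤ 2k), then q divides the integer
-- P = ∏ (√n₁ ± ⋯ ± √n₂ₖ), the product being over all signs. As |P| ≤ (2k √N)^(2^(2k-1)),
-- P = 0 as soon as q > C N^(4^(k-1)). Then some signed sum of the √nᵢ vanishes in an
-- extension of ℚ, and the trace of its product with √nᵢ shows that nᵢ nₗ is a square
-- for some l ≠ i. Only O(N^k (log N)^k) tuples n have this property for every i, so
-- Eₖ ≪ N^k (log N)^k.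
--
-- For q > C N¹⁶ take k = 3 and get T ≤ N^(5+o(1)); for C N⁴ < q ≤ C N¹⁶ take k = 2 and
-- get T ≤ N^(6+o(1)) ≤ N^(14+o(1)) / q^(1/2); for smaller q, T ≤ |S|⁸ is enough.

-- P is never formed from real square roots. It is computed in the formal ring ℤ[x₁, ..., xₘ]/(xᵢ² =
-- nᵢ), which maps to every ring with chosen roots of the nᵢ. Two kinds of rings are used: ℤ/q with
-- a root of j⁻¹ adjoined, where one vanishing signed sum forces P ≡ 0, and towers of quadratic
-- extensions of ℚ, which are fields, where P = 0 forces some signed sum to vanish.
--
-- The last root keeps a fixed sign, because reversing all signs at once only repeats the factors up
-- to sign. The halved degree is essential: T ≤ N^(6+o(1)) implies the bound N^(14+o(1)) / q^(1/2)
-- only up to q of order N¹⁶, and this is exactly where k = 3 takes over. With all 2^(2k) signs the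
-- case k = 3 would start at N³² and leave a gap.
--
-- In the count of tuples, a pair of entries whose product is a square has at most L N values, where
-- L is of order log N, and one integer has at most √(L N) partners. Every entry therefore costs a
-- factor √(L N), whether it is matched with a new entry or with one already fixed.

-- Adjoining a square root to a commutative ring.

module SquareRootAdjunction where
  open import Level using (0ℓ)
  open import Algebra.Bundles using (CommutativeRing; AbelianGroup)
  import Algebra.Construct.DirectProduct as DirectProduct
  import Algebra.Properties.Ring as RingProperties
  import Algebra.Solver.Ring.NaturalCoefficients.Default as SemiringSolver
  open import Data.Product.Base using (_×_; _,_)
  open import Data.Integer.Base as ℤ using (ℤ; +_; 0ℤ; 1ℤ)
  import Data.Integer.Properties as ℤ
  open import Relation.Binary.PropositionalEquality as ≡ using (_≡_)

  -- A commutative ring with its map from ℤ, so that one identity can be read both modulo q and in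
  -- extensions of ℚ. Equality is a setoid relation; thus ℤ with congruence modulo q is an instance.
  record ℤ-Algebra : Set₁ where
    field
      commutativeRing : CommutativeRing 0ℓ 0ℓ
    open CommutativeRing commutativeRing public
    field
      ι   : ℤ → Carrier
      ι-0 : ι 0ℤ ≈ 0#
      ι-1 : ι 1ℤ ≈ 1#
      ι-+ : ∀ x y → ι (x ℤ.+ y) ≈ ι x + ι y
      ι-* : ∀ x y → ι (x ℤ.* y) ≈ ι x * ι y

    open RingProperties ring public using (-‿distribˡ-*; -‿distribʳ-*; -‿involutive; -0#≈0#)
    open import Algebra.Properties.AbelianGroup +-abelianGroup public
      using () renaming (inverseˡ-unique to +-inverseˡ-unique)

    ι-neg : ∀ x → ι (ℤ.- x) ≈ - ι x
    ι-neg x = +-inverseˡ-unique _ _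
      (trans (sym (ι-+ (ℤ.- x) x)) (trans (reflexive (≡.cong ι (ℤ.+-inverseˡ x))) ι-0))

    open SemiringSolver commutativeSemiring public using (solve; _:+_; _:*_; _:=_; con)

  -- A[x]/(x² - d), with (a , b) standing for a + b x. It is a ring for every d; zero divisors may
  -- appear when d is a square.
  module Adjoin (A : ℤ-Algebra) (d : ℤ-Algebra.Carrier A) where
    open ℤ-Algebra A
    private
      module +² = AbelianGroup (DirectProduct.abelianGroup +-abelianGroup +-abelianGroup)

    _*²_ : Carrier × Carrier → Carrier × Carrier → Carrier × Carrier
    (a , b) *² (c , e) = a * c + d * (b * e) , a * e + b * c

    algebra : ℤ-Algebra
    algebra = record
      { commutativeRing = record
        { _*_ = _*²_
        ; 1# = 1# , 0#
        ; isCommutativeRing = record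
          { isRing = record
            { +-isAbelianGroup = +².isAbelianGroup
            ; *-cong = λ (p , q) (r , s) →
                +-cong (*-cong p r) (*-congˡ (*-cong q s)) , +-cong (*-cong p s) (*-cong q r)
            ; *-assoc = λ (a , b) (c , e) (f , g) →
                solve 7 (λ d a b c e f g →
                  (a :* c :+ d :* (b :* e)) :* f :+ d :* ((a :* e :+ b :* c) :* g)
                  := a :* (c :* f :+ d :* (e :* g)) :+ d :* (b :* (c :* g :+ e :* f)))
                  refl d a b c e f g
              , solve 7 (λ d a b c e f g →
                  (a :* c :+ d :* (b :* e)) :* g :+ (a :* e :+ b :* c) :* f
                  := a :* (c :* g :+ e :* f) :+ b :* (c :* f :+ d :* (e :* g)))
                  refl d a b c e f g
            ; *-identity =
                (λ (a , b) →
                  solve 3 (λ d a b → con 1 :* a :+ d :* (con 0 :* b) := a) refl d a b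
                , solve 2 (λ a b → con 1 :* b :+ con 0 :* a := b) refl a b)
              , (λ (a , b) →
                  solve 3 (λ d a b → a :* con 1 :+ d :* (b :* con 0) := a) refl d a b
                , solve 2 (λ a b → a :* con 0 :+ b :* con 1 := b) refl a b)
            ; distrib =
                (λ (a , b) (c , e) (f , g) →
                  solve 7 (λ d a b c e f g →
                    a :* (c :+ f) :+ d :* (b :* (e :+ g))
                    := (a :* c :+ d :* (b :* e)) :+ (a :* f :+ d :* (b :* g))) refl d a b c e f g
                , solve 6 (λ a b c e f g →
                    a :* (e :+ g) :+ b :* (c :+ f)
                    := (a :* e :+ b :* c) :+ (a :* g :+ b :* f)) refl a b c e f g)
              , (λ (a , b) (c , e) (f , g) →
                  solve 7 (λ d a b c e f g →
                    (c :+ f) :* a :+ d :* ((e :+ g) :* b)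
                    := (c :* a :+ d :* (e :* b)) :+ (f :* a :+ d :* (g :* b))) refl d a b c e f g
                , solve 6 (λ a b c e f g →
                    (c :+ f) :* b :+ (e :+ g) :* a
                    := (c :* b :+ e :* a) :+ (f :* b :+ g :* a)) refl a b c e f g)
            }
          ; *-comm = λ (a , b) (c , e) →
              solve 5 (λ d a b c e → a :* c :+ d :* (b :* e) := c :* a :+ d :* (e :* b)) refl d a b c e
            , solve 4 (λ a b c e → a :* e :+ b :* c := c :* b :+ e :* a) refl a b c e
          }
        }
      ; ι = λ x → ι x , 0#
      ; ι-0 = ι-0 , refl
      ; ι-1 = ι-1 , refl
      ; ι-+ = λ x y → ι-+ x y , sym (+-identityˡ 0#)
      ; ι-* = λ x y →
          trans (ι-* x y) (solve 3 (λ d a b → a :* b := a :* b :+ d :* (con 0 :* con 0)) refl d (ι x) (ι y))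
        , solve 2 (λ a b → con 0 := a :* con 0 :+ con 0 :* b) refl (ι x) (ι y)
      }

-- The product of all signed sums of square roots: its vanishing and its size.

module SignProducts where
  open SquareRootAdjunction
  open import Data.Bool.Base using (Bool; true; false; not; _xor_)
  open import Data.Unit.Base using (⊤; tt)
  open import Data.Nat.Base as ℕ using (ℕ; zero; suc)
  import Data.Nat.Properties as ℕ
  open import Data.Nat.Solver using (module +-*-Solver)
  open import Data.Vec.Base using (Vec; []; _∷_)
  open import Data.Vec.Relation.Unary.All using (All; []; _∷_)
  open import Data.Product.Base using (_×_; _,_; proj₁; proj₂; ∃)
  open import Data.Sum.Base using (_⊎_; inj₁; inj₂)
  open import Data.Integer.Base as ℤ using (ℤ; +_; 0ℤ; 1ℤ; ∣_∣)
  import Data.Integer.Properties as ℤ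
  open import Relation.Binary.PropositionalEquality as ≡ using (_≡_)

  -- Multi m is the ring ℤ[x₁, …, xₘ]/(xᵢ² = nᵢ); the pair (a , b) over n ∷ ns
  -- stands for a + b x with x² = n.
  Multi : ℕ → Set
  Multi zero    = ℤ
  Multi (suc m) = Multi m × Multi m

  private variable
    m : ℕ
    ns : Vec ℕ m

  0ᴹ : Multi m
  0ᴹ {zero}  = 0ℤ
  0ᴹ {suc m} = 0ᴹ , 0ᴹ

  1ᴹ : Multi m
  1ᴹ {zero}  = 1ℤ
  1ᴹ {suc m} = 1ᴹ , 0ᴹ

  infixl 6 _+ᴹ_
  infixr 7 _·ᴹ_

  _+ᴹ_ : Multi m → Multi m → Multi m
  _+ᴹ_ {zero}  x y = x ℤ.+ y
  _+ᴹ_ {suc m} (a , b) (c , d) = a +ᴹ c , b +ᴹ d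

  _·ᴹ_ : ℤ → Multi m → Multi m
  _·ᴹ_ {zero}  k x = k ℤ.* x
  _·ᴹ_ {suc m} k (a , b) = k ·ᴹ a , k ·ᴹ b

  mulᴹ : Vec ℕ m → Multi m → Multi m → Multi m
  mulᴹ []       x y = x ℤ.* y
  mulᴹ (n ∷ ns) (a , b) (c , d) =
    mulᴹ ns a c +ᴹ + n ·ᴹ mulᴹ ns b d , mulᴹ ns a d +ᴹ mulᴹ ns b c

  rootSum : Multi m
  rootSum {zero}  = 0ℤ
  rootSum {suc m} = rootSum , 1ᴹ

  -- (a + b x)(a - b x) with x² = n, in which the first root x no longer occurs.
  norm : ∀ n (ns : Vec ℕ m) → Multi (suc m) → Multi m
  norm n ns (a , b) = mulᴹ ns a a +ᴹ (ℤ.- + n) ·ᴹ mulᴹ ns b b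

  lastEntry : Vec ℕ (suc m) → ℕ
  lastEntry (n ∷ [])      = n
  lastEntry (n ∷ n′ ∷ ns) = lastEntry (n′ ∷ ns)

  iterNorm : Vec ℕ (suc m) → Multi (suc m) → Multi 1
  iterNorm (n ∷ [])      z = z
  iterNorm (n ∷ n′ ∷ ns) z = iterNorm (n′ ∷ ns) (norm n (n′ ∷ ns) z)

  -- The product of ±√n₁ ± ⋯ ± √nₘ over all choices of signs but the last, as an integer.
  signProduct : Vec ℕ (suc m) → ℤ
  signProduct ns = proj₁ (iterNorm ns rootSum)

  module _ (A : ℤ-Algebra) where
    open ℤ-Algebra A

    Root : ℕ → Set
    Root n = ∃ λ r → r * r ≈ ι (+ n)

    data Roots : Vec ℕ m → Set where
      []  : Roots []
      _∷_ : ∀ {n} → Root n → Roots ns → Roots (n ∷ ns)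

  module _ {A : ℤ-Algebra} where
    open ℤ-Algebra A
    open import Relation.Binary.Reasoning.Setoid setoid

    sumRoots : Roots A ns → Carrier
    sumRoots []             = 0#
    sumRoots ((r , _) ∷ rs) = r + sumRoots rs

    -- The homomorphism from ℤ[x₁, ..., xₘ]/(xᵢ² = nᵢ) to A that sends each xᵢ to the chosen root.
    ev : Roots A {m} ns → Multi m → Carrier
    ev []             x       = ι x
    ev ((r , _) ∷ rs) (a , b) = ev rs a + r * ev rs b

    ev-0 : (rs : Roots A {m} ns) → ev rs (0ᴹ {m}) ≈ 0#
    ev-0 []             = ι-0
    ev-0 ((r , _) ∷ rs) = begin
      ev rs 0ᴹ + r * ev rs 0ᴹ ≈⟨ +-cong (ev-0 rs) (*-congˡ (ev-0 rs)) ⟩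
      0# + r * 0#             ≈⟨ trans (+-identityˡ _) (zeroʳ r) ⟩
      0#                      ∎

    ev-1 : (rs : Roots A {m} ns) → ev rs (1ᴹ {m}) ≈ 1#
    ev-1 []             = ι-1
    ev-1 ((r , _) ∷ rs) = begin
      ev rs 1ᴹ + r * ev rs 0ᴹ ≈⟨ +-cong (ev-1 rs) (*-congˡ (ev-0 rs)) ⟩
      1# + r * 0#             ≈⟨ trans (+-congˡ (zeroʳ r)) (+-identityʳ 1#) ⟩
      1#                      ∎

    ev-+ : (rs : Roots A {m} ns) (x y : Multi m) → ev rs (x +ᴹ y) ≈ ev rs x + ev rs y
    ev-+ []             x y = ι-+ x y
    ev-+ ((r , _) ∷ rs) (a , b) (c , d) = begin
      ev rs (a +ᴹ c) + r * ev rs (b +ᴹ d)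
        ≈⟨ +-cong (ev-+ rs a c) (*-congˡ (ev-+ rs b d)) ⟩
      (ev rs a + ev rs c) + r * (ev rs b + ev rs d)
        ≈⟨ solve 5 (λ r a b c d → (a :+ c) :+ r :* (b :+ d) := (a :+ r :* b) :+ (c :+ r :* d))
             refl r (ev rs a) (ev rs b) (ev rs c) (ev rs d) ⟩
      (ev rs a + r * ev rs b) + (ev rs c + r * ev rs d) ∎

    ev-· : (rs : Roots A {m} ns) (k : ℤ) (x : Multi m) → ev rs (k ·ᴹ x) ≈ ι k * ev rs x
    ev-· []             k x = ι-* k x
    ev-· ((r , _) ∷ rs) k (a , b) = begin
      ev rs (k ·ᴹ a) + r * ev rs (k ·ᴹ b)
        ≈⟨ +-cong (ev-· rs k a) (*-congˡ (ev-· rs k b)) ⟩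
      ι k * ev rs a + r * (ι k * ev rs b)
        ≈⟨ solve 4 (λ r k a b → k :* a :+ r :* (k :* b) := k :* (a :+ r :* b))
             refl r (ι k) (ev rs a) (ev rs b) ⟩
      ι k * (ev rs a + r * ev rs b) ∎

    ev-mul : (rs : Roots A {m} ns) (x y : Multi m) → ev rs (mulᴹ ns x y) ≈ ev rs x * ev rs y
    ev-mul []              x y = ι-* x y
    ev-mul {ns = n ∷ ns} ((r , r²≈n) ∷ rs) (a , b) (c , d) = begin
      ev rs (mulᴹ ns a c +ᴹ + n ·ᴹ mulᴹ ns b d) + r * ev rs (mulᴹ ns a d +ᴹ mulᴹ ns b c)
        ≈⟨ +-cong (trans (ev-+ rs _ _) (+-cong (ev-mul rs a c)
                    (trans (ev-· rs (+ n) _) (*-cong (sym r²≈n) (ev-mul rs b d)))))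
                  (*-congˡ (trans (ev-+ rs _ _) (+-cong (ev-mul rs a d) (ev-mul rs b c)))) ⟩
      (ev rs a * ev rs c + r * r * (ev rs b * ev rs d))
        + r * (ev rs a * ev rs d + ev rs b * ev rs c)
        ≈⟨ solve 5 (λ r a b c d → (a :* c :+ r :* r :* (b :* d)) :+ r :* (a :* d :+ b :* c)
                                := (a :+ r :* b) :* (c :+ r :* d))
             refl r (ev rs a) (ev rs b) (ev rs c) (ev rs d) ⟩
      (ev rs a + r * ev rs b) * (ev rs c + r * ev rs d) ∎

    ev-rootSum : (rs : Roots A {m} ns) → ev rs rootSum ≈ sumRoots rs
    ev-rootSum []             = ι-0
    ev-rootSum ((r , _) ∷ rs) = begin
      ev rs rootSum + r * ev rs 1ᴹ ≈⟨ +-cong (ev-rootSum rs) (*-congˡ (ev-1 rs)) ⟩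
      sumRoots rs + r * 1#         ≈⟨ trans (+-congˡ (*-identityʳ r)) (+-comm _ r) ⟩
      r + sumRoots rs              ∎

    negate : ∀ {n} → Root A n → Root A n
    negate (r , r²≈n) = - r , trans
      (trans (sym (-‿distribˡ-* r (- r))) (trans (-‿cong (sym (-‿distribʳ-* r r))) (-‿involutive _))) r²≈n

    ev-norm : ∀ {n} (r : Root A n) (rs : Roots A {m} ns) z →
              ev rs (norm n ns z) ≈ ev (r ∷ rs) z * ev (negate r ∷ rs) z
    ev-norm {ns = ns} {n = n} (r , r²≈n) rs (a , b) = begin
      ev rs (mulᴹ ns a a +ᴹ (ℤ.- + n) ·ᴹ mulᴹ ns b b)
        ≈⟨ trans (ev-+ rs _ _) (+-cong (ev-mul rs a a) (trans (ev-· rs (ℤ.- + n) _)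
             (*-cong (trans (ι-neg (+ n)) (-‿cong (sym r²≈n))) (ev-mul rs b b)))) ⟩
      x * x + - (r * r) * (y * y)
        ≈⟨ +-congˡ (*-congʳ (-‿distribʳ-* r r)) ⟩
      x * x + (r * - r) * (y * y)
        -- The solver works over semirings and knows no negation. With the zero term (r + - r) x y
        -- added, the identity holds for any s in place of - r.
        ≈⟨ sym (trans (+-congˡ (trans (*-congʳ (-‿inverseʳ r)) (zeroˡ (x * y)))) (+-identityʳ _)) ⟩
      (x * x + (r * - r) * (y * y)) + (r + - r) * (x * y)
        ≈⟨ solve 4 (λ r s x y → (x :* x :+ (r :* s) :* (y :* y)) :+ (r :+ s) :* (x :* y)
                              := (x :+ r :* y) :* (x :+ s :* y))
             refl r (- r) x y ⟩
      (x + r * y) * (x + - r * y) ∎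
      where x = ev rs a
            y = ev rs b

    -- Each norm contains the previous element as a factor, so vanishing propagates. This direction
    -- also holds in rings with zero divisors, as needed modulo q.
    ev-iterNorm : (rs : Roots A {suc m} ns) (z : Multi (suc m)) → ev rs z ≈ 0# →
                  ∃ λ (r : Roots A (lastEntry ns ∷ [])) → ev r (iterNorm ns z) ≈ 0#
    ev-iterNorm (r ∷ [])      z z≈0 = r ∷ [] , z≈0
    ev-iterNorm {ns = n ∷ n′ ∷ ns} (r ∷ r′ ∷ rs) z z≈0 = ev-iterNorm (r′ ∷ rs) (norm n (n′ ∷ ns) z)
      (trans (ev-norm r (r′ ∷ rs) z) (trans (*-congʳ z≈0) (zeroˡ _)))

    -- The converse in a domain: a vanishing norm has a vanishing factor, which selects a sign for
    -- each root in turn. The resulting roots may thus differ in sign from the given ones.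
    iterNorm-ev : (∀ {x y} → x * y ≈ 0# → x ≈ 0# ⊎ y ≈ 0#) →
                  (rs : Roots A {suc m} ns) (z : Multi (suc m)) →
                  (∀ (r : Roots A (lastEntry ns ∷ [])) → ev r (iterNorm ns z) ≈ 0#) →
                  ∃ λ (rs′ : Roots A ns) → ev rs′ z ≈ 0#
    iterNorm-ev dom (r ∷ [])      z N≈0 = r ∷ [] , N≈0 (r ∷ [])
    iterNorm-ev {ns = n ∷ n′ ∷ ns} dom (r ∷ r′ ∷ rs) z N≈0 =
      choose (iterNorm-ev dom (r′ ∷ rs) (norm n (n′ ∷ ns) z) N≈0)
      where
      choose : ∃ (λ (rs′ : Roots A (n′ ∷ ns)) → ev rs′ (norm n (n′ ∷ ns) z) ≈ 0#) →
               ∃ λ (rs′ : Roots A (n ∷ n′ ∷ ns)) → ev rs′ z ≈ 0#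
      choose (rs′ , v) with dom {ev (r ∷ rs′) z} {ev (negate r ∷ rs′) z} (trans (sym (ev-norm r rs′ z)) v)
      ... | inj₁ e = r ∷ rs′ , e
      ... | inj₂ e = negate r ∷ rs′ , e

  -- The iterated norm of the odd element x₁ + ⋯ + xₘ is even, and an even element
  -- of Multi 1 is an integer. Stopping at Multi 1 rather than at ℤ halves the degree.
  HasParity : Bool → Multi m → Set
  HasParity {zero}  false _ = ⊤
  HasParity {zero}  true  x = x ≡ 0ℤ
  HasParity {suc m} p (a , b) = HasParity p a × HasParity (not p) b

  0-parity : ∀ p → HasParity {m} p 0ᴹ
  0-parity {zero}  false = tt
  0-parity {zero}  true  = ≡.refl
  0-parity {suc m} p     = 0-parity p , 0-parity (not p)

  1-parity : HasParity {m} false 1ᴹ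
  1-parity {zero}  = tt
  1-parity {suc m} = 1-parity , 0-parity true

  rootSum-parity : HasParity {m} true rootSum
  rootSum-parity {zero}  = ≡.refl
  rootSum-parity {suc m} = rootSum-parity , 1-parity

  +-parity : ∀ p {x y : Multi m} → HasParity p x → HasParity p y → HasParity p (x +ᴹ y)
  +-parity {zero}  false _ _ = tt
  +-parity {zero}  true  ≡.refl ≡.refl = ≡.refl
  +-parity {suc m} p (a , b) (c , d) = +-parity p a c , +-parity (not p) b d

  ·-parity : ∀ p k {x : Multi m} → HasParity p x → HasParity p (k ·ᴹ x)
  ·-parity {zero}  false k _      = tt
  ·-parity {zero}  true  k ≡.refl = ℤ.*-zeroʳ k
  ·-parity {suc m} p     k (a , b) = ·-parity p k a , ·-parity (not p) k b

  not-xor : ∀ p q → not p xor not q ≡ p xor q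
  not-xor false false = ≡.refl
  not-xor false true  = ≡.refl
  not-xor true  false = ≡.refl
  not-xor true  true  = ≡.refl

  xor-not : ∀ p q → p xor not q ≡ not (p xor q)
  xor-not false q = ≡.refl
  xor-not true  q = ≡.refl

  not-xorˡ : ∀ p q → not p xor q ≡ not (p xor q)
  not-xorˡ false false = ≡.refl
  not-xorˡ false true  = ≡.refl
  not-xorˡ true  false = ≡.refl
  not-xorˡ true  true  = ≡.refl

  mul-parity : ∀ p q (ns : Vec ℕ m) {x y : Multi m} →
               HasParity p x → HasParity q y → HasParity (p xor q) (mulᴹ ns x y)
  mul-parity false false [] _ _ = tt
  mul-parity false true  [] {x} _ ≡.refl = ℤ.*-zeroʳ x
  mul-parity true  false [] ≡.refl _ = ≡.refl
  mul-parity true  true  [] _ _ = tt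
  mul-parity p q (n ∷ ns) (a , b) (c , d) =
      +-parity (p xor q) (mul-parity p q ns a c)
        (·-parity (p xor q) (+ n)
          (≡.subst (λ s → HasParity s _) (not-xor p q) (mul-parity (not p) (not q) ns b d)))
    , +-parity (not (p xor q))
        (≡.subst (λ s → HasParity s _) (xor-not p q) (mul-parity p (not q) ns a d))
        (≡.subst (λ s → HasParity s _) (not-xorˡ p q) (mul-parity (not p) q ns b c))

  xor-self : ∀ p → p xor p ≡ false
  xor-self false = ≡.refl
  xor-self true  = ≡.refl

  -- The two components have opposite parities, but each has a definite one, so both squares are
  -- even.
  norm-parity : ∀ p n (ns : Vec ℕ m) {z : Multi (suc m)} → HasParity p z → HasParity false (norm n ns z)
  norm-parity p n ns (a , b) = +-parity false (square p a) (·-parity false (ℤ.- + n) (square (not p) b))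
    where
    square : ∀ p {x} → HasParity p x → HasParity false (mulᴹ ns x x)
    square p h = ≡.subst (λ s → HasParity s _) (xor-self p) (mul-parity p p ns h h)

  iterNorm-even : (ns : Vec ℕ (suc m)) {z : Multi (suc m)} → HasParity false z → HasParity false (iterNorm ns z)
  iterNorm-even (n ∷ [])      h = h
  iterNorm-even (n ∷ n′ ∷ ns) h = iterNorm-even (n′ ∷ ns) (norm-parity false n (n′ ∷ ns) h)

  module _ {A : ℤ-Algebra} where
    open ℤ-Algebra A

    -- By parity the coefficient of the last root is zero. At least two entries are required: with a
    -- single one no norm is taken and the element x₁ is still odd.
    ev-signProduct : (ns : Vec ℕ (suc (suc m))) (r : Roots A (lastEntry ns ∷ [])) →
                     ev r (iterNorm ns rootSum) ≈ ι (signProduct ns)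
    ev-signProduct (n ∷ n′ ∷ ns) ((r , _) ∷ []) =
      trans (+-congˡ (trans (*-congˡ (trans (reflexive (≡.cong ι even)) ι-0)) (zeroʳ r))) (+-identityʳ _)
      where
      even : proj₂ (iterNorm (n ∷ n′ ∷ ns) rootSum) ≡ 0ℤ
      even = proj₂ (iterNorm-even (n′ ∷ ns) (norm-parity true n (n′ ∷ ns) rootSum-parity))

    sumRoots≈0⇒signProduct≈0 : {ns : Vec ℕ (suc (suc m))} (rs : Roots A ns) →
      sumRoots rs ≈ 0# → ι (signProduct ns) ≈ 0#
    sumRoots≈0⇒signProduct≈0 {ns = ns} rs s≈0 with ev-iterNorm rs rootSum (trans (ev-rootSum rs) s≈0)
    ... | r , e = trans (sym (ev-signProduct ns r)) e

    signProduct≡0⇒sumRoots≈0 : (∀ {x y} → x * y ≈ 0# → x ≈ 0# ⊎ y ≈ 0#) →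
      {ns : Vec ℕ (suc (suc m))} → Roots A ns → signProduct ns ≡ 0ℤ →
      ∃ λ (rs : Roots A ns) → sumRoots rs ≈ 0#
    signProduct≡0⇒sumRoots≈0 dom {ns} rs P≡0
      with iterNorm-ev dom rs rootSum
             (λ r → trans (ev-signProduct ns r) (trans (reflexive (≡.cong ι P≡0)) ι-0))
    ... | rs′ , e = rs′ , trans (sym (ev-rootSum rs′)) e

  module Size (M : ℕ) where
    open ℕ.≤-Reasoning

    -- The value at x₁ = ⋯ = xₘ = M after all coefficients are replaced by their absolute values. If
    -- nᵢ ≤ M², replacing xᵢ² by nᵢ does not increase it, so it is submultiplicative; it plays the
    -- role of the estimate √nᵢ ≤ M.
    ‖_‖ : Multi m → ℕ
    ‖_‖ {zero}  x       = ∣ x ∣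
    ‖_‖ {suc m} (a , b) = ‖ a ‖ ℕ.+ M ℕ.* ‖ b ‖

    ‖0‖ : ‖ 0ᴹ {m} ‖ ≡ 0
    ‖0‖ {zero}  = ≡.refl
    ‖0‖ {suc m} rewrite ‖0‖ {m} = ℕ.*-zeroʳ M

    ‖1‖ : ‖ 1ᴹ {m} ‖ ≡ 1
    ‖1‖ {zero}  = ≡.refl
    ‖1‖ {suc m} rewrite ‖1‖ {m} | ‖0‖ {m} = ≡.cong suc (ℕ.*-zeroʳ M)

    ‖rootSum‖ : ‖ rootSum {m} ‖ ≡ m ℕ.* M
    ‖rootSum‖ {zero}  = ≡.refl
    ‖rootSum‖ {suc m} rewrite ‖rootSum‖ {m} | ‖1‖ {m} | ℕ.*-identityʳ M = ℕ.+-comm (m ℕ.* M) M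

    ‖+‖≤ : (x y : Multi m) → ‖ x +ᴹ y ‖ ℕ.≤ ‖ x ‖ ℕ.+ ‖ y ‖
    ‖+‖≤ {zero}  x y = ℤ.∣i+j∣≤∣i∣+∣j∣ x y
    ‖+‖≤ {suc m} (a , b) (c , d) = begin
      ‖ a +ᴹ c ‖ ℕ.+ M ℕ.* ‖ b +ᴹ d ‖
        ≤⟨ ℕ.+-mono-≤ (‖+‖≤ a c) (ℕ.*-monoʳ-≤ M (‖+‖≤ b d)) ⟩
      ‖ a ‖ ℕ.+ ‖ c ‖ ℕ.+ M ℕ.* (‖ b ‖ ℕ.+ ‖ d ‖)
        ≡⟨ solve 5 (λ M a b c d → a :+ c :+ M :* (b :+ d) := (a :+ M :* b) :+ (c :+ M :* d))
             ≡.refl M (‖ a ‖) (‖ b ‖) (‖ c ‖) (‖ d ‖) ⟩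
      (‖ a ‖ ℕ.+ M ℕ.* ‖ b ‖) ℕ.+ (‖ c ‖ ℕ.+ M ℕ.* ‖ d ‖) ∎
      where open +-*-Solver

    ‖·‖ : ∀ k (x : Multi m) → ‖ k ·ᴹ x ‖ ≡ ∣ k ∣ ℕ.* ‖ x ‖
    ‖·‖ {zero}  k x = ℤ.∣i*j∣≡∣i∣*∣j∣ k x
    ‖·‖ {suc m} k (a , b) rewrite ‖·‖ k a | ‖·‖ k b =
      solve 4 (λ k M a b → k :* a :+ M :* (k :* b) := k :* (a :+ M :* b)) ≡.refl (∣ k ∣) M (‖ a ‖) (‖ b ‖)
      where open +-*-Solver

    ‖mul‖≤ : {ns : Vec ℕ m} → All (λ n → n ℕ.≤ M ℕ.* M) ns → (x y : Multi m) →
             ‖ mulᴹ ns x y ‖ ℕ.≤ ‖ x ‖ ℕ.* ‖ y ‖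
    ‖mul‖≤ []         x y = ℕ.≤-reflexive (ℤ.∣i*j∣≡∣i∣*∣j∣ x y)
    ‖mul‖≤ {ns = n ∷ ns} (n≤ ∷ ns≤) (a , b) (c , d) = begin
      ‖ mulᴹ ns a c +ᴹ + n ·ᴹ mulᴹ ns b d ‖ ℕ.+ M ℕ.* ‖ mulᴹ ns a d +ᴹ mulᴹ ns b c ‖
        ≤⟨ ℕ.+-mono-≤ (‖+‖≤ (mulᴹ ns a c) _) (ℕ.*-monoʳ-≤ M (‖+‖≤ (mulᴹ ns a d) _)) ⟩
      (‖ mulᴹ ns a c ‖ ℕ.+ ‖ + n ·ᴹ mulᴹ ns b d ‖) ℕ.+ M ℕ.* (‖ mulᴹ ns a d ‖ ℕ.+ ‖ mulᴹ ns b c ‖)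
        ≤⟨ ℕ.+-mono-≤ (ℕ.+-mono-≤ (‖mul‖≤ ns≤ a c)
             (ℕ.≤-trans (ℕ.≤-reflexive (‖·‖ (+ n) (mulᴹ ns b d))) (ℕ.*-mono-≤ n≤ (‖mul‖≤ ns≤ b d))))
             (ℕ.*-monoʳ-≤ M (ℕ.+-mono-≤ (‖mul‖≤ ns≤ a d) (‖mul‖≤ ns≤ b c))) ⟩
      (‖ a ‖ ℕ.* ‖ c ‖ ℕ.+ M ℕ.* M ℕ.* (‖ b ‖ ℕ.* ‖ d ‖))
        ℕ.+ M ℕ.* (‖ a ‖ ℕ.* ‖ d ‖ ℕ.+ ‖ b ‖ ℕ.* ‖ c ‖)
        ≡⟨ solve 5 (λ M a b c d → (a :* c :+ M :* M :* (b :* d)) :+ M :* (a :* d :+ b :* c)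
                                := (a :+ M :* b) :* (c :+ M :* d))
             ≡.refl M (‖ a ‖) (‖ b ‖) (‖ c ‖) (‖ d ‖) ⟩
      (‖ a ‖ ℕ.+ M ℕ.* ‖ b ‖) ℕ.* (‖ c ‖ ℕ.+ M ℕ.* ‖ d ‖) ∎
      where open +-*-Solver

    ‖norm‖≤ : ∀ {n} {ns : Vec ℕ m} → All (λ n → n ℕ.≤ M ℕ.* M) (n ∷ ns) → (z : Multi (suc m)) →
              ‖ norm n ns z ‖ ℕ.≤ ‖ z ‖ ℕ.* ‖ z ‖
    ‖norm‖≤ {n = n} {ns} (n≤ ∷ ns≤) (a , b) = begin
      ‖ mulᴹ ns a a +ᴹ (ℤ.- + n) ·ᴹ mulᴹ ns b b ‖
        ≤⟨ ‖+‖≤ (mulᴹ ns a a) _ ⟩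
      ‖ mulᴹ ns a a ‖ ℕ.+ ‖ (ℤ.- + n) ·ᴹ mulᴹ ns b b ‖
        ≡⟨ ≡.cong (‖ mulᴹ ns a a ‖ ℕ.+_) (≡.trans (‖·‖ (ℤ.- + n) (mulᴹ ns b b))
             (≡.cong (ℕ._* ‖ mulᴹ ns b b ‖) (ℤ.∣-i∣≡∣i∣ (+ n)))) ⟩
      ‖ mulᴹ ns a a ‖ ℕ.+ n ℕ.* ‖ mulᴹ ns b b ‖
        ≤⟨ ℕ.+-mono-≤ (‖mul‖≤ ns≤ a a) (ℕ.*-mono-≤ n≤ (‖mul‖≤ ns≤ b b)) ⟩
      ‖ a ‖ ℕ.* ‖ a ‖ ℕ.+ M ℕ.* M ℕ.* (‖ b ‖ ℕ.* ‖ b ‖)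
        ≤⟨ ℕ.m≤m+n _ (2 ℕ.* (M ℕ.* (‖ a ‖ ℕ.* ‖ b ‖))) ⟩
      ‖ a ‖ ℕ.* ‖ a ‖ ℕ.+ M ℕ.* M ℕ.* (‖ b ‖ ℕ.* ‖ b ‖) ℕ.+ 2 ℕ.* (M ℕ.* (‖ a ‖ ℕ.* ‖ b ‖))
        ≡⟨ solve 3 (λ M a b → a :* a :+ M :* M :* (b :* b) :+ con 2 :* (M :* (a :* b))
                                := (a :+ M :* b) :* (a :+ M :* b))
             ≡.refl M (‖ a ‖) (‖ b ‖) ⟩
      (‖ a ‖ ℕ.+ M ℕ.* ‖ b ‖) ℕ.* (‖ a ‖ ℕ.+ M ℕ.* ‖ b ‖) ∎
      where open +-*-Solver

    ‖iterNorm‖≤ : {ns : Vec ℕ (suc m)} → All (λ n → n ℕ.≤ M ℕ.* M) ns → (z : Multi (suc m)) →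
                  ‖ iterNorm ns z ‖ ℕ.≤ ‖ z ‖ ℕ.^ (2 ℕ.^ m)
    ‖iterNorm‖≤ (_ ∷ []) z = ℕ.≤-reflexive (≡.sym (ℕ.*-identityʳ _))
    ‖iterNorm‖≤ {m = suc m} {ns = n ∷ n′ ∷ ns} (n≤ ∷ n′≤ ∷ ns≤) z = begin
      ‖ iterNorm (n′ ∷ ns) (norm n (n′ ∷ ns) z) ‖ ≤⟨ ‖iterNorm‖≤ (n′≤ ∷ ns≤) (norm n (n′ ∷ ns) z) ⟩
      ‖ norm n (n′ ∷ ns) z ‖ ℕ.^ (2 ℕ.^ m)        ≤⟨ ℕ.^-monoˡ-≤ (2 ℕ.^ m) (‖norm‖≤ (n≤ ∷ n′≤ ∷ ns≤) z) ⟩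
      (‖ z ‖ ℕ.* ‖ z ‖) ℕ.^ (2 ℕ.^ m)
          ≡⟨ ≡.cong (λ w → (‖ z ‖ ℕ.* w) ℕ.^ (2 ℕ.^ m)) (≡.sym (ℕ.*-identityʳ (‖ z ‖))) ⟩
      (‖ z ‖ ℕ.^ 2) ℕ.^ (2 ℕ.^ m)                 ≡⟨ ℕ.^-*-assoc (‖ z ‖) 2 (2 ℕ.^ m) ⟩
      ‖ z ‖ ℕ.^ (2 ℕ.^ suc m)                     ∎

  -- x₁ + ⋯ + xₘ₊₁ has size (m + 1) M, and each of the m norms at most squares the size.
  ∣signProduct∣≤ : ∀ M {ns : Vec ℕ (suc m)} → All (λ n → n ℕ.≤ M ℕ.* M) ns →
                   ∣ signProduct ns ∣ ℕ.≤ (suc m ℕ.* M) ℕ.^ (2 ℕ.^ m)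
  ∣signProduct∣≤ {m = m} M {ns} ns≤ = begin
    ∣ signProduct ns ∣             ≤⟨ ℕ.m≤m+n _ _ ⟩
    ‖ iterNorm ns rootSum ‖        ≤⟨ ‖iterNorm‖≤ ns≤ rootSum ⟩
    ‖ rootSum {suc m} ‖ ℕ.^ (2 ℕ.^ m) ≡⟨ ≡.cong (ℕ._^ (2 ℕ.^ m)) (‖rootSum‖ {suc m}) ⟩
    (suc m ℕ.* M) ℕ.^ (2 ℕ.^ m)    ∎
    where open Size M
          open ℕ.≤-Reasoning

-- Quadratic towers over ℚ and the nonvanishing of the sign product.

module SquareRootFields where
  open SquareRootAdjunction
  open SignProducts
  open import Data.Nat.Base as ℕ using (ℕ; zero; suc)
  import Data.Nat.Properties as ℕ
  import Data.Nat.Divisibility as ℕ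
  import Data.Nat.Coprimality as ℕ
  import Data.Nat.GCD as ℕ
  import Data.Nat.DivMod as ℕ
  open import Data.Nat.Solver using (module +-*-Solver)
  open import Data.Vec.Base using (Vec; []; _∷_)
  open import Data.Vec.Relation.Unary.All using (All; []; _∷_)
  open import Data.Product.Base using (_×_; _,_; proj₁; ∃; ∃₂; Σ-syntax)
  open import Data.Sum.Base using (_⊎_; inj₁; inj₂)
  open import Data.Integer.Base as ℤ using (ℤ; +_; 0ℤ; 1ℤ; ∣_∣)
  import Data.Integer.Properties as ℤ
  open import Data.Rational.Unnormalised.Base as ℚᵘ using (ℚᵘ; mkℚᵘ; *≡*)
  import Data.Rational.Unnormalised.Properties as ℚᵘ
  open import Relation.Nullary using (¬_; Dec; yes; no; contradiction)
  open import Relation.Nullary.Decidable using (¬¬-excluded-middle)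
  open import Relation.Nullary.Decidable.Core using (_×-dec_)
  open import Relation.Binary.PropositionalEquality as ≡ using (_≡_; _≢_)

  IsSquare : ℕ → Set
  IsSquare n = ∃ λ k → k ℕ.* k ≡ n

  -- TraceZero stands for the kernel of the ℚ-linear trace.
  record SqrtField : Set₁ where
    field
      algebra : ℤ-Algebra
    open ℤ-Algebra algebra public
    field
      _≟_     : ∀ x y → Dec (x ≈ y)
      inverse : ∀ {x} → ¬ x ≈ 0# → ∃ λ y → x * y ≈ 1#
      TraceZero      : Carrier → Set
      TraceZero-resp : ∀ {x y} → x ≈ y → TraceZero x → TraceZero y
      TraceZero-0    : TraceZero 0#
      TraceZero-+    : ∀ {x y} → TraceZero x → TraceZero y → TraceZero (x + y)
      TraceZero-√    : ∀ {m x} → ¬ IsSquare m → x * x ≈ ι (+ m) → TraceZero x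
      TraceZero-ι    : ∀ {k} → TraceZero (ι k) → k ≡ 0ℤ

    noZeroDivisors : ∀ {x y} → x * y ≈ 0# → x ≈ 0# ⊎ y ≈ 0#
    noZeroDivisors {x} {y} xy≈0 with x ≟ 0#
    ... | yes x≈0 = inj₁ x≈0
    ... | no x≉0 with inverse x≉0
    ...   | x⁻¹ , xx⁻¹≈1 = inj₂ (begin
      y               ≈⟨ sym (*-identityˡ y) ⟩
      1# * y          ≈⟨ *-congʳ (sym xx⁻¹≈1) ⟩
      x * x⁻¹ * y     ≈⟨ solve 3 (λ a b c → a :* b :* c := b :* (a :* c)) refl x x⁻¹ y ⟩
      x⁻¹ * (x * y)   ≈⟨ *-congˡ xy≈0 ⟩
      x⁻¹ * 0#        ≈⟨ zeroʳ x⁻¹ ⟩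
      0#              ∎)
      where open import Relation.Binary.Reasoning.Setoid setoid

    -- The trace axioms entail characteristic zero, since 0 has trace zero.
    ι-injective₀ : ∀ {k} → ι k ≈ 0# → k ≡ 0ℤ
    ι-injective₀ e = TraceZero-ι (TraceZero-resp (sym e) TraceZero-0)

    x+x≈0⇒x≈0 : ∀ {x} → x + x ≈ 0# → x ≈ 0#
    x+x≈0⇒x≈0 {x} e with noZeroDivisors {ι (+ 2)} {x} (trans (*-congʳ (trans (ι-+ 1ℤ 1ℤ) (+-cong ι-1 ι-1)))
        (trans (solve 1 (λ x → (con 1 :+ con 1) :* x := x :+ x) refl x) e))
    ... | inj₂ x≈0 = x≈0
    ... | inj₁ 2≈0 with () ← ι-injective₀ 2≈0

  module _ (F : SqrtField) (d : ℕ) (d-nonsquare : ¬ ∃ λ x → SqrtField._≈_ F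
              (SqrtField._*_ F x x) (SqrtField.ι F (+ d))) where
    open SqrtField F
    open import Relation.Binary.Reasoning.Setoid setoid
    private
      δ = ι (+ d)
      module E = ℤ-Algebra (Adjoin.algebra algebra δ)

    -- If a² = d b² with b invertible, then a / b is a square root of d; if b = 0, then a² = 0.
    norm-nonzero : ∀ {a b} → ¬ (a , b) E.≈ E.0# → ¬ a * a + - (δ * (b * b)) ≈ 0#
    norm-nonzero {a} {b} ab≉0 e with b ≟ 0#
    ... | yes b≈0 = ab≉0 (a≈0 , b≈0)
      where
      a²≈0 : a * a ≈ 0#
      a²≈0 = begin
        a * a                      ≈⟨ sym (trans (+-congˡ -0#≈0#) (+-identityʳ _)) ⟩
        a * a + - 0#
            ≈⟨ +-congˡ (-‿cong (sym (trans (*-congˡ (trans (*-congʳ b≈0) (zeroˡ b))) (zeroʳ δ)))) ⟩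
        a * a + - (δ * (b * b))    ≈⟨ e ⟩
        0#                         ∎
      a≈0 : a ≈ 0#
      a≈0 with noZeroDivisors a²≈0
      ... | inj₁ z = z
      ... | inj₂ z = z
    ... | no b≉0 with inverse b≉0
    ...   | c , bc≈1 = d-nonsquare (a * c , (begin
        (a * c) * (a * c)         ≈⟨ solve 2 (λ a c → (a :* c) :* (a :* c) := (a :* a) :* (c :* c)) refl a c ⟩
        (a * a) * (c * c)         ≈⟨ *-congʳ (trans (+-inverseˡ-unique _ _ e) (-‿involutive _)) ⟩
        (δ * (b * b)) * (c * c)
            ≈⟨ solve 3 (λ d b c → (d :* (b :* b)) :* (c :* c) := d :* ((b :* c) :* (b :* c))) refl δ b c ⟩
        δ * ((b * c) * (b * c))   ≈⟨ *-congˡ (*-cong bc≈1 bc≈1) ⟩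
        δ * (1# * 1#)             ≈⟨ trans (*-congˡ (*-identityˡ 1#)) (*-identityʳ δ) ⟩
        δ                         ∎))

    -- The trace of a + b √d down to the smaller field is 2 a, so in characteristic zero its kernel
    -- is read off from a alone.
    adjoin : SqrtField
    adjoin = record
      { algebra = Adjoin.algebra algebra δ
      ; _≟_ = λ (a , b) (c , e) → (a ≟ c) ×-dec (b ≟ e)
      ; inverse = inverse′
      ; TraceZero = λ (a , _) → TraceZero a
      ; TraceZero-resp = λ (e , _) → TraceZero-resp e
      ; TraceZero-0 = TraceZero-0
      ; TraceZero-+ = TraceZero-+
      ; TraceZero-√ = trace-√
      ; TraceZero-ι = TraceZero-ι
      }
      where
      inverse′ : ∀ {x} → ¬ x E.≈ E.0# → ∃ λ y → x E.* y E.≈ E.1#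
      inverse′ {a , b} ab≉0 with inverse (norm-nonzero ab≉0)
      ... | w , Nw≈1 = (a * w , - b * w) , (begin
          a * (a * w) + δ * (b * (- b * w))
            ≈⟨ solve 5 (λ d a b w c → a :* (a :* w) :+ d :* (b :* (c :* w)) := (a :* a :+ d :* (b :* c)) :* w)
                 refl δ a b w (- b) ⟩
          (a * a + δ * (b * - b)) * w
            ≈⟨ *-congʳ (+-congˡ (trans (*-congˡ (sym (-‿distribʳ-* b b))) (sym (-‿distribʳ-* δ (b * b))))) ⟩
          (a * a + - (δ * (b * b))) * w
            ≈⟨ Nw≈1 ⟩
          1# ∎) , (begin
          a * (- b * w) + b * (a * w)
            ≈⟨ solve 4 (λ a b w c → a :* (c :* w) :+ b :* (a :* w) := (c :+ b) :* (a :* w)) refl a b w (- b) ⟩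
          (- b + b) * (a * w)   ≈⟨ trans (*-congʳ (-‿inverseˡ b)) (zeroˡ _) ⟩
          0# ∎)

      -- If (a + b √d)² is an integer, then 2 a b = 0. Either a = 0 and the trace vanishes, or b = 0
      -- and the root already lies in the smaller field.
      trace-√ : ∀ {m x} → ¬ IsSquare m → x E.* x E.≈ E.ι (+ m) → TraceZero (proj₁ x)
      trace-√ {m} {a , b} m-nonsquare (e₁ , e₂)
        with noZeroDivisors (x+x≈0⇒x≈0 (trans (+-congˡ (*-comm a b)) e₂))
      ... | inj₁ a≈0 = TraceZero-resp (sym a≈0) TraceZero-0
      ... | inj₂ b≈0 = TraceZero-√ m-nonsquare (begin
        a * a
            ≈⟨ sym (trans (+-congˡ (trans (*-congˡ (trans (*-congʳ b≈0) (zeroˡ b))) (zeroʳ δ))) (+-identityʳ _)) ⟩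
        a * a + δ * (b * b)    ≈⟨ e₁ ⟩
        ι (+ m)                ∎)

    adjoin-root : Root (SqrtField.algebra adjoin) d
    adjoin-root = (0# , 1#) ,
        solve 1 (λ d → con 0 :* con 0 :+ d :* (con 1 :* con 1) := d) refl δ
      , solve 0 (con 0 :* con 1 :+ con 1 :* con 0 := con 0) refl

    lift-roots : ∀ {m} {ns : Vec ℕ m} → Roots algebra ns → Roots (SqrtField.algebra adjoin) ns
    lift-roots []               = []
    lift-roots ((r , e) ∷ rs)  = ((r , 0#) ,
        trans (solve 2 (λ d r → r :* r :+ d :* (con 0 :* con 0) := r :* r) refl δ r) e
      , solve 1 (λ r → r :* con 0 :+ con 0 :* r := con 0) refl r) ∷ lift-roots rs

  reduce : ∀ n k .{{_ : ℕ.NonZero n}} → ∃ λ g → ∃₂ λ n′ k′ →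
           ℕ.NonZero g × n ≡ n′ ℕ.* g × k ≡ k′ ℕ.* g × ℕ.Coprime n′ k′
  reduce n k = ℕ.gcd n k , n ℕ./ ℕ.gcd n k , k ℕ./ ℕ.gcd n k , g≢0
    , ≡.sym (ℕ.m/n*n≡m (ℕ.gcd[m,n]∣m n k)) , ≡.sym (ℕ.m/n*n≡m (ℕ.gcd[m,n]∣n n k))
    , ℕ.coprime-/gcd n k
    where
    instance
      g≢0 : ℕ.NonZero (ℕ.gcd n k)
      g≢0 = ℕ.≢-nonZero (ℕ.gcd[m,n]≢0 n k (inj₁ (ℕ.≢-nonZero⁻¹ n)))

  -- After division by the gcd, n′ divides k′ k′ and is coprime to k′, hence n′ = 1 and n is the
  -- gcd.
  n²∣k²⇒n∣k : ∀ c n k .{{_ : ℕ.NonZero n}} → c ℕ.* (n ℕ.* n) ≡ k ℕ.* k → n ℕ.∣ k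
  n²∣k²⇒n∣k c n k e with reduce n k
  ... | g , n′ , k′ , g≢0 , ≡.refl , ≡.refl , coprime =
    ≡.subst (λ a → a ℕ.* g ℕ.∣ k′ ℕ.* g) (≡.sym n′≡1) (ℕ.divides k′ (≡.cong (k′ ℕ.*_) (≡.sym (ℕ.*-identityˡ g))))
    where
    instance _ = g≢0
             _ = ℕ.m*n≢0 g g
    open +-*-Solver
    e′ : c ℕ.* (n′ ℕ.* n′) ≡ k′ ℕ.* k′
    e′ = ℕ.*-cancelʳ-≡ _ _ (g ℕ.* g) (≡.trans
      (solve 3 (λ c n g → c :* (n :* n) :* (g :* g) := c :* ((n :* g) :* (n :* g))) ≡.refl c n′ g)
      (≡.trans e (solve 2 (λ k g → (k :* g) :* (k :* g) := k :* k :* (g :* g)) ≡.refl k′ g)))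
    n′∣k′k′ : n′ ℕ.∣ k′ ℕ.* k′
    n′∣k′k′ = ℕ.divides (c ℕ.* n′) (≡.trans (≡.sym e′) (≡.sym (ℕ.*-assoc c n′ n′)))
    n′≡1 : n′ ≡ 1
    n′≡1 = coprime (ℕ.∣-refl , ℕ.coprime-divisor coprime n′∣k′k′)

  -- An integer that is the square of the rational k / n is the square of an integer.
  square-cancel : ∀ c n k .{{_ : ℕ.NonZero n}} → c ℕ.* (n ℕ.* n) ≡ k ℕ.* k → IsSquare c
  square-cancel c n k e with n²∣k²⇒n∣k c n k e
  ... | ℕ.divides t ≡.refl = t , ≡.sym (ℕ.*-cancelʳ-≡ c (t ℕ.* t) (n ℕ.* n) (≡.trans e
    (solve 2 (λ t n → (t :* n) :* (t :* n) := t :* t :* (n :* n)) ≡.refl t n)))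
    where
    instance _ = ℕ.m*n≢0 n n
    open +-*-Solver

  isSquare? : ∀ n → Dec (IsSquare n)
  isSquare? n with ℕ.anyUpTo? (λ k → k ℕ.* k ℕ.≟ n) (suc n)
  ... | yes (k , _ , e) = yes (k , e)
  ... | no none = no λ where
    (zero , e)  → none (0 , ℕ.s≤s ℕ.z≤n , e)
    (suc k , e) → none (suc k , ℕ.s≤s (≡.subst (suc k ℕ.≤_) e (ℕ.m≤m*n (suc k) (suc k))) , e)

  ℚ-algebra : ℤ-Algebra
  ℚ-algebra = record
    { commutativeRing = ℚᵘ.+-*-commutativeRing
    ; ι = λ k → mkℚᵘ k 0
    ; ι-0 = ℚᵘ.≃-refl
    ; ι-1 = ℚᵘ.≃-refl
    ; ι-+ = λ x y → *≡* (≡.cong (ℤ._* 1ℤ) (≡.sym (≡.cong₂ ℤ._+_ (ℤ.*-identityʳ x) (ℤ.*-identityʳ y))))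
    ; ι-* = λ x y → *≡* ≡.refl
    }

  -- The base of the tower: the trace is the identity, and a nonsquare integer has no rational root.
  ℚ-sqrtField : SqrtField
  ℚ-sqrtField = record
    { algebra = ℚ-algebra
    ; _≟_ = ℚᵘ._≃?_
    ; inverse = inverse′
    ; TraceZero = _≃0
    ; TraceZero-resp = resp
    ; TraceZero-0 = ℚᵘ.≃-refl
    ; TraceZero-+ = plus
    ; TraceZero-√ = λ {m} {x} m-nonsquare e → contradiction (root m x e) m-nonsquare
    ; TraceZero-ι = λ { {k} (*≡* e) → ≡.trans (≡.sym (ℤ.*-identityʳ k)) e }
    }
    where
    _≃0 : ℚᵘ → Set
    x ≃0 = x ℚᵘ.≃ ℚᵘ.0ℚᵘ
    inverse′ : ∀ {x} → ¬ x ≃0 → ∃ λ y → x ℚᵘ.* y ℚᵘ.≃ ℚᵘ.1ℚᵘ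
    inverse′ {x} x≄0 = ℚᵘ.1/ x , ℚᵘ.*-inverseʳ x
      where instance _ = ℚᵘ.≢-nonZero x≄0
    resp : ∀ {x y} → x ℚᵘ.≃ y → x ≃0 → y ≃0
    resp x≃y x≃0 = ℚᵘ.≃-trans (ℚᵘ.≃-sym x≃y) x≃0
    plus : ∀ {x y} → x ≃0 → y ≃0 → (x ℚᵘ.+ y) ≃0
    plus {x} {y} x≃0 y≃0 = ℚᵘ.≃-trans {x ℚᵘ.+ y} {ℚᵘ.0ℚᵘ ℚᵘ.+ ℚᵘ.0ℚᵘ} (ℚᵘ.+-cong {x} {ℚᵘ.0ℚᵘ} {y} x≃0 y≃0)
        (ℚᵘ.+-identityˡ ℚᵘ.0ℚᵘ)
    root : ∀ m x → x ℚᵘ.* x ℚᵘ.≃ mkℚᵘ (+ m) 0 → IsSquare m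
    root m (mkℚᵘ p d-1) (*≡* e) = square-cancel m (suc d-1) ∣ p ∣ (≡.sym (begin
      ∣ p ∣ ℕ.* ∣ p ∣                      ≡⟨ ℤ.∣i*j∣≡∣i∣*∣j∣ p p ⟨
      ∣ p ℤ.* p ∣                          ≡⟨ ≡.cong ∣_∣ (ℤ.*-identityʳ (p ℤ.* p)) ⟨
      ∣ p ℤ.* p ℤ.* 1ℤ ∣                   ≡⟨ ≡.cong ∣_∣ e ⟩
      ∣ + m ℤ.* + (suc d-1 ℕ.* suc d-1) ∣  ≡⟨ ℤ.∣i*j∣≡∣i∣*∣j∣ (+ m) (+ (suc d-1 ℕ.* suc d-1)) ⟩
      m ℕ.* (suc d-1 ℕ.* suc d-1)          ∎))
      where open ≡.≡-Reasoning

  -- Whether n already has a root in F is not decided; each step takes excluded middle under a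
  -- double negation. This suffices because the towers serve only to refute an equation.
  ¬¬-sqrtField : ∀ {m} (ns : Vec ℕ m) → ¬ ¬ (Σ[ F ∈ SqrtField ] Roots (SqrtField.algebra F) ns)
  ¬¬-sqrtField []       none = none (ℚ-sqrtField , [])
  ¬¬-sqrtField (n ∷ ns) none = ¬¬-sqrtField ns λ (F , rs) →
    let open SqrtField F in
    ¬¬-excluded-middle {A = ∃ λ x → x * x ≈ ι (+ n)} λ where
      (yes root)       → none (F , root ∷ rs)
      (no n-nonsquare) → none (adjoin F n n-nonsquare
                             , adjoin-root F n n-nonsquare ∷ lift-roots F n n-nonsquare rs)

  -- A vanishing sum r + ∑ sₗ = 0 with r² = n gives - n = ∑ r sₗ. Each r sₗ squares to the nonsquare
  -- n nₗ and has trace zero, so - n has trace zero, that is, n = 0.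
  signProduct≢0 : ∀ {m} n .{{_ : ℕ.NonZero n}} (ns : Vec ℕ (suc m)) →
                  All (λ k → ¬ IsSquare (n ℕ.* k)) ns → signProduct (n ∷ ns) ≢ 0ℤ
  signProduct≢0 n ns independent P≡0 = ¬¬-sqrtField (n ∷ ns) λ (F , rs) →
    let open SqrtField F in noVanishingSum F (signProduct≡0⇒sumRoots≈0 noZeroDivisors {n ∷ ns} rs P≡0)
    where
    module _ (F : SqrtField) where
      open SqrtField F
      open import Relation.Binary.Reasoning.Setoid setoid
      open import Data.Empty using (⊥)

      trace-sum : ∀ {r} → r * r ≈ ι (+ n) → ∀ {m} {ns : Vec ℕ m} → All (λ k → ¬ IsSquare (n ℕ.* k)) ns →
                  (rs : Roots algebra ns) → TraceZero (r * sumRoots rs)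
      trace-sum {r} r² []         []              = TraceZero-resp (sym (zeroʳ r)) TraceZero-0
      trace-sum {r} r² {ns = k ∷ ns} (nk ∷ nks) ((s , s²) ∷ rs) = TraceZero-resp (sym (distribˡ r s _))
        (TraceZero-+ (TraceZero-√ nk (begin
          (r * s) * (r * s)   ≈⟨ solve 2 (λ r s → (r :* s) :* (r :* s) := (r :* r) :* (s :* s)) refl r s ⟩
          (r * r) * (s * s)   ≈⟨ *-cong r² s² ⟩
          ι (+ n) * ι (+ k)   ≈⟨ sym (ι-* (+ n) (+ k)) ⟩
          ι (+ n ℤ.* + k)     ≈⟨ reflexive (≡.cong ι (≡.sym (ℤ.pos-* n k))) ⟩
          ι (+ (n ℕ.* k))     ∎)) (trace-sum r² nks rs))

      noVanishingSum : ∃ (λ (rs : Roots algebra (n ∷ ns)) → sumRoots rs ≈ 0#) → ⊥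
      noVanishingSum ((r , r²) ∷ rs , sum≈0) = ℕ.≢-nonZero⁻¹ n (ℤ.+-injective
        (≡.trans (≡.sym (ℤ.neg-involutive (+ n))) (≡.cong ℤ.-_ (TraceZero-ι (TraceZero-resp (begin
          r * sumRoots rs    ≈⟨ *-congˡ (+-inverseˡ-unique _ _ (trans (+-comm _ _) sum≈0)) ⟩
          r * - r            ≈⟨ sym (-‿distribʳ-* r r) ⟩
          - (r * r)          ≈⟨ -‿cong r² ⟩
          - ι (+ n)          ≈⟨ sym (ι-neg (+ n)) ⟩
          ι (ℤ.- + n)        ∎) (trace-sum r² independent rs))))))

-- Zero sums of square roots modulo q.

module ModularRoots where
  open SquareRootAdjunction
  open SignProducts
  open SquareRootFields
  open import Data.Nat.Base as ℕ using (ℕ; zero; suc)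
  import Data.Nat.Properties as ℕ
  import Data.Nat.Divisibility as ℕ
  open import Data.Nat.Primality using (Prime)
  import Data.Nat.Coprimality as ℕ
  import Data.Nat.GCD as ℕ
  open import Data.List.Base using (List; []; _∷_; map; length; foldr)
  open import Data.List.Relation.Unary.All as All using (All; []; _∷_)
  open import Data.List.Relation.Unary.All.Properties using (¬Any⇒All¬)
  open import Data.List.Relation.Unary.Any using (Any; any?)
  open import Data.Vec.Base using (Vec; []; _∷_; fromList)
  import Data.Vec.Relation.Unary.All as Vec using (All; []; _∷_)
  open import Data.Product.Base using (_×_; _,_; proj₁; proj₂; ∃)
  open import Data.Integer.Base as ℤ using (ℤ; +_; 0ℤ; 1ℤ; ∣_∣)
  import Data.Integer.Properties as ℤ
  open import Data.Integer.Divisibility.Signed as ℤ using (divides)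
  open import Data.Integer.Tactic.RingSolver using (solve-∀)
  open import Function.Base using (_∘_)
  open import Relation.Nullary using (¬_; contradiction)
  open import Relation.Nullary.Decidable using (decidable-stable)
  open import Relation.Binary.PropositionalEquality as ≡ using (_≡_)

  valueSum : List (ℤ × ℕ) → ℤ
  valueSum = foldr (λ x s → proj₁ x ℤ.+ s) 0ℤ

  module Congruence (q : ℕ) where

    infix 4 _≈_
    record _≈_ (x y : ℤ) : Set where
      constructor mod
      field
        q∣x-y : + q ℤ.∣ x ℤ.- y
    open _≈_

    ≡⇒≈ : ∀ {x y} → x ≡ y → x ≈ y
    ≡⇒≈ {x} ≡.refl = mod (divides 0ℤ (ℤ.+-inverseʳ x))

    ≈-sym : ∀ {x y} → x ≈ y → y ≈ x
    ≈-sym {x} {y} (mod (divides k e)) = mod (divides (ℤ.- k)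
      (≡.trans (swap x y) (≡.trans (≡.cong ℤ.-_ e) (ℤ.neg-distribˡ-* k (+ q)))))
      where swap : ∀ x y → y ℤ.- x ≡ ℤ.- (x ℤ.- y)
            swap = solve-∀

    ≈-trans : ∀ {x y z} → x ≈ y → y ≈ z → x ≈ z
    ≈-trans {x} {y} {z} (mod d) (mod e) = mod (≡.subst (+ q ℤ.∣_) (telescope x y z) (ℤ.∣m∣n⇒∣m+n d e))
      where telescope : ∀ x y z → (x ℤ.- y) ℤ.+ (y ℤ.- z) ≡ x ℤ.- z
            telescope = solve-∀

    +-cong : ∀ {x y u v} → x ≈ y → u ≈ v → x ℤ.+ u ≈ y ℤ.+ v
    +-cong {x} {y} {u} {v} (mod d) (mod e) = mod (≡.subst (+ q ℤ.∣_) (regroup x y u v) (ℤ.∣m∣n⇒∣m+n d e))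
      where regroup : ∀ x y u v → (x ℤ.- y) ℤ.+ (u ℤ.- v) ≡ (x ℤ.+ u) ℤ.- (y ℤ.+ v)
            regroup = solve-∀

    *-cong : ∀ {x y u v} → x ≈ y → u ≈ v → x ℤ.* u ≈ y ℤ.* v
    *-cong {x} {y} {u} {v} (mod d) (mod e) = mod (≡.subst (+ q ℤ.∣_) (regroup x y u v)
        (ℤ.∣m∣n⇒∣m+n (ℤ.∣m⇒∣m*n u d) (ℤ.∣n⇒∣m*n y e)))
      where regroup : ∀ x y u v → (x ℤ.- y) ℤ.* u ℤ.+ y ℤ.* (u ℤ.- v) ≡ x ℤ.* u ℤ.- y ℤ.* v
            regroup = solve-∀

    neg-cong : ∀ {x y} → x ≈ y → ℤ.- x ≈ ℤ.- y
    neg-cong {x} {y} (mod d) = mod (≡.subst (+ q ℤ.∣_) (regroup x y) (ℤ.∣m⇒∣-m d))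
      where regroup : ∀ x y → ℤ.- (x ℤ.- y) ≡ ℤ.- x ℤ.- ℤ.- y
            regroup = solve-∀

    ≈0⇒≡0 : ∀ {x} → x ≈ 0ℤ → ∣ x ∣ ℕ.< q → x ≡ 0ℤ
    ≈0⇒≡0 {x} (mod d) ∣x∣<q with ∣ x ∣ in e
    ... | zero  = ℤ.∣i∣≡0⇒i≡0 e
    ... | suc k = contradiction
      (ℕ.∣⇒≤ (≡.subst (q ℕ.∣_) (≡.trans (≡.cong ∣_∣ (ℤ.+-identityʳ x)) e) (ℤ.∣⇒∣ᵤ d)))
      (ℕ.<⇒≱ ∣x∣<q)

    algebra : ℤ-Algebra
    algebra = record
      { commutativeRing = record
        { Carrier = ℤ
        ; _≈_ = _≈_
        ; _+_ = ℤ._+_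
        ; _*_ = ℤ._*_
        ; -_  = ℤ.-_
        ; 0#  = 0ℤ
        ; 1#  = 1ℤ
        ; isCommutativeRing = record
          { isRing = record
            { +-isAbelianGroup = record
              { isGroup = record
                { isMonoid = record
                  { isSemigroup = record
                    { isMagma = record
                      { isEquivalence = record
                        { refl = ≡⇒≈ ≡.refl
                        ; sym = ≈-sym
                        ; trans = λ {x} {y} {z} → ≈-trans {x} {y} {z}
                        }
                      ; ∙-cong = λ {x} {y} {u} {v} → +-cong {x} {y} {u} {v}
                      }
                    ; assoc = λ x y z → ≡⇒≈ (ℤ.+-assoc x y z)
                    }
                  ; identity = (≡⇒≈ ∘ ℤ.+-identityˡ) , (≡⇒≈ ∘ ℤ.+-identityʳ)
                  }
                ; inverse = (≡⇒≈ ∘ ℤ.+-inverseˡ) , (≡⇒≈ ∘ ℤ.+-inverseʳ)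
                ; ⁻¹-cong = neg-cong
                }
              ; comm = λ x y → ≡⇒≈ (ℤ.+-comm x y)
              }
            ; *-cong = λ {x} {y} {u} {v} → *-cong {x} {y} {u} {v}
            ; *-assoc = λ x y z → ≡⇒≈ (ℤ.*-assoc x y z)
            ; *-identity = (≡⇒≈ ∘ ℤ.*-identityˡ) , (≡⇒≈ ∘ ℤ.*-identityʳ)
            ; distrib = (λ x y z → ≡⇒≈ (ℤ.*-distribˡ-+ x y z)) , (λ x y z → ≡⇒≈ (ℤ.*-distribʳ-+ x y z))
            }
          ; *-comm = λ x y → ≡⇒≈ (ℤ.*-comm x y)
          }
        }
      ; ι = λ x → x
      ; ι-0 = ≡⇒≈ ≡.refl
      ; ι-1 = ≡⇒≈ ≡.refl
      ; ι-+ = λ x y → ≡⇒≈ ≡.refl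
      ; ι-* = λ x y → ≡⇒≈ ≡.refl
      }

    inverse : Prime q → ∀ j .{{_ : ℕ.NonZero j}} → j ℕ.< q → ∃ λ j⁻¹ → j⁻¹ ℤ.* + j ≈ 1ℤ
    inverse q-prime j j<q with ℕ.coprime-Bézout (ℕ.prime⇒coprime q-prime j<q)
    ... | ℕ.Bézout.+- x y e = ℤ.- + y , mod (divides (ℤ.- + x) (begin
        ℤ.- + y ℤ.* + j ℤ.- 1ℤ         ≡⟨ ring₁ (+ y) (+ j) ⟩
        ℤ.- (1ℤ ℤ.+ + y ℤ.* + j)       ≡⟨ ≡.cong (λ z → ℤ.- (1ℤ ℤ.+ z)) (ℤ.pos-* y j) ⟨
        ℤ.- (+ (1 ℕ.+ y ℕ.* j))        ≡⟨ ≡.cong (λ z → ℤ.- + z) e ⟩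
        ℤ.- (+ (x ℕ.* q))              ≡⟨ ≡.cong ℤ.-_ (ℤ.pos-* x q) ⟩
        ℤ.- (+ x ℤ.* + q)              ≡⟨ ℤ.neg-distribˡ-* (+ x) (+ q) ⟩
        ℤ.- + x ℤ.* + q                ∎))
      where open ≡.≡-Reasoning
            ring₁ : ∀ y j → ℤ.- y ℤ.* j ℤ.- 1ℤ ≡ ℤ.- (1ℤ ℤ.+ y ℤ.* j)
            ring₁ = solve-∀
    ... | ℕ.Bézout.-+ x y e = + y , mod (divides (+ x) (begin
        + y ℤ.* + j ℤ.- 1ℤ             ≡⟨ ≡.cong (ℤ._- 1ℤ) (ℤ.pos-* y j) ⟨
        + (y ℕ.* j) ℤ.- 1ℤ             ≡⟨ ≡.cong (λ z → + z ℤ.- 1ℤ) e ⟨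
        + (x ℕ.* q)                    ≡⟨ ℤ.pos-* x q ⟩
        + x ℤ.* + q                    ∎))
      where open ≡.≡-Reasoning

    module Twisted (q-prime : Prime q) (j : ℕ) .{{j≢0 : ℕ.NonZero j}} (j<q : j ℕ.< q) where

      IsRoot : ℤ × ℕ → Set
      IsRoot (x , n) = x ℤ.* x ≈ + n ℤ.* + j

      private
        j⁻¹ = proj₁ (inverse q-prime j j<q)
        module E = ℤ-Algebra (Adjoin.algebra algebra j⁻¹)
        module Z = ℤ-Algebra algebra

      -- j need not be a square mod q, so √j⁻¹ is adjoined to turn b² = n j into
      -- (b √j⁻¹)² = n.
      toRoots : {xs : List (ℤ × ℕ)} → All IsRoot xs → Roots (Adjoin.algebra algebra j⁻¹) (fromList (map proj₂ xs))
      toRoots []       = []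
      toRoots {(x , n) ∷ xs} (x² ∷ rest) = ((0ℤ , x) , square , Z.reflexive (vanish x)) ∷ toRoots rest
        where
        vanish : ∀ x → 0ℤ ℤ.* x ℤ.+ x ℤ.* 0ℤ ≡ 0ℤ
        vanish = solve-∀
        regroup : ∀ i n j → i ℤ.* (n ℤ.* j) ≡ n ℤ.* (i ℤ.* j)
        regroup = solve-∀
        open import Relation.Binary.Reasoning.Setoid Z.setoid
        square : 0ℤ ℤ.* 0ℤ ℤ.+ j⁻¹ ℤ.* (x ℤ.* x) ≈ + n
        square = begin
          0ℤ ℤ.* 0ℤ ℤ.+ j⁻¹ ℤ.* (x ℤ.* x)  ≈⟨ Z.reflexive (ℤ.+-identityˡ _) ⟩
          j⁻¹ ℤ.* (x ℤ.* x)                ≈⟨ Z.*-congˡ {j⁻¹} x² ⟩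
          j⁻¹ ℤ.* (+ n ℤ.* + j)            ≈⟨ Z.reflexive (regroup j⁻¹ (+ n) (+ j)) ⟩
          + n ℤ.* (j⁻¹ ℤ.* + j)            ≈⟨ Z.*-congˡ {+ n} (proj₂ (inverse q-prime j j<q)) ⟩
          + n ℤ.* 1ℤ                       ≈⟨ Z.reflexive (ℤ.*-identityʳ (+ n)) ⟩
          + n                              ∎

      sum-toRoots : {xs : List (ℤ × ℕ)} (rs : All IsRoot xs) → sumRoots (toRoots rs) E.≈ (0ℤ , valueSum xs)
      sum-toRoots []       = E.refl
      sum-toRoots {(x , n) ∷ xs} (x² ∷ rs) = E.trans {_} {(0ℤ ℤ.+ 0ℤ , x ℤ.+ valueSum xs)}
        (E.+-cong {(0ℤ , x)} E.refl (sum-toRoots rs)) E.refl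

      -- Multiplied by √j⁻¹, the zero sum becomes a vanishing sum of roots of the labels, so q
      -- divides the sign product; being smaller than q in absolute value, the product is 0. As
      -- squareness is decidable, refuting the absence of a partner produces one.
      partner : ∀ M x y zs → All IsRoot (x ∷ y ∷ zs) → ℕ.NonZero (proj₂ x) →
                All (λ z → proj₂ z ℕ.≤ M ℕ.* M) (x ∷ y ∷ zs) → valueSum (x ∷ y ∷ zs) ≈ 0ℤ →
                (suc (suc (length zs)) ℕ.* M) ℕ.^ (2 ℕ.^ suc (length zs)) ℕ.< q →
                Any (λ z → IsSquare (proj₂ x ℕ.* proj₂ z)) (y ∷ zs)
      partner M x y zs rs n≢0 bound sum≈0 q> = decidable-stable (any? (λ z → isSquare? _) (y ∷ zs)) λ none →
        signProduct≢0 (proj₂ x) {{n≢0}} (fromList (map proj₂ (y ∷ zs))) (independent (¬Any⇒All¬ _ none))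
          (≈0⇒≡0 (proj₁ (sumRoots≈0⇒signProduct≈0 (toRoots rs)
                    (E.trans {_} {(0ℤ , valueSum (x ∷ y ∷ zs))} (sum-toRoots rs) (Z.refl , sum≈0))))
                 (ℕ.≤-<-trans (∣signProduct∣≤ M (bounds bound))
                   (≡.subst (λ l → (suc (suc l) ℕ.* M) ℕ.^ (2 ℕ.^ suc l) ℕ.< q) (≡.sym (length-map proj₂ zs)) q>)))
        where
        open import Data.List.Properties using (length-map)
        independent : ∀ {zs : List (ℤ × ℕ)} → All (λ z → ¬ IsSquare (proj₂ x ℕ.* proj₂ z)) zs →
                      Vec.All (λ k → ¬ IsSquare (proj₂ x ℕ.* k)) (fromList (map proj₂ zs))
        independent []       = Vec.[]
        independent (h ∷ hs) = h Vec.∷ independent hs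
        bounds : ∀ {zs : List (ℤ × ℕ)} → All (λ z → proj₂ z ℕ.≤ M ℕ.* M) zs →
                 Vec.All (λ n → n ℕ.≤ M ℕ.* M) (fromList (map proj₂ zs))
        bounds []       = Vec.[]
        bounds (h ∷ hs) = h Vec.∷ bounds hs

-- Counting tuples whose entries are matched by square classes.

module SquareClassCounting where
  open SquareRootFields using (IsSquare; isSquare?; reduce; square-cancel)
  open import Data.Nat.Base as ℕ using (ℕ; zero; suc; _+_; _*_; _^_; _≤_; _<_; z≤n; s≤s; NonZero)
  import Data.Nat.Properties as ℕ
  import Data.Nat.Divisibility as ℕ
  import Data.Nat.Coprimality as ℕ
  open import Data.Nat.Solver using (module +-*-Solver)
  open import Data.List.Base using (List; []; _∷_; _++_; [_]; map; length; concatMap; upTo; applyUpTo; filter; cartesianProduct; cartesianProductWith)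
  open import Data.List.Properties using (length-map; length-++; length-upTo)
  open import Data.List.Relation.Unary.All as All using (All; []; _∷_)
  import Data.List.Relation.Unary.All.Properties as All
  open import Data.List.Relation.Unary.Any using (Any; here; there)
  import Data.List.Relation.Unary.Any.Properties as Any
  open import Data.List.Relation.Unary.Unique.Propositional using (Unique; []; _∷_)
  import Data.List.Relation.Unary.Unique.Propositional.Properties as Unique
  open import Data.List.Membership.Propositional using (_∈_; find; lose)
  open import Data.List.Membership.Propositional.Properties
  open import Data.List.Relation.Binary.Subset.Propositional using (_⊆_)
  open import Data.List.Relation.Binary.Permutation.Propositional using (_↭_; prep; swap; ↭-refl; ↭-trans)
  open import Data.List.Relation.Binary.Permutation.Propositional.Properties using (shift; Any-resp-↭)
  open import Data.Product.Base using (_×_; _,_; proj₁; proj₂; ∃; ∃₂)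
  open import Data.Sum.Base using (inj₁; inj₂)
  open import Function.Base using (_∘_; it)
  open import Relation.Nullary using (yes; no; contradiction)
  open import Relation.Binary.PropositionalEquality as ≡ using (_≡_; refl; sym; trans; cong; subst)

  private variable
    A B : Set

  unique-⊆⇒length≤ : {xs ys : List A} → Unique xs → xs ⊆ ys → length xs ≤ length ys
  unique-⊆⇒length≤ []              _     = z≤n
  unique-⊆⇒length≤ {xs = x ∷ xs} (x∉xs ∷ u) xs⊆ys with ∈-∃++ (xs⊆ys (here refl))
  ... | as , bs , refl = begin
      suc (length xs)           ≤⟨ s≤s (unique-⊆⇒length≤ u rest) ⟩
      suc (length (as ++ bs))   ≡⟨ cong suc (length-++ as) ⟩
      suc (length as + length bs) ≡⟨ ℕ.+-suc (length as) (length bs) ⟨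
      length as + suc (length bs) ≡⟨ length-++ as ⟨
      length (as ++ x ∷ bs)     ∎
    where
    open ℕ.≤-Reasoning
    rest : xs ⊆ as ++ bs
    rest {y} y∈xs with ∈-++⁻ as (xs⊆ys (there y∈xs))
    ... | inj₁ y∈as          = ∈-++⁺ˡ y∈as
    ... | inj₂ (here refl)   = contradiction refl (All.lookup x∉xs y∈xs)
    ... | inj₂ (there y∈bs)  = ∈-++⁺ʳ as y∈bs

  length-concatMap-≤ : (f : A → List B) {c : ℕ} (xs : List A) → (∀ {x} → x ∈ xs → length (f x) ≤ c) →
                       length (concatMap f xs) ≤ length xs * c
  length-concatMap-≤ f []       _ = z≤n
  length-concatMap-≤ f (x ∷ xs) h = ℕ.≤-trans (ℕ.≤-reflexive (length-++ (f x)))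
    (ℕ.+-mono-≤ (h (here refl)) (length-concatMap-≤ f xs (h ∘ there)))

  ∈-concatMap⁺′ : (f : A → List B) {x : A} {y : B} {xs : List A} → x ∈ xs → y ∈ f x → y ∈ concatMap f xs
  ∈-concatMap⁺′ f x∈xs y∈fx = ∈-concatMap⁺ f (lose x∈xs y∈fx)

  -- With k² = n m, write n = u s and k = v s, where u and v are coprime. Then u m = v² s gives v ∣
  -- m, say m = t v, and t u = v s gives u ∣ s, say s = w u; hence t = v w, n = u² w and m = v² w.
  squareClass : ∀ n m .{{_ : NonZero n}} .{{_ : NonZero m}} → IsSquare (n * m) →
                ∃ λ w → ∃₂ λ u v → n ≡ u * u * w × m ≡ v * v * w
  squareClass n m (k , k²≡nm) with reduce n k
  ... | s , u , v , s≢0 , refl , refl , coprime = split-m (ℕ.coprime-divisor (ℕ.sym coprime) (ℕ.divides (v * s) um≡vsv))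
    where
    instance _ = s≢0
             _ = ℕ.m*n≢0⇒m≢0 u
    open +-*-Solver
    um≡vsv : u * m ≡ v * s * v
    um≡vsv = ℕ.*-cancelʳ-≡ _ _ s (trans (solve 3 (λ u s m → u :* m :* s := u :* s :* m) refl u s m)
      (trans (sym k²≡nm) (solve 2 (λ v s → v :* s :* (v :* s) := v :* s :* v :* s) refl v s)))
    split-m : v ℕ.∣ m → ∃ λ w → ∃₂ λ u′ v′ → u * s ≡ u′ * u′ * w × m ≡ v′ * v′ * w
    split-m (ℕ.divides t m≡tv) = split-s (ℕ.coprime-divisor coprime (ℕ.divides t (sym tu≡vs)))
      where
      instance _ = ℕ.m*n≢0⇒n≢0 t {v} {{subst NonZero m≡tv it}}
      tu≡vs : t * u ≡ v * s
      tu≡vs = ℕ.*-cancelʳ-≡ _ _ v (trans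
        (solve 3 (λ t u v → t :* u :* v := u :* (t :* v)) refl t u v)
        (trans (cong (u *_) (sym m≡tv)) um≡vsv))
      split-s : u ℕ.∣ s → ∃ λ w → ∃₂ λ u′ v′ → u * s ≡ u′ * u′ * w × m ≡ v′ * v′ * w
      split-s (ℕ.divides w s≡wu) = w , u , v
        , trans (cong (u *_) s≡wu) (solve 2 (λ w u → u :* (w :* u) := u :* u :* w) refl w u)
        , trans m≡tv (trans (cong (_* v) t≡vw) (solve 2 (λ v w → v :* w :* v := v :* v :* w) refl v w))
        where
        t≡vw : t ≡ v * w
        t≡vw = ℕ.*-cancelʳ-≡ _ _ u (trans tu≡vs (trans (cong (v *_) s≡wu) (sym (ℕ.*-assoc v w u))))

  IsSquare-trans : ∀ {a b n} .{{_ : NonZero n}} → IsSquare (n * a) → IsSquare (n * b) → IsSquare (a * b)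
  IsSquare-trans {a} {b} {n} (k , k²) (l , l²) = square-cancel (a * b) n (k * l) (begin
    a * b * (n * n)       ≡⟨ solve 3 (λ a b n → a :* b :* (n :* n) := n :* a :* (n :* b)) refl a b n ⟩
    n * a * (n * b)       ≡⟨ ≡.cong₂ _*_ k² l² ⟨
    k * k * (l * l)       ≡⟨ solve 2 (λ k l → k :* k :* (l :* l) := k :* l :* (k :* l)) refl k l ⟩
    k * l * (k * l)       ∎)
    where open +-*-Solver
          open ≡.≡-Reasoning

  length-cartesianProductWith : ∀ {C : Set} (f : A → B → C) xs ys →
                                length (cartesianProductWith f xs ys) ≡ length xs * length ys
  length-cartesianProductWith f []       ys = refl
  length-cartesianProductWith f (x ∷ xs) ys = trans (length-++ (map (f x) ys))
    (≡.cong₂ _+_ (length-map (f x) ys) (length-cartesianProductWith f xs ys))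

  -- ⌊√(N / k)⌋
  floorSqrt : ∀ k N .{{_ : NonZero k}} → ∃ λ s → k * (s * s) ≤ N × (∀ u → k * (u * u) ≤ N → u ≤ s)
  floorSqrt k N with largest N
    where
    largest : ∀ B → ∃ λ s → k * (s * s) ≤ N × (∀ u → u ≤ B → k * (u * u) ≤ N → u ≤ s)
    largest zero = 0 , ℕ.≤-trans (ℕ.≤-reflexive (ℕ.*-zeroʳ k)) z≤n , λ u u≤0 _ → u≤0
    largest (suc B) with k * (suc B * suc B) ℕ.≤? N
    ... | yes h = suc B , h , λ u u≤ _ → u≤
    ... | no ¬h with largest B
    ...   | s , hs , max = s , hs , λ u u≤ hu → max u (ℕ.≤-pred (ℕ.≤∧≢⇒< u≤ λ { refl → ¬h hu })) hu
  ... | s , hs , max = s , hs , λ u hu → max u (ℕ.≤-trans (u≤ku² u) hu) hu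
    where
    u≤ku² : ∀ u → u ≤ k * (u * u)
    u≤ku² zero    = z≤n
    u≤ku² (suc u) = ℕ.≤-trans (ℕ.m≤m*n (suc u) (suc u)) (ℕ.m≤n*m (suc u * suc u) k)

  dyadic : ∀ L w .{{_ : NonZero w}} → w < 2 ^ L → ∃₂ λ i t → i < L × t < 2 ^ i × w ≡ 2 ^ i + t
  dyadic zero    w w<1 = contradiction (ℕ.n<1⇒n≡0 w<1) (ℕ.≢-nonZero⁻¹ w)
  dyadic (suc L) w w<  with w ℕ.<? 2 ^ L
  ... | yes w<′ = let i , t , i< , t< , e = dyadic L w w<′ in i , t , ℕ.m<n⇒m<1+n i< , t< , e
  ... | no w≮   = L , w ℕ.∸ 2 ^ L , ℕ.≤-refl
    , ℕ.+-cancelˡ-< (2 ^ L) _ _ (subst (_< 2 ^ L + 2 ^ L) (sym e) (subst (λ z → w < 2 ^ L + z) (ℕ.+-identityʳ _) w<))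
    , sym e
    where e = ℕ.m+[n∸m]≡n (ℕ.≮⇒≥ w≮)

  range : ℕ → List ℕ
  range N = applyUpTo suc N

  ∈-range⁺ : ∀ {n N} .{{_ : NonZero n}} → n ≤ N → n ∈ range N
  ∈-range⁺ {suc n} n≤N = ∈-applyUpTo⁺ suc n≤N

  ∈-range⁻ : ∀ {n N} → n ∈ range N → NonZero n × n ≤ N
  ∈-range⁻ n∈ with ∈-applyUpTo⁻ suc n∈
  ... | i , i<N , refl = _ , i<N

  module SquareClasses (N L : ℕ) (N<2^L : N < 2 ^ L) where

    abstract
      -- ⌊√(N / 2ⁱ)⌋, which bounds u whenever u² w ≤ N and w ≥ 2ⁱ.
      radius : ℕ → ℕ
      radius i = proj₁ (floorSqrt (2 ^ i) N {{ℕ.m^n≢0 2 i}})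

      radius-≤ : ∀ i → 2 ^ i * (radius i * radius i) ≤ N
      radius-≤ i = proj₁ (proj₂ (floorSqrt (2 ^ i) N {{ℕ.m^n≢0 2 i}}))

      radius-max : ∀ i u → 2 ^ i * (u * u) ≤ N → u ≤ radius i
      radius-max i = proj₂ (proj₂ (floorSqrt (2 ^ i) N {{ℕ.m^n≢0 2 i}}))

    -- Every pair with n m a square is (u² w , v² w) for some w; sorting by the
    -- dyadic block of w replaces the harmonic sum ∑ N/w by L equal blocks.
    block : ℕ → List (ℕ × ℕ)
    block i = concatMap (λ t → map (λ (u , v) → u * u * (2 ^ i + t) , v * v * (2 ^ i + t))
      (cartesianProduct (range (radius i)) (range (radius i)))) (upTo (2 ^ i))

    squarePairs : List (ℕ × ℕ)
    squarePairs = concatMap block (upTo L)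

    length-range : ∀ n → length (range n) ≡ n
    length-range n = Data.List.Properties.length-applyUpTo suc n
      where import Data.List.Properties

    length-block : ∀ i → length (block i) ≤ N
    length-block i = begin
      length (block i)
        ≤⟨ length-concatMap-≤ _ (upTo (2 ^ i))
            (λ {t} _ → ℕ.≤-reflexive (trans (length-map _ (cartesianProduct (range r) (range r)))
             (trans (length-cartesianProductWith _,_ (range r) (range r))
                 (≡.cong₂ _*_ (length-range r) (length-range r))))) ⟩
      length (upTo (2 ^ i)) * (r * r)  ≡⟨ cong (_* (r * r)) (length-upTo (2 ^ i)) ⟩
      2 ^ i * (r * r)                  ≤⟨ radius-≤ i ⟩
      N                                ∎
      where open ℕ.≤-Reasoning
            r = radius i

    length-squarePairs : length squarePairs ≤ L * N
    length-squarePairs = ℕ.≤-trans (length-concatMap-≤ block (upTo L) (λ {i} _ → length-block i))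
      (ℕ.≤-reflexive (cong (_* N) (length-upTo L)))

    ∈-squarePairs : ∀ {n m} → n ∈ range N → m ∈ range N → IsSquare (n * m) → (n , m) ∈ squarePairs
    ∈-squarePairs {n} {m} n∈ m∈ nm with ∈-range⁻ n∈ | ∈-range⁻ m∈
    ... | n≢0 , n≤N | m≢0 , m≤N with squareClass n m {{n≢0}} {{m≢0}} nm
    ...   | w , u , v , refl , refl with dyadic L w {{w≢0}} (ℕ.≤-<-trans w≤N N<2^L)
      where
      w≢0 : NonZero w
      w≢0 = ℕ.m*n≢0⇒n≢0 (u * u) {{n≢0}}
      w≤N : w ≤ N
      w≤N = ℕ.≤-trans (ℕ.m≤n*m w (u * u) {{ℕ.m*n≢0⇒m≢0 (u * u) {{n≢0}}}}) n≤N
    ...     | i , t , i<L , t<2^i , refl = ∈-concatMap⁺′ block (∈-upTo⁺ i<L)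
      (∈-concatMap⁺′ (λ t → map (λ (u , v) → u * u * (2 ^ i + t) , v * v * (2 ^ i + t)) _) (∈-upTo⁺ t<2^i)
        (∈-map⁺ _ (∈-cartesianProduct⁺ (inRadius u n≢0 n≤N) (inRadius v m≢0 m≤N))))
      where
      inRadius : ∀ u → NonZero (u * u * (2 ^ i + t)) → u * u * (2 ^ i + t) ≤ N → u ∈ range (radius i)
      inRadius u ≢0 ≤N = ∈-range⁺ {{ℕ.m*n≢0⇒m≢0 u {{ℕ.m*n≢0⇒m≢0 (u * u) {{≢0}}}}}}
        (radius-max i u (ℕ.≤-trans
          (ℕ.≤-trans (ℕ.≤-reflexive (ℕ.*-comm (2 ^ i) (u * u))) (ℕ.*-monoʳ-≤ (u * u) (ℕ.m≤m+n (2 ^ i) t))) ≤N))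

    squarePartners : ℕ → List ℕ
    squarePartners n = filter (λ m → isSquare? (n * m)) (range N)

    ∈-squarePartners : ∀ {n m} → m ∈ range N → IsSquare (n * m) → m ∈ squarePartners n
    ∈-squarePartners {n} m∈ nm = ∈-filter⁺ (λ m → isSquare? (n * m)) m∈ nm

    range-unique : ∀ n → Unique (range n)
    range-unique n = Unique.applyUpTo⁺₁ suc n (λ i<j _ e → ℕ.<⇒≢ i<j (ℕ.suc-injective e))

    -- Any two partners of n are partners of each other.
    length-squarePartners² : ∀ n .{{_ : NonZero n}} → length (squarePartners n) * length (squarePartners n) ≤ L * N
    length-squarePartners² n = begin
      length Pn * length Pn             ≡⟨ length-cartesianProductWith _,_ Pn Pn ⟨
      length (cartesianProduct Pn Pn)   ≤⟨ unique-⊆⇒length≤ (Unique.cartesianProduct⁺ uniq uniq) sub ⟩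
      length squarePairs                ≤⟨ length-squarePairs ⟩
      L * N                             ∎
      where
      open ℕ.≤-Reasoning
      Pn = squarePartners n
      uniq : Unique Pn
      uniq = Unique.filter⁺ (λ m → isSquare? (n * m)) (range-unique N)
      sub : cartesianProduct Pn Pn ⊆ squarePairs
      sub {a , b} ab∈ with ∈-cartesianProduct⁻ Pn Pn ab∈
      ... | a∈ , b∈ with ∈-filter⁻ (λ m → isSquare? (n * m)) {xs = range N} a∈
                       | ∈-filter⁻ (λ m → isSquare? (n * m)) {xs = range N} b∈
      ...   | a∈N , na | b∈N , nb = ∈-squarePairs a∈N b∈N (IsSquare-trans {n = n} na nb)

    -- `squarePairs` may repeat pairs and, as w can exceed 2ⁱ, may leave the range. The covering
    -- below needs pairs inside the range, so `squarePairs` serves only to bound the length of this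
    -- list.
    relatedPairs : List (ℕ × ℕ)
    relatedPairs = filter (λ nm → isSquare? (proj₁ nm * proj₂ nm)) (cartesianProduct (range N) (range N))

    ∈-relatedPairs⁻ : ∀ {n m} → (n , m) ∈ relatedPairs → n ∈ range N × m ∈ range N × IsSquare (n * m)
    ∈-relatedPairs⁻ nm∈ with ∈-filter⁻ (λ nm → isSquare? (proj₁ nm * proj₂ nm))
        {xs = cartesianProduct (range N) (range N)} nm∈
    ... | nm∈N² , nm with ∈-cartesianProduct⁻ (range N) (range N) nm∈N²
    ...   | n∈ , m∈ = n∈ , m∈ , nm

    ∈-relatedPairs⁺ : ∀ {n m} → n ∈ range N → m ∈ range N → IsSquare (n * m) → (n , m) ∈ relatedPairs
    ∈-relatedPairs⁺ n∈ m∈ nm = ∈-filter⁺ (λ nm → isSquare? (proj₁ nm * proj₂ nm)) (∈-cartesianProduct⁺ n∈ m∈) nm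

    length-relatedPairs : length relatedPairs ≤ L * N
    length-relatedPairs = ℕ.≤-trans (unique-⊆⇒length≤
      (Unique.filter⁺ (λ nm → isSquare? (proj₁ nm * proj₂ nm))
          (Unique.cartesianProduct⁺ (range-unique N) (range-unique N)))
      (λ nm∈ → let n∈ , m∈ , nm = ∈-relatedPairs⁻ nm∈ in ∈-squarePairs n∈ m∈ nm)) length-squarePairs

  insert : ℕ → A → List A → List A
  insert zero    y xs       = y ∷ xs
  insert (suc k) y []       = [ y ]
  insert (suc k) y (x ∷ xs) = x ∷ insert k y xs

  insert-length : ∀ (as : List A) y bs → insert (length as) y (as ++ bs) ≡ as ++ y ∷ bs
  insert-length []       y bs = refl
  insert-length (a ∷ as) y bs = cong (a ∷_) (insert-length as y bs)

  -- The number of matching patterns for r entries when p values are known: the first entry is tied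
  -- to one of the p values, or to one of the later entries, and whatever has been placed becomes
  -- known.
  coverBound : ℕ → ℕ → ℕ
  coverBound p zero          = 1
  coverBound p (suc zero)    = p * 1
  coverBound p (suc (suc r)) = p * coverBound (suc p) (suc r) + suc r * coverBound (2 + p) r

  module Paired {A : Set} (_~_ : A → A → Set) (~-sym : ∀ {x y} → x ~ y → y ~ x)
                (domain : List A) (related : A → List A) (pairs : List (A × A)) where

    -- A permutation x ∷ zs singles out one occurrence x. Its partner is a known value or another
    -- occurrence, so an entry never counts as its own partner, while an equal entry elsewhere may.
    IsPaired : List A → List A → Set
    IsPaired known xs = ∀ x zs → xs ↭ x ∷ zs → Any (x ~_) (known ++ zs)

    -- The first entry is related to a known value (cover₁) or to a later entry
    -- (cover₂); in both cases the rest is paired relative to a longer known list.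
    cover  : List A → ℕ → List (List A)
    cover₁ : List A → ℕ → List (List A)
    cover₂ : List A → ℕ → List (List A)
    cover known zero    = [ [] ]
    cover known (suc r) = cover₁ known r ++ cover₂ known r
    cover₁ known r = concatMap (λ p → concatMap (λ z → map (z ∷_) (cover (z ∷ known) r)) (related p)) known
    cover₂ known zero    = []
    cover₂ known (suc r) = concatMap (λ k → concatMap (λ zz →
      map (λ xs → proj₁ zz ∷ insert k (proj₂ zz) xs) (cover (proj₁ zz ∷ proj₂ zz ∷ known) r)) pairs) (upTo (suc r))

    module _ (e : ℕ) (related≤ : ∀ {x} → x ∈ domain → length (related x) ≤ e)
             (pairs≤ : length pairs ≤ e * e)
             (related⊆ : ∀ {x y} → y ∈ related x → y ∈ domain)
             (pairs⊆ : ∀ {x y} → (x , y) ∈ pairs → x ∈ domain × y ∈ domain) where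
      open ℕ.≤-Reasoning
      open +-*-Solver using (solve; _:+_; _:*_; _:=_)

      -- A match with a known value places one entry at the cost of a factor e; a match with a later
      -- entry places two at the cost of e². Both cost e per entry, and only the number of patterns
      -- remains as a constant.
      length-cover : ∀ known r → All (_∈ domain) known →
                     length (cover known r) ≤ coverBound (length known) r * e ^ r
      length-cover₁ : ∀ known r → All (_∈ domain) known →
                      length (cover₁ known r) ≤ length known * coverBound (suc (length known)) r * e ^ suc r

      length-cover known zero ok = ℕ.≤-refl
      length-cover known (suc zero) ok = begin
        length (cover₁ known 0 ++ [])      ≡⟨ length-++ (cover₁ known 0) ⟩
        length (cover₁ known 0) + 0        ≡⟨ ℕ.+-identityʳ _ ⟩
        length (cover₁ known 0)            ≤⟨ length-cover₁ known 0 ok ⟩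
        length known * 1 * e ^ 1           ∎
      length-cover known (suc (suc r)) ok = begin
        length (cover₁ known (suc r) ++ cover₂ known (suc r))
          ≡⟨ length-++ (cover₁ known (suc r)) ⟩
        length (cover₁ known (suc r)) + length (cover₂ known (suc r))
          ≤⟨ ℕ.+-mono-≤ (length-cover₁ known (suc r) ok) cover₂≤ ⟩
        p * coverBound (suc p) (suc r) * e ^ suc (suc r) + suc r * coverBound (2 + p) r * e ^ suc (suc r)
          ≡⟨ ℕ.*-distribʳ-+ (e ^ suc (suc r)) (p * coverBound (suc p) (suc r)) (suc r * coverBound (2 + p) r) ⟨
        coverBound p (suc (suc r)) * e ^ suc (suc r) ∎
        where
        p = length known
        D = coverBound (2 + p) r * e ^ r
        extend : ℕ → A × A → List (List A)
        extend k zz = map (λ xs → proj₁ zz ∷ insert k (proj₂ zz) xs) (cover (proj₁ zz ∷ proj₂ zz ∷ known) r)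
        cover₂≤ : length (cover₂ known (suc r)) ≤ suc r * coverBound (2 + p) r * e ^ suc (suc r)
        cover₂≤ = begin
          length (cover₂ known (suc r))
            ≤⟨ length-concatMap-≤ (λ k → concatMap (extend k) pairs) (upTo (suc r))
                (λ {k} _ → length-concatMap-≤ (extend k) pairs (λ {zz} zz∈ →
                 ℕ.≤-trans (ℕ.≤-reflexive (length-map _ (cover (proj₁ zz ∷ proj₂ zz ∷ known) r)))
                   (length-cover (proj₁ zz ∷ proj₂ zz ∷ known) r
                     (proj₁ (pairs⊆ zz∈) ∷ proj₂ (pairs⊆ zz∈) ∷ ok)))) ⟩
          length (upTo (suc r)) * (length pairs * D)
            ≡⟨ cong (_* (length pairs * D)) (length-upTo (suc r)) ⟩
          suc r * (length pairs * D)
            ≤⟨ ℕ.*-monoʳ-≤ (suc r) (ℕ.*-monoˡ-≤ D pairs≤) ⟩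
          suc r * (e * e * (coverBound (2 + p) r * e ^ r))
            ≡⟨ solve 4 (λ r e c f → r :* (e :* e :* (c :* f)) := r :* c :* (e :* (e :* f)))
                 refl (suc r) e (coverBound (2 + p) r) (e ^ r) ⟩
          suc r * coverBound (2 + p) r * e ^ suc (suc r) ∎

      length-cover₁ known r ok = begin
        length (cover₁ known r)
          ≤⟨ length-concatMap-≤ _ known (λ {p} p∈ → ℕ.≤-trans
               (length-concatMap-≤ _ (related p) (λ {z} z∈ → ℕ.≤-trans
                 (ℕ.≤-reflexive (length-map (z ∷_) (cover (z ∷ known) r)))
                 (length-cover (z ∷ known) r (related⊆ z∈ ∷ ok))))
               (ℕ.*-monoˡ-≤ D (related≤ (All.lookup ok p∈)))) ⟩
        length known * (e * D)
          ≡⟨ solve 4 (λ l e c f → l :* (e :* (c :* f)) := l :* c :* (e :* f))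
               refl (length known) e (coverBound (suc (length known)) r) (e ^ r) ⟩
        length known * coverBound (suc (length known)) r * e ^ suc r ∎
        where D = coverBound (suc (length known)) r * e ^ r

    module _ (related⁺ : ∀ {x y} → y ∈ domain → x ~ y → y ∈ related x)
             (pairs⁺ : ∀ {x y} → x ∈ domain → y ∈ domain → x ~ y → (x , y) ∈ pairs) where

      -- When z, or z together with its partner z′, is removed, the remaining entries keep their
      -- partners, because the removed values have joined `known`.
      ∈-cover : ∀ known r xs → length xs ≡ r → All (_∈ domain) xs → IsPaired known xs → xs ∈ cover known r
      ∈-cover known zero    []       _   _         _      = here refl
      ∈-cover known (suc r) (z ∷ xs) len (z∈ ∷ ok) paired with Any.++⁻ known (paired z xs ↭-refl)
      ... | inj₁ z~known with find z~known
      ...   | p , p∈ , z~p = ∈-++⁺ˡ (∈-concatMap⁺′ _ p∈ (∈-concatMap⁺′ _ (related⁺ z∈ (~-sym z~p))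
        (∈-map⁺ (z ∷_) (∈-cover (z ∷ known) r xs (ℕ.suc-injective len) ok λ x zs xs↭ →
          Any-resp-↭ (shift z known zs)
            (paired x (z ∷ zs) (↭-trans (prep z xs↭) (swap z x ↭-refl)))))))
      ∈-cover known (suc r) (z ∷ xs) len (z∈ ∷ ok) paired | inj₂ z~xs with find z~xs
      ...   | z′ , z′∈ , z~z′ with ∈-∃++ z′∈
      ...     | as , bs , refl = ∈-++⁺ʳ (cover₁ known r) (∈-cover₂ r len)
        where
        length-as++bs : length (as ++ z′ ∷ bs) ≡ suc (length (as ++ bs))
        length-as++bs = trans (length-++ as) (trans (ℕ.+-suc (length as) (length bs)) (cong suc (sym (length-++ as))))
        ok′ : All (_∈ domain) (as ++ bs)
        ok′ = All.++⁺ (All.++⁻ˡ as ok) (All.tail (All.++⁻ʳ as ok))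
        ∈-cover₂ : ∀ r → suc (length (as ++ z′ ∷ bs)) ≡ suc r → z ∷ as ++ z′ ∷ bs ∈ cover₂ known r
        ∈-cover₂ zero    e with () ← trans (sym length-as++bs) (ℕ.suc-injective e)
        ∈-cover₂ (suc r) e = ∈-concatMap⁺′ _ {length as} (∈-upTo⁺ as<)
          (∈-concatMap⁺′ _ (pairs⁺ z∈ (All.lookup ok z′∈) z~z′)
            (subst (λ ys → z ∷ ys ∈ map (λ xs → z ∷ insert (length as) z′ xs) (cover (z ∷ z′ ∷ known) r))
              (insert-length as z′ bs)
              (∈-map⁺ (λ xs → z ∷ insert (length as) z′ xs) (∈-cover (z ∷ z′ ∷ known) r (as ++ bs) len′ ok′ paired′))))
          where
          len′ : length (as ++ bs) ≡ r
          len′ = ℕ.suc-injective (trans (sym length-as++bs) (ℕ.suc-injective e))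
          as< : length as < suc r
          as< = s≤s (ℕ.≤-trans (ℕ.m≤m+n _ _) (ℕ.≤-reflexive (trans (sym (length-++ as)) len′)))
          paired′ : IsPaired (z ∷ z′ ∷ known) (as ++ bs)
          paired′ x zs as++bs↭ = Any-resp-↭ (↭-trans (shift z known (z′ ∷ zs)) (prep z (shift z′ known zs)))
            (paired x (z ∷ z′ ∷ zs)
              (↭-trans (prep z (↭-trans (shift z′ as bs) (↭-trans (prep z′ as++bs↭) (swap z′ x ↭-refl))))
                       (swap z x ↭-refl)))

-- Cauchy-Schwarz for numbers of collisions.

module CollisionCounting where
  open SquareClassCounting
  open import Data.Nat.Base as ℕ using (ℕ; zero; suc; _+_; _*_; _^_; _≤_; z≤n)
  import Data.Nat.Properties as ℕ
  open import Data.Nat.Solver using (module +-*-Solver)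
  open import Data.List.Base using (List; []; _∷_; [_]; length; concatMap; filter; cartesianProduct; cartesianProductWith)
  open import Data.List.Properties using (length-++; ∷-injective)
  open import Data.List.Relation.Unary.All as All using (All; []; _∷_)
  open import Data.List.Relation.Unary.Any using (here)
  open import Data.List.Relation.Unary.Unique.Propositional using (Unique; []; _∷_)
  import Data.List.Relation.Unary.Unique.Propositional.Properties as Unique
  open import Data.List.Membership.Propositional using (_∈_; find)
  open import Data.List.Membership.Propositional.Properties
  open import Data.Product.Base using (_×_; _,_; proj₁; proj₂)
  open import Data.Sum.Base using (inj₁; inj₂)
  open import Relation.Binary.Definitions using (DecidableEquality)
  open import Relation.Binary.PropositionalEquality as ≡ using (_≡_; refl; sym; trans; cong)

  private variable
    A B : Set

  unique-concatMap : (key : B → A) (f : A → List B) → (∀ x → Unique (f x)) → (∀ {x y} → y ∈ f x → key y ≡ x) →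
                     ∀ {xs} → Unique xs → Unique (concatMap f xs)
  unique-concatMap key f u k []       = []
  unique-concatMap key f u k {x ∷ xs} (x∉xs ∷ uxs) = Unique.++⁺ (u x) (unique-concatMap key f u k uxs)
    λ (y∈fx , y∈rest) → let x′ , x′∈xs , y∈fx′ = find (∈-concatMap⁻ f y∈rest) in
      All.lookup x∉xs x′∈xs (trans (sym (k y∈fx)) (k y∈fx′))

  tuples : List A → ℕ → List (List A)
  tuples xs zero    = [ [] ]
  tuples xs (suc k) = cartesianProductWith _∷_ xs (tuples xs k)

  length-tuples : (xs : List A) (k : ℕ) → length (tuples xs k) ≡ length xs ^ k
  length-tuples xs zero    = refl
  length-tuples xs (suc k) = trans (length-cartesianProductWith _∷_ xs (tuples xs k))
      (cong (length xs *_) (length-tuples xs k))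

  unique-tuples : {xs : List A} → Unique xs → ∀ k → Unique (tuples xs k)
  unique-tuples u zero    = [] ∷ []
  unique-tuples u (suc k) = Unique.cartesianProductWith⁺ _∷_ ∷-injective u (unique-tuples u k)

  ∈-tuples⁺ : {xs : List A} {ys : List A} → All (_∈ xs) ys → ys ∈ tuples xs (length ys)
  ∈-tuples⁺ []         = here refl
  ∈-tuples⁺ (y∈ ∷ ys∈) = ∈-cartesianProductWith⁺ _∷_ y∈ (∈-tuples⁺ ys∈)

  ∈-tuples⁻ : (xs : List A) (k : ℕ) {ys : List A} → ys ∈ tuples xs k → All (_∈ xs) ys × length ys ≡ k
  ∈-tuples⁻ xs zero    (here refl) = [] , refl
  ∈-tuples⁻ xs (suc k) ys∈ with ∈-cartesianProductWith⁻ _∷_ xs (tuples xs k) ys∈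
  ... | y , ys , y∈ , ys∈′ , refl = let ok , e = ∈-tuples⁻ xs k ys∈′ in y∈ ∷ ok , cong suc e

  2ab≤a²+b² : ∀ a b → 2 * (a * b) ≤ a * a + b * b
  2ab≤a²+b² a b with ℕ.≤-total a b
  ... | inj₁ a≤b with ℕ.m≤n⇒∃[o]m+o≡n a≤b
  ...   | d , refl = ℕ.≤-trans (ℕ.m≤m+n _ (d * d)) (ℕ.≤-reflexive (solve 2 (λ a d →
            con 2 :* (a :* (a :+ d)) :+ d :* d := a :* a :+ (a :+ d) :* (a :+ d)) refl a d))
    where open +-*-Solver
  2ab≤a²+b² a b | inj₂ b≤a with ℕ.m≤n⇒∃[o]m+o≡n b≤a
  ...   | d , refl = ℕ.≤-trans (ℕ.m≤m+n _ (d * d)) (ℕ.≤-reflexive (solve 2 (λ b d →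
            con 2 :* ((b :+ d) :* b) :+ d :* d := (b :+ d) :* (b :+ d) :+ b :* b) refl b d))
    where open +-*-Solver

  module Collisions {X V : Set} (_≟_ : DecidableEquality V) {vs : List V} (vs-unique : Unique vs)
                    {xs : List X} (xs-unique : Unique xs) where

    fiber : (X → V) → V → List X
    fiber g v = filter (λ x → g x ≟ v) xs

    collisions : (X → V) → (X → V) → List (X × X)
    collisions g h = concatMap (λ v → cartesianProduct (fiber g v) (fiber h v)) vs

    ∈-collisions⁺ : ∀ {g h x y} → g x ∈ vs → x ∈ xs → y ∈ xs → g x ≡ h y → (x , y) ∈ collisions g h
    ∈-collisions⁺ {g} {h} {x} {y} gx∈vs x∈ y∈ gx≡hy =
      ∈-concatMap⁺′ (λ v → cartesianProduct (fiber g v) (fiber h v)) gx∈vs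
        (∈-cartesianProduct⁺ (∈-filter⁺ (λ x → g x ≟ _) x∈ refl) (∈-filter⁺ (λ x → h x ≟ _) y∈ (sym gx≡hy)))

    module _ {Q : List (X × X)} where

      length-collisions-self : ∀ g → (∀ {x y} → x ∈ xs → y ∈ xs → g x ≡ g y → (x , y) ∈ Q) →
                               length (collisions g g) ≤ length Q
      length-collisions-self g hQ = unique-⊆⇒length≤
        (unique-concatMap (λ xy → g (proj₁ xy)) (λ v → cartesianProduct (fiber g v) (fiber g v))
          (λ v → Unique.cartesianProduct⁺ (fiber-unique v) (fiber-unique v))
          (λ {v} xy∈ → proj₂ (∈-filter⁻ (λ x → g x ≟ v) {xs = xs}
            (proj₁ (∈-cartesianProduct⁻ (fiber g v) (fiber g v) xy∈))))
          vs-unique)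
        λ {xy} xy∈ → let v , _ , xy∈v = find (∈-concatMap⁻ (λ v → cartesianProduct (fiber g v) (fiber g v)) {xs = vs} xy∈)
                         x∈f , y∈f = ∈-cartesianProduct⁻ (fiber g v) (fiber g v) xy∈v
                         x∈ , gx≡v = ∈-filter⁻ (λ x → g x ≟ v) {xs = xs} x∈f
                         y∈ , gy≡v = ∈-filter⁻ (λ x → g x ≟ v) {xs = xs} y∈f
                     in hQ x∈ y∈ (trans gx≡v (sym gy≡v))
        where
        fiber-unique : ∀ v → Unique (fiber g v)
        fiber-unique v = Unique.filter⁺ (λ x → g x ≟ v) xs-unique

      -- For each value v, the fiber sizes a of g and b of h satisfy 2 a b ≤ a² + b². Summed over v,
      -- twice the mixed count is at most the sum of the two diagonal counts, each of which is
      -- bounded by the length of Q.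
      length-collisions : ∀ g h → (∀ {x y} → x ∈ xs → y ∈ xs → g x ≡ g y → (x , y) ∈ Q) →
                          (∀ {x y} → x ∈ xs → y ∈ xs → h x ≡ h y → (x , y) ∈ Q) →
                          length (collisions g h) ≤ length Q
      length-collisions g h gQ hQ = ℕ.*-cancelˡ-≤ 2 (begin
        2 * length (collisions g h)
          ≤⟨ cauchySchwarz vs ⟩
        length (collisions g g) + length (collisions h h)
          ≤⟨ ℕ.+-mono-≤ (length-collisions-self g gQ) (length-collisions-self h hQ) ⟩
        length Q + length Q
          ≡⟨ cong (length Q +_) (ℕ.+-identityʳ _) ⟨
        2 * length Q ∎)
        where
        open ℕ.≤-Reasoning
        open +-*-Solver using (solve; _:+_; _:*_; _:=_; con)
        meet : (X → V) → (X → V) → V → ℕ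
        meet g h v = length (cartesianProduct (fiber g v) (fiber h v))
        sums : (X → V) → (X → V) → List V → ℕ
        sums g h vs = length (concatMap (λ v → cartesianProduct (fiber g v) (fiber h v)) vs)
        pointwise : ∀ v → 2 * (meet g h v) ≤ meet g g v + meet h h v
        pointwise v rewrite length-cartesianProductWith _,_ (fiber g v) (fiber h v)
                          | length-cartesianProductWith _,_ (fiber g v) (fiber g v)
                          | length-cartesianProductWith _,_ (fiber h v) (fiber h v) = 2ab≤a²+b² (length (fiber g v)) (length (fiber h v))
        cauchySchwarz : ∀ vs → 2 * sums g h vs ≤ sums g g vs + sums h h vs
        cauchySchwarz []       = z≤n
        cauchySchwarz (v ∷ vs)
          rewrite length-++ (cartesianProduct (fiber g v) (fiber h v)) {concatMap (λ v → cartesianProduct (fiber g v) (fiber h v)) vs}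
                | length-++ (cartesianProduct (fiber g v) (fiber g v)) {concatMap (λ v → cartesianProduct (fiber g v) (fiber g v)) vs}
                | length-++ (cartesianProduct (fiber h v) (fiber h v)) {concatMap (λ v → cartesianProduct (fiber h v) (fiber h v)) vs} = begin
          2 * (meet g h v + sums g h vs)
            ≡⟨ ℕ.*-distribˡ-+ 2 (meet g h v) (sums g h vs) ⟩
          2 * (meet g h v) + 2 * sums g h vs
            ≤⟨ ℕ.+-mono-≤ (pointwise v) (cauchySchwarz vs) ⟩
          (meet g g v + meet h h v) + (sums g g vs + sums h h vs)
            ≡⟨ solve 4 (λ a b c d → (a :+ b) :+ (c :+ d) := (a :+ c) :+ (b :+ d)) refl
                 (meet g g v) (meet h h v) (sums g g vs) (sums h h vs) ⟩
          (meet g g v + sums g g vs) + (meet h h v + sums h h vs) ∎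

-- From solutions in `𝔽 q` to additive energies of the set of square roots.

module EnergyBounds where
  open import Defs
  open SquareRootAdjunction
  open SquareRootFields using (IsSquare; isSquare?)
  open ModularRoots
  open SquareClassCounting
  open CollisionCounting
  open import Data.Fin.Base using (Fin; toℕ; finToFun; funToFin)
  import Data.Fin.Base as Fin
  open import Data.Fin.Patterns using (0F; 1F; 2F; 3F; 4F; 5F; 6F; 7F)
  import Data.Fin.Properties as Fin
  open import Data.Integer.Base as ℤ using (ℤ; +_; 0ℤ; 1ℤ; ∣_∣)
  import Data.Integer.Properties as ℤ
  import Data.Integer.Divisibility.Signed as ℤ
  open import Data.Integer.Tactic.RingSolver using (solve-∀)
  open import Data.Nat.Base as ℕ using (ℕ; zero; suc; _+_; _*_; _^_; _≤_; _<_; z≤n; NonZero)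
  import Data.Nat.Properties as ℕ
  import Data.Nat.DivMod as ℕ
  open import Data.Nat.Divisibility using (_∣_)
  open import Data.Nat.Primality using (Prime; euclidsLemma)
  open import Data.Nat.Solver using (module +-*-Solver)
  open import Data.List.Base using (List; []; _∷_; _++_; [_]; map; length; concatMap; filter; allFin; cartesianProductWith; splitAt; take; drop; tabulate)
  open import Data.Nat.ListAction using (sum)
  open import Data.Nat.ListAction.Properties using (sum-++)
  open import Data.List.Properties using (length-map; length-++; ∷-injective; map-++)
  open import Data.List.Relation.Unary.All as All using (All; []; _∷_)
  import Data.List.Relation.Unary.All.Properties as All
  open import Data.List.Relation.Unary.Any using (Any; here; there)
  import Data.List.Relation.Unary.Any.Properties as Any
  open import Data.List.Relation.Unary.Unique.Propositional using (Unique; []; _∷_)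
  import Data.List.Relation.Unary.Unique.Propositional.Properties as Unique
  open import Data.List.Membership.Propositional using (_∈_)
  open import Data.List.Membership.Propositional.Properties
  open import Data.List.Relation.Binary.Subset.Propositional using (_⊆_)
  open import Data.List.Relation.Binary.Permutation.Propositional using (_↭_; prep; swap)
  import Data.List.Relation.Binary.Permutation.Propositional as ↭
  open import Data.List.Relation.Binary.Permutation.Propositional.Properties using (All-resp-↭; ↭-map-inv; ↭-length)
  open import Data.Product.Base using (_×_; _,_; proj₁; proj₂; ∃; ∃₂)
  open import Data.Sum.Base using (_⊎_; inj₁; inj₂)
  open import Function.Base using (_∘_)
  open import Relation.Nullary using (Dec)
  open import Relation.Binary.PropositionalEquality as ≡ using (_≡_; _≢_; refl; sym; trans; cong; subst)

  funToFin-cong : ∀ {m n} {f g : Fin m → Fin n} → (∀ i → f i ≡ g i) → funToFin f ≡ funToFin g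
  funToFin-cong {zero}  f≗g = refl
  funToFin-cong {suc m} f≗g = ≡.cong₂ Fin.combine (f≗g Fin.zero) (funToFin-cong (λ i → f≗g (Fin.suc i)))

  finToFun-injective : ∀ {m n} {a b : Fin (n ^ m)} → (∀ i → finToFun {n} {m} a i ≡ finToFun b i) → a ≡ b
  finToFun-injective {m} {n} {a} {b} eq =
    trans (sym (Fin.funToFin-finToFin {m} {n} a)) (trans (funToFin-cong eq) (Fin.funToFin-finToFin {m} {n} b))

  tabulate-injective : ∀ {A : Set} {n} {f g : Fin n → A} → tabulate f ≡ tabulate g → ∀ i → f i ≡ g i
  tabulate-injective e Fin.zero    = proj₁ (∷-injective e)
  tabulate-injective e (Fin.suc i) = tabulate-injective (proj₂ (∷-injective e)) i

  valueSum-++ : ∀ xs ys → valueSum (xs ++ ys) ≡ valueSum xs ℤ.+ valueSum ys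
  valueSum-++ []       ys = sym (ℤ.+-identityˡ _)
  valueSum-++ (x ∷ xs) ys = trans (cong (ℤ._+_ (proj₁ x)) (valueSum-++ xs ys)) (sym (ℤ.+-assoc (proj₁ x) _ _))

  valueSum-↭ : ∀ {xs ys} → xs ↭ ys → valueSum xs ≡ valueSum ys
  valueSum-↭ ↭.refl          = refl
  valueSum-↭ (prep x p)      = cong (ℤ._+_ (proj₁ x)) (valueSum-↭ p)
  valueSum-↭ (swap x y p)    = trans (cong (λ s → proj₁ x ℤ.+ (proj₁ y ℤ.+ s)) (valueSum-↭ p))
      (exchange (proj₁ x) (proj₁ y) _)
    where exchange : ∀ a b c → a ℤ.+ (b ℤ.+ c) ≡ b ℤ.+ (a ℤ.+ c)
          exchange = solve-∀
  valueSum-↭ (↭.trans p p′) = trans (valueSum-↭ p) (valueSum-↭ p′)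

  module _ (q : ℕ) .{{_ : NonZero q}} where
    open Congruence q

    toℕ-⟦⟧ : ∀ a → + toℕ (⟦_⟧ {q} a) ≈ + a
    toℕ-⟦⟧ a = ≈-sym (mod (ℤ.divides (+ (a ℕ./ q)) (begin
      + a ℤ.- + toℕ (⟦_⟧ {q} a)                        ≡⟨ cong (λ r → + a ℤ.- + r) (Fin.toℕ-fromℕ< (ℕ.m%n<n a q)) ⟩
      + a ℤ.- + (a ℕ.% q)                              ≡⟨ cong (λ b → + b ℤ.- + (a ℕ.% q)) (ℕ.m≡m%n+[m/n]*n a q) ⟩
      + (a ℕ.% q) ℤ.+ + (a ℕ./ q * q) ℤ.- + (a ℕ.% q)  ≡⟨ cancel (+ (a ℕ.% q)) (+ (a ℕ./ q * q)) ⟩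
      + (a ℕ./ q * q)                                  ≡⟨ ℤ.pos-* (a ℕ./ q) q ⟩
      + (a ℕ./ q) ℤ.* + q                              ∎)))
      where open ≡.≡-Reasoning
            cancel : ∀ r s → r ℤ.+ s ℤ.- r ≡ s
            cancel = solve-∀

    ≈⇒≡ : {x y : 𝔽 q} → + toℕ x ≈ + toℕ y → x ≡ y
    ≈⇒≡ {x} {y} (mod d) = Fin.toℕ-injective (ℤ.+-injective (ℤ.i-j≡0⇒i≡j (+ toℕ x) (+ toℕ y)
      (≈0⇒≡0 (mod (subst (+ q ℤ.∣_) (sym (ℤ.+-identityʳ _)) d)) (begin-strict
        ∣ + toℕ x ℤ.- + toℕ y ∣   ≡⟨ cong ∣_∣ (ℤ.m-n≡m⊖n (toℕ x) (toℕ y)) ⟩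
        ∣ toℕ x ℤ.⊖ toℕ y ∣       ≤⟨ ℤ.∣m⊝n∣≤m⊔n (toℕ x) (toℕ y) ⟩
        toℕ x ℕ.⊔ toℕ y           <⟨ ℕ.⊔-lub (Fin.toℕ<n x) (Fin.toℕ<n y) ⟩
        q                         ∎))))
      where open ℕ.≤-Reasoning

    ⟦⟧-≈ : ∀ {a b} → ⟦_⟧ {q} a ≡ ⟦ b ⟧ → + a ≈ + b
    ⟦⟧-≈ {a} {b} e = ≈-trans (≈-sym (toℕ-⟦⟧ a)) (≈-trans (≡⇒≈ (cong (+_ ∘ toℕ) e)) (toℕ-⟦⟧ b))

    ≈-⟦⟧ : ∀ {a b} → + a ≈ + b → ⟦_⟧ {q} a ≡ ⟦ b ⟧
    ≈-⟦⟧ {a} {b} e = ≈⇒≡ (≈-trans (toℕ-⟦⟧ a) (≈-trans e (≈-sym (toℕ-⟦⟧ b))))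

    toℕ-neg : ∀ (a : 𝔽 q) → + toℕ (⟦_⟧ {q} (q ℕ.∸ toℕ a)) ≈ ℤ.- + toℕ a
    toℕ-neg a = ≈-trans (toℕ-⟦⟧ (q ℕ.∸ toℕ a)) (mod (ℤ.divides 1ℤ (trans
      (cong (λ z → z ℤ.- ℤ.- + toℕ a) (sym (trans (ℤ.m-n≡m⊖n q (toℕ a)) (ℤ.⊖-≥ (ℕ.<⇒≤ (Fin.toℕ<n a))))))
      (cancel (+ q) (+ toℕ a)))))
      where cancel : ∀ x y → x ℤ.- y ℤ.- ℤ.- y ≡ 1ℤ ℤ.* x
            cancel = solve-∀

    sq≈⇒±≈ : Prime q → ∀ {x y} → x ℤ.* x ≈ y ℤ.* y → x ≈ y ⊎ x ≈ ℤ.- y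
    sq≈⇒±≈ q-prime {x} {y} (mod d) = sign (euclidsLemma (∣ x ℤ.- y ∣) (∣ x ℤ.- ℤ.- y ∣) q-prime
      (subst (q ∣_) (trans (cong ∣_∣ (difference x y)) (ℤ.∣i*j∣≡∣i∣*∣j∣ (x ℤ.- y) (x ℤ.- ℤ.- y))) (ℤ.∣⇒∣ᵤ d)))
      where
      difference : ∀ x y → x ℤ.* x ℤ.- y ℤ.* y ≡ (x ℤ.- y) ℤ.* (x ℤ.- ℤ.- y)
      difference = solve-∀
      sign : (q ∣ (∣ x ℤ.- y ∣)) ⊎ (q ∣ (∣ x ℤ.- ℤ.- y ∣)) → x ≈ y ⊎ x ≈ ℤ.- y
      sign (inj₁ d) = inj₁ (mod (ℤ.∣ᵤ⇒∣ d))
      sign (inj₂ d) = inj₂ (mod (ℤ.∣ᵤ⇒∣ d))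

    Σ𝔽 : List (𝔽 q) → ℕ
    Σ𝔽 xs = sum (map toℕ xs)

    Σ𝔽-++ : ∀ xs ys → Σ𝔽 (xs ++ ys) ≡ Σ𝔽 xs + Σ𝔽 ys
    Σ𝔽-++ xs ys = trans (cong sum (map-++ toℕ xs ys)) (sum-++ (map toℕ xs) (map toℕ ys))

    shiftedSum : ℕ → List (𝔽 q) → 𝔽 q
    shiftedSum c xs = ⟦ Σ𝔽 xs + c ⟧

    module Energy (N : ℕ) (j : 𝔽 q) where

      squareRoots : ℕ → List (𝔽 q)
      squareRoots n = filter (λ b → (b *ₚ b) Fin.≟ (⟦ n ⟧ *ₚ j)) (allFin q)

      Admissible : 𝔽 q → Set
      Admissible b = b *ₚ b ∈ multiples N j

      admissible? : ∀ b → Dec (Admissible b)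
      admissible? b = (b *ₚ b) ∈? multiples N j
        where open import Data.List.Membership.DecPropositional (Fin._≟_ {q}) using (_∈?_)

      S : List (𝔽 q)
      S = filter admissible? (allFin q)

      S-unique : Unique S
      S-unique = Unique.filter⁺ admissible? (Unique.allFin⁺ q)

      ∈-S⁺ : ∀ {b} → Admissible b → b ∈ S
      ∈-S⁺ {b} h = ∈-filter⁺ admissible? (∈-allFin b) h

      ∈-S⇒root : ∀ {b} → b ∈ S → ∃ λ n → n ∈ range N × b ∈ squareRoots n
      ∈-S⇒root {b} b∈ with ∈-applyUpTo⁻ (λ i → ⟦ suc i ⟧ *ₚ j) (proj₂ (∈-filter⁻ admissible? {xs = allFin q} b∈))
      ... | i , i<N , e = suc i , ∈-applyUpTo⁺ suc i<N , ∈-filter⁺ (λ b → (b *ₚ b) Fin.≟ (⟦ suc i ⟧ *ₚ j))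
          (∈-allFin b) e

      squareRoot-≈ : ∀ {n b} → b ∈ squareRoots n → + toℕ b ℤ.* + toℕ b ≈ + n ℤ.* + toℕ j
      squareRoot-≈ {n} {b} b∈ = begin
        + toℕ b ℤ.* + toℕ b                ≡⟨ ℤ.pos-* (toℕ b) (toℕ b) ⟨
        + (toℕ b * toℕ b)
            ≈⟨ ⟦⟧-≈ (proj₂ (∈-filter⁻ (λ b → (b *ₚ b) Fin.≟ (⟦ n ⟧ *ₚ j)) {xs = allFin q} b∈)) ⟩
        + (toℕ (⟦_⟧ {q} n) * toℕ j)        ≡⟨ ℤ.pos-* (toℕ (⟦_⟧ {q} n)) (toℕ j) ⟩
        + toℕ (⟦_⟧ {q} n) ℤ.* + toℕ j      ≈⟨ *-cong (toℕ-⟦⟧ n) (≡⇒≈ refl) ⟩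
        + n ℤ.* + toℕ j                    ∎
        where open import Relation.Binary.Reasoning.Setoid (ℤ-Algebra.setoid algebra)

      length-squareRoots : Prime q → ∀ n → length (squareRoots n) ≤ 2
      length-squareRoots q-prime n = bound (squareRoots n)
          (Unique.filter⁺ (λ b → (b *ₚ b) Fin.≟ (⟦ n ⟧ *ₚ j)) (Unique.allFin⁺ q)) squareRoot-≈
        where
        bound : ∀ bs → Unique bs → (∀ {b} → b ∈ bs → + toℕ b ℤ.* + toℕ b ≈ + n ℤ.* + toℕ j) → length bs ≤ 2
        bound []       _    _  = z≤n
        bound (a ∷ as) uniq sq = unique-⊆⇒length≤ {ys = a ∷ ⟦ q ℕ.∸ toℕ a ⟧ ∷ []} uniq λ {b} b∈ →
          ±a b (sq≈⇒±≈ q-prime (≈-trans (sq b∈) (≈-sym (sq (here refl)))))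
          where
          ±a : ∀ b → + toℕ b ≈ + toℕ a ⊎ + toℕ b ≈ ℤ.- + toℕ a → b ∈ a ∷ ⟦ q ℕ.∸ toℕ a ⟧ ∷ []
          ±a b (inj₁ b≈a)  = here (≈⇒≡ b≈a)
          ±a b (inj₂ b≈-a) = there (here (≈⇒≡ (≈-trans b≈-a (≈-sym (toℕ-neg a)))))

      rootLists : List ℕ → List (List (𝔽 q))
      rootLists []       = [ [] ]
      rootLists (n ∷ ns) = cartesianProductWith _∷_ (squareRoots n) (rootLists ns)

      length-rootLists : Prime q → ∀ ns → length (rootLists ns) ≤ 2 ^ length ns
      length-rootLists q-prime []       = ℕ.≤-refl
      length-rootLists q-prime (n ∷ ns) = ℕ.≤-trans
        (ℕ.≤-reflexive (length-cartesianProductWith _∷_ (squareRoots n) (rootLists ns)))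
        (ℕ.*-mono-≤ (length-squareRoots q-prime n) (length-rootLists q-prime ns))

      length-S : Prime q → length S ≤ N * 2
      length-S q-prime = ℕ.≤-trans
        (unique-⊆⇒length≤ S-unique (λ b∈ → let n , n∈ , b∈n = ∈-S⇒root b∈ in ∈-concatMap⁺′ squareRoots n∈ b∈n))
        (ℕ.≤-trans (length-concatMap-≤ squareRoots (range N) (λ {n} _ → length-squareRoots q-prime n))
          (ℕ.≤-reflexive (cong (_* 2) (length-applyUpTo suc N))))
        where open import Data.List.Properties using (length-applyUpTo)

      solutions : List (Fin (q ^ 8))
      solutions = filter (isSolution? N j ∘ finToFun {q} {8}) (allFin (q ^ 8))

      decode : Fin (q ^ 8) → List (𝔽 q)
      decode a = tabulate (finToFun {q} {8} a)

      decode-injective : ∀ {a b} → decode a ≡ decode b → a ≡ b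
      decode-injective {a} {b} e = finToFun-injective {8} {q} (tabulate-injective e)

      -- Fixing all but 2k of the b's leaves x, y ∈ Sᵏ with Σx + c ≡ Σy + d; by
      -- Cauchy–Schwarz a bound for the case c = d suffices.
      module _ (k l : ℕ) (k+l≡4 : k + l ≡ 4) (Q : List (List (𝔽 q) × List (𝔽 q)))
               (Q-covers : ∀ c {x y} → x ∈ tuples S k → y ∈ tuples S k →
                           shiftedSum c x ≡ shiftedSum c y → (x , y) ∈ Q) where
        open Collisions Fin._≟_ (Unique.allFin⁺ q) (unique-tuples S-unique k)

        assemble : List (𝔽 q) → List (𝔽 q) → List (𝔽 q) × List (𝔽 q) → List (𝔽 q)
        assemble u w (x , y) = (x ++ u) ++ (y ++ w)

        solutionCover : List (List (𝔽 q))
        solutionCover = concatMap (λ u → concatMap (λ w →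
          map (assemble u w) (collisions (shiftedSum (Σ𝔽 u)) (shiftedSum (Σ𝔽 w))))
          (tuples S l)) (tuples S l)

        length-solutionCover : length solutionCover ≤ length S ^ l * (length S ^ l * length Q)
        length-solutionCover = ℕ.≤-trans
          (length-concatMap-≤ _ (tuples S l) (λ {u} _ →
            length-concatMap-≤ (λ w → map (assemble u w) (collisions (shiftedSum (Σ𝔽 u)) (shiftedSum (Σ𝔽 w))))
                (tuples S l) (λ {w} _ → ℕ.≤-trans
              (ℕ.≤-reflexive (length-map _ (collisions (shiftedSum (Σ𝔽 u)) (shiftedSum (Σ𝔽 w)))))
              (length-collisions (shiftedSum (Σ𝔽 u)) (shiftedSum (Σ𝔽 w)) (Q-covers (Σ𝔽 u)) (Q-covers (Σ𝔽 w))))))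
          (ℕ.≤-reflexive (≡.cong₂ (λ a b → a * (b * length Q)) (length-tuples S l) (length-tuples S l)))

        halves : ∀ {zs} → length zs ≡ 4 → All (_∈ S) zs →
                 ∃₂ λ x u → zs ≡ x ++ u × x ∈ tuples S k × u ∈ tuples S l
        halves {zs} len ok = take k zs , drop k zs , sym (take++drop≡id k zs)
          , subst (λ m → take k zs ∈ tuples S m) len-take (∈-tuples⁺ (All.take⁺ k ok))
          , subst (λ m → drop k zs ∈ tuples S m) len-drop (∈-tuples⁺ (All.drop⁺ k ok))
          where
          open import Data.List.Properties using (take++drop≡id; length-take; length-drop)
          len-take : length (take k zs) ≡ k
          len-take = trans (length-take k zs) (ℕ.m≤n⇒m⊓n≡m (subst (k ≤_) (trans k+l≡4 (sym len)) (ℕ.m≤m+n k l)))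
          len-drop : length (drop k zs) ≡ l
          len-drop = trans (length-drop k zs) (trans (cong (ℕ._∸ k) (trans len (sym k+l≡4))) (ℕ.m+n∸m≡n k l))

        ⟦Σ⟧ : ∀ a b c d → + toℕ (a +ₚ b +ₚ c +ₚ d) ≈ + (Σ𝔽 (a ∷ b ∷ c ∷ d ∷ []))
        ⟦Σ⟧ a b c d = begin
          + toℕ (a +ₚ b +ₚ c +ₚ d)                   ≈⟨ toℕ-⟦⟧ (toℕ (a +ₚ b +ₚ c) + toℕ d) ⟩
          + toℕ (a +ₚ b +ₚ c) ℤ.+ + toℕ d            ≈⟨ +-cong (toℕ-⟦⟧ (toℕ (a +ₚ b) + toℕ c)) (≡⇒≈ {+ toℕ d} refl) ⟩
          + toℕ (a +ₚ b) ℤ.+ + toℕ c ℤ.+ + toℕ d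
              ≈⟨ +-cong (+-cong (toℕ-⟦⟧ (toℕ a + toℕ b)) (≡⇒≈ {+ toℕ c} refl)) (≡⇒≈ {+ toℕ d} refl) ⟩
          + (toℕ a + toℕ b + toℕ c + toℕ d)
            ≡⟨ cong +_ (solve 4 (λ a b c d → a :+ b :+ c :+ d := a :+ (b :+ (c :+ (d :+ con 0)))) refl (toℕ a)
                (toℕ b) (toℕ c) (toℕ d)) ⟩
          + (Σ𝔽 (a ∷ b ∷ c ∷ d ∷ []))                ∎
          where
          open import Relation.Binary.Reasoning.Setoid (ℤ-Algebra.setoid algebra)
          open +-*-Solver

        ∈-solutionCover : ∀ {zs ws} → length zs ≡ 4 → length ws ≡ 4 → All (_∈ S) zs → All (_∈ S) ws →
                          + Σ𝔽 zs ≈ + Σ𝔽 ws → zs ++ ws ∈ solutionCover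
        ∈-solutionCover {zs} {ws} len len′ ok ok′ Σ≈ with halves len ok | halves len′ ok′
        ... | x , u , refl , x∈ , u∈ | y , w , refl , y∈ , w∈ =
          ∈-concatMap⁺′ _ u∈ (∈-concatMap⁺′
              (λ w → map (assemble u w) (collisions (shiftedSum (Σ𝔽 u)) (shiftedSum (Σ𝔽 w)))) w∈
            (∈-map⁺ (assemble u w)
              (∈-collisions⁺ {shiftedSum (Σ𝔽 u)} {shiftedSum (Σ𝔽 w)} (∈-allFin _) x∈ y∈
                (≈-⟦⟧ (subst (_≈_ _) (cong +_ (Σ𝔽-++ y w))
                    (subst (λ a → a ≈ + Σ𝔽 (y ++ w)) (cong +_ (Σ𝔽-++ x u)) Σ≈))))))

        solution∈cover : ∀ b → IsSolution N j b → tabulate b ∈ solutionCover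
        solution∈cover b (Σ≡ , adm) = ∈-solutionCover {b 0F ∷ b 1F ∷ b 2F ∷ b 3F ∷ []} {b 4F ∷ b 5F ∷ b 6F ∷ b 7F ∷ []}
          refl refl
          (∈-S⁺ (adm 0F) ∷ ∈-S⁺ (adm 1F) ∷ ∈-S⁺ (adm 2F) ∷ ∈-S⁺ (adm 3F) ∷ [])
          (∈-S⁺ (adm 4F) ∷ ∈-S⁺ (adm 5F) ∷ ∈-S⁺ (adm 6F) ∷ ∈-S⁺ (adm 7F) ∷ [])
          (≈-trans (≈-sym (⟦Σ⟧ (b 0F) (b 1F) (b 2F) (b 3F)))
            (≈-trans (≡⇒≈ (cong (+_ ∘ toℕ) Σ≡)) (⟦Σ⟧ (b 4F) (b 5F) (b 6F) (b 7F))))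
        decodes⊆cover : map decode solutions ⊆ solutionCover
        decodes⊆cover {zs} zs∈ =
          let a , a∈ , e = ∈-map⁻ decode zs∈
              _ , solution = ∈-filter⁻ (isSolution? N j ∘ finToFun {q} {8}) {xs = allFin (q ^ 8)} a∈
          in subst (_∈ solutionCover) (sym e) (solution∈cover (finToFun {q} {8} a) solution)

        T₄₂-≤ : T₄₂ N q j ≤ length S ^ l * (length S ^ l * length Q)
        T₄₂-≤ = begin
          length solutions                ≡⟨ length-map decode solutions ⟨
          length (map decode solutions)
              ≤⟨ unique-⊆⇒length≤ (Unique.map⁺ {f = decode} decode-injective solutions-unique) decodes⊆cover ⟩
          length solutionCover            ≤⟨ length-solutionCover ⟩
          length S ^ l * (length S ^ l * length Q) ∎
          where
          open ℕ.≤-Reasoning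
          solutions-unique : Unique solutions
          solutions-unique = Unique.filter⁺ (isSolution? N j ∘ finToFun {q} {8}) (Unique.allFin⁺ (q ^ 8))

      -- M and e are integers above √N and √(L N): the first bounds the roots in the sign product,
      -- the second the number of partners of one integer.
      module SmallEnergy (q-prime : Prime q) (j≢0 : j ≢ ⟦ 0 ⟧) (L M e : ℕ) (N<2^L : N < 2 ^ L)
                         (N≤M² : N ≤ M * M) (LN≤e² : L * N ≤ e * e) where
        open SquareClasses N L N<2^L
        open Paired (λ a b → IsSquare (a * b)) (λ {a} {b} → subst IsSquare (ℕ.*-comm a b))
                    (range N) squarePartners relatedPairs

        toℕj≢0 : NonZero (toℕ j)
        toℕj≢0 = ℕ.≢-nonZero λ j≡0 → j≢0 (≈⇒≡ (≈-trans (≡⇒≈ (cong +_ j≡0)) (≈-sym (toℕ-⟦⟧ 0))))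

        open Twisted q-prime (toℕ j) {{toℕj≢0}} (Fin.toℕ<n j)

        labels : ∀ {xs} → All (_∈ S) xs → List ℕ
        labels []       = []
        labels (h ∷ hs) = proj₁ (∈-S⇒root h) ∷ labels hs

        labels-range : ∀ {xs} (hs : All (_∈ S) xs) → All (_∈ range N) (labels hs)
        labels-range []       = []
        labels-range (h ∷ hs) = proj₁ (proj₂ (∈-S⇒root h)) ∷ labels-range hs

        length-labels : ∀ {xs} (hs : All (_∈ S) xs) → length (labels hs) ≡ length xs
        length-labels []       = refl
        length-labels (h ∷ hs) = cong suc (length-labels hs)

        ∈-rootLists-labels : ∀ {xs ys ns} (hs : All (_∈ S) xs) → ys ∈ rootLists ns → xs ++ ys ∈ rootLists
            (labels hs ++ ns)
        ∈-rootLists-labels []       ys∈ = ys∈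
        ∈-rootLists-labels (h ∷ hs) ys∈ = ∈-cartesianProductWith⁺ _∷_ (proj₂ (proj₂ (∈-S⇒root h)))
            (∈-rootLists-labels hs ys∈)

        -- With s the identity on x and negation on y, the equation Σx = Σy becomes a zero sum. A
        -- sign does not change the square, so the labels stay the same.
        signed : (ℤ → ℤ) → ∀ {xs} → All (_∈ S) xs → List (ℤ × ℕ)
        signed s []                    = []
        signed s {x ∷ xs} (h ∷ hs) = (s (+ toℕ x) , proj₁ (∈-S⇒root h)) ∷ signed s hs

        signed-labels : ∀ s {xs} (hs : All (_∈ S) xs) → map proj₂ (signed s hs) ≡ labels hs
        signed-labels s []       = refl
        signed-labels s (h ∷ hs) = cong (proj₁ (∈-S⇒root h) ∷_) (signed-labels s hs)

        signed-roots : ∀ s → (∀ x → s x ℤ.* s x ≡ x ℤ.* x) → ∀ {xs} (hs : All (_∈ S) xs) → All IsRoot (signed s hs)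
        signed-roots s s² []       = []
        signed-roots s s² {x ∷ xs} (h ∷ hs) =
          ≈-trans (≡⇒≈ (s² (+ toℕ x))) (squareRoot-≈ (proj₂ (proj₂ (∈-S⇒root h)))) ∷ signed-roots s s² hs

        signed-sum⁺ : ∀ {xs} (hs : All (_∈ S) xs) → valueSum (signed (λ x → x) hs) ≡ + Σ𝔽 xs
        signed-sum⁺ []                = refl
        signed-sum⁺ {x ∷ xs} (h ∷ hs) = cong (ℤ._+_ (+ toℕ x)) (signed-sum⁺ hs)

        signed-sum⁻ : ∀ {xs} (hs : All (_∈ S) xs) → valueSum (signed ℤ.-_ hs) ≡ ℤ.- + Σ𝔽 xs
        signed-sum⁻ []                = refl
        signed-sum⁻ {x ∷ xs} (h ∷ hs) = trans (cong (ℤ._+_ (ℤ.- + toℕ x)) (signed-sum⁻ hs))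
          (sym (ℤ.neg-distrib-+ (+ toℕ x) (+ Σ𝔽 xs)))

        -- The size bound for a sign product of m + 2 roots is below q. For M of order √N this means
        -- q above a constant times N^(2^m): N⁴ for m = 2 and N¹⁶ for m = 4.
        Large : ℕ → Set
        Large m = (suc (suc m) * M) ^ (2 ^ suc m) < q

        -- `partner` concerns the first entry only. The hypotheses are invariant under permutation,
        -- and a permutation of the labels lifts to one of the labelled values, so any entry can be
        -- moved to the front.
        zeroSum⇒paired : ∀ m → Large m → ∀ xs → length xs ≡ suc (suc m) → All IsRoot xs →
                         All (_∈ range N) (map proj₂ xs) → valueSum xs ≈ 0ℤ → IsPaired [] (map proj₂ xs)
        zeroSum⇒paired m q> xs len roots ranges Σ≈0 n ns π = partner′ (↭-map-inv proj₂ π)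
          where
          partner′ : ∃ (λ ys → n ∷ ns ≡ map proj₂ ys × xs ↭ ys) → Any (λ b → IsSquare (n * b)) ns
          partner′ (x ∷ [] , refl , xs↭) with () ← trans (sym (↭-length xs↭)) len
          partner′ (x ∷ y ∷ zs , refl , xs↭) = Any.map⁺ {f = proj₂} {P = λ b → IsSquare (n * b)}
            (partner M x y zs (All-resp-↭ xs↭ roots)
                (proj₁ (∈-range⁻ (All.head ranges′))) bounded
                (subst (_≈ 0ℤ) (valueSum-↭ xs↭) Σ≈0)
                (subst Large (ℕ.suc-injective (ℕ.suc-injective (trans (sym len) (↭-length xs↭)))) q>))
            where
            ranges′ : All (_∈ range N) (map proj₂ (x ∷ y ∷ zs))
            ranges′ = All-resp-↭ π ranges
            bounded : All (λ z → proj₂ z ≤ M * M) (x ∷ y ∷ zs)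
            bounded = All.map⁻ (All.map (λ n∈ → ℕ.≤-trans (proj₂ (∈-range⁻ n∈)) N≤M²) ranges′)

        module _ (k m : ℕ) (2k≡m+2 : k + k ≡ suc (suc m)) (q> : Large m) where

          -- The filter records the length of every list, on which the factor 2 ^ (m + 2) for the
          -- choices of square roots depends.
          labelLists : List (List ℕ)
          labelLists = filter (λ ns → length ns ℕ.≟ suc (suc m)) (cover [] (suc (suc m)))

          energyCover : List (List (𝔽 q) × List (𝔽 q))
          energyCover = map (splitAt k) (concatMap rootLists labelLists)

          length-energyCover : length energyCover ≤ coverBound 0 (suc (suc m)) * e ^ suc (suc m) * 2 ^ suc (suc m)
          length-energyCover = begin
            length energyCover                    ≡⟨ length-map (splitAt k) (concatMap rootLists labelLists) ⟩
            length (concatMap rootLists labelLists)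
              ≤⟨ length-concatMap-≤ rootLists labelLists (λ {ns} ns∈ → subst (λ l → length (rootLists ns) ≤ 2 ^ l)
                   (proj₂ (∈-filter⁻ (λ ns → length ns ℕ.≟ suc (suc m)) {xs = cover [] (suc (suc m))} ns∈))
                   (length-rootLists q-prime ns)) ⟩
            length labelLists * 2 ^ suc (suc m)
              ≤⟨ ℕ.*-monoˡ-≤ (2 ^ suc (suc m))
                  (ℕ.≤-trans (length-filter (λ ns → length ns ℕ.≟ suc (suc m)) (cover [] (suc (suc m))))
                   (length-cover e partners≤ (ℕ.≤-trans length-relatedPairs LN≤e²)
                     (λ {n} m∈ → proj₁ (∈-filter⁻ (λ m → isSquare? (n * m)) {xs = range N} m∈))
                     (λ nm∈ → let n∈ , m∈ , _ = ∈-relatedPairs⁻ nm∈ in n∈ , m∈)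
                     [] (suc (suc m)) [])) ⟩
            coverBound 0 (suc (suc m)) * e ^ suc (suc m) * 2 ^ suc (suc m) ∎
            where
            open ℕ.≤-Reasoning
            open import Data.List.Properties using (length-filter)
            partners≤ : ∀ {n} → n ∈ range N → length (squarePartners n) ≤ e
            partners≤ {n} n∈ = ℕ.≮⇒≥ λ e< → ℕ.<⇒≱ (ℕ.*-mono-< e< e<)
              (ℕ.≤-trans (length-squarePartners² n {{proj₁ (∈-range⁻ n∈)}}) LN≤e²)

          splitAt-++ : ∀ (x y : List (𝔽 q)) → splitAt (length x) (x ++ y) ≡ (x , y)
          splitAt-++ []      y = refl
          splitAt-++ (a ∷ x) y rewrite splitAt-++ x y = refl

          energyCover-covers : ∀ c {x y} → x ∈ tuples S k → y ∈ tuples S k →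
                               shiftedSum c x ≡ shiftedSum c y → (x , y) ∈ energyCover
          energyCover-covers c {x} {y} x∈ y∈ Σ≡ with ∈-tuples⁻ S k x∈ | ∈-tuples⁻ S k y∈
          ... | hx , lx | hy , ly = subst (_∈ energyCover)
              (trans (cong (λ k → splitAt k (x ++ y)) (sym lx)) (splitAt-++ x y))
            (∈-map⁺ (splitAt k) (∈-concatMap⁺′ rootLists
              (∈-filter⁺ (λ ns → length ns ℕ.≟ suc (suc m))
                (∈-cover (λ {n} {m} → ∈-squarePartners {n} {m}) ∈-relatedPairs⁺ [] (suc (suc m)) ns length-ns
                  (All.++⁺ (labels-range hx) (labels-range hy))
                  paired)
                length-ns)
              (∈-rootLists-labels hx
                  (subst₂ (λ y ns → y ∈ rootLists ns) (++-identityʳ y) (++-identityʳ (labels hy))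
                      (∈-rootLists-labels hy (here refl))))))
            where
            open import Data.List.Properties using (++-identityʳ)
            open ≡ using (subst₂)
            ns = labels hx ++ labels hy
            entriesˢ = signed (λ x → x) hx ++ signed ℤ.-_ hy
            length-ns : length ns ≡ suc (suc m)
            length-ns = trans (length-++ (labels hx))
                (trans (≡.cong₂ _+_ (trans (length-labels hx) lx) (trans (length-labels hy) ly)) 2k≡m+2)
            labels-entries : map proj₂ entriesˢ ≡ ns
            labels-entries = trans (map-++ proj₂ (signed (λ x → x) hx) (signed ℤ.-_ hy))
              (≡.cong₂ _++_ (signed-labels (λ x → x) hx) (signed-labels ℤ.-_ hy))
            Σ≈0 : valueSum entriesˢ ≈ 0ℤ
            Σ≈0 = begin
              valueSum entriesˢ                             ≡⟨ valueSum-++ (signed (λ x → x) hx) (signed ℤ.-_ hy) ⟩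
              valueSum (signed (λ x → x) hx) ℤ.+ valueSum (signed ℤ.-_ hy)
                ≡⟨ ≡.cong₂ ℤ._+_ (signed-sum⁺ hx) (signed-sum⁻ hy) ⟩
              + Σ𝔽 x ℤ.- + Σ𝔽 y                             ≡⟨ shift-difference (+ Σ𝔽 x) (+ Σ𝔽 y) (+ c) ⟩
              + (Σ𝔽 x + c) ℤ.- + (Σ𝔽 y + c)                 ≈⟨ +-cong (⟦⟧-≈ Σ≡) (≡⇒≈ {ℤ.- + (Σ𝔽 y + c)} refl) ⟩
              + (Σ𝔽 y + c) ℤ.- + (Σ𝔽 y + c)                 ≡⟨ ℤ.+-inverseʳ (+ (Σ𝔽 y + c)) ⟩
              0ℤ                                            ∎
              where
              open import Relation.Binary.Reasoning.Setoid (ℤ-Algebra.setoid algebra)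
              shift-difference : ∀ a b c → a ℤ.- b ≡ (a ℤ.+ c) ℤ.- (b ℤ.+ c)
              shift-difference = solve-∀
            square-neg : ∀ x → ℤ.- x ℤ.* ℤ.- x ≡ x ℤ.* x
            square-neg = solve-∀
            paired : IsPaired [] ns
            paired = subst (IsPaired []) labels-entries (zeroSum⇒paired m q> entriesˢ
              (trans (sym (length-map proj₂ entriesˢ)) (trans (cong length labels-entries) length-ns))
              (All.++⁺ (signed-roots (λ x → x) (λ _ → refl) hx) (signed-roots ℤ.-_ square-neg hy))
              (subst (All (_∈ range N)) (sym labels-entries) (All.++⁺ (labels-range hx) (labels-range hy)))
              Σ≈0)

      T₄₂-trivial : Prime q → T₄₂ N q j ≤ (N * 2) ^ 4 * ((N * 2) ^ 4 * 1)
      T₄₂-trivial q-prime = ℕ.≤-trans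
        -- With k = 0 all eight entries are fixed, and the pair of empty tuples is the only
        -- collision.
        (T₄₂-≤ 0 4 refl (([] , []) ∷ []) λ { _ (here refl) (here refl) _ → here refl })
        (ℕ.*-mono-≤ S⁴ (ℕ.*-monoˡ-≤ 1 S⁴))
        where S⁴ = ℕ.^-monoˡ-≤ 4 (length-S q-prime)

-- Integer bounds for `T₄₂` in the three ranges of q.

module IntegerBounds where
  open import Defs
  open SquareClassCounting
  open EnergyBounds
  open import Data.Nat.Base as ℕ using (ℕ; zero; suc; _+_; _*_; _^_; _≤_; _<_; NonZero)
  import Data.Nat.Properties as ℕ
  open import Data.Nat.Primality using (Prime)
  open import Data.Nat.Solver using (module +-*-Solver)
  open import Data.Product.Base using (_×_; _,_; proj₁; proj₂; ∃)
  open import Data.Sum.Base using (_⊎_; inj₁; inj₂)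
  open import Relation.Nullary using (¬_; Dec; yes; no)
  open import Relation.Binary.PropositionalEquality as ≡ using (_≡_; _≢_; refl; sym; trans; cong)

  ^-distribʳ-* : ∀ n a b → (a * b) ^ n ≡ a ^ n * b ^ n
  ^-distribʳ-* zero    a b = refl
  ^-distribʳ-* (suc n) a b = trans (cong (a * b *_) (^-distribʳ-* n a b))
    (solve 4 (λ a b c d → a :* b :* (c :* d) := a :* c :* (b :* d)) refl a b (a ^ n) (b ^ n))
    where open +-*-Solver

  -- The witness is s + 1 with s the integer square root. As s ≥ 1, s + 1 ≤ 2 s, which accounts for
  -- the factor 4.
  sqrtAbove : ∀ n .{{_ : NonZero n}} → ∃ λ s → n ≤ s * s × s * s ≤ 4 * n
  sqrtAbove n with floorSqrt 1 n
  ... | s , s²≤n , max = suc s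
    , ℕ.≮⇒≥ (λ ss<n → ℕ.<-irrefl refl (max (suc s) (ℕ.≤-trans (ℕ.≤-reflexive (ℕ.*-identityˡ _)) (ℕ.<⇒≤ ss<n))))
    , (begin
      suc s * suc s           ≤⟨ ℕ.*-mono-≤ ss≤ ss≤ ⟩
      (s + s) * (s + s)       ≡⟨ solve 1 (λ s → (s :+ s) :* (s :+ s) := con 4 :* (con 1 :* (s :* s))) refl s ⟩
      4 * (1 * (s * s))       ≤⟨ ℕ.*-monoʳ-≤ 4 s²≤n ⟩
      4 * n                   ∎)
    where
    open ℕ.≤-Reasoning
    open +-*-Solver
    ss≤ : suc s ≤ s + s
    ss≤ = ℕ.+-monoˡ-≤ s (max 1 (ℕ.>-nonZero⁻¹ n))

  even-power-≤ : ∀ a M N n {k} → k ≡ 2 * n → M * M ≤ 4 * N → (a * M) ^ k ≤ (a * a * 4) ^ n * N ^ n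
  even-power-≤ a M N n {k} k≡2n M²≤ = begin
    (a * M) ^ k                     ≡⟨ cong ((a * M) ^_) k≡2n ⟩
    (a * M) ^ (2 * n)               ≡⟨ ℕ.^-*-assoc (a * M) 2 n ⟨
    ((a * M) ^ 2) ^ n               ≤⟨ ℕ.^-monoˡ-≤ n square ⟩
    (a * a * 4 * N) ^ n             ≡⟨ ^-distribʳ-* n (a * a * 4) N ⟩
    (a * a * 4) ^ n * N ^ n         ∎
    where
    open ℕ.≤-Reasoning
    open +-*-Solver
    square : (a * M) ^ 2 ≤ a * a * 4 * N
    square = begin
      (a * M) ^ 2          ≡⟨ solve 2 (λ a M → (a :* M) :* ((a :* M) :* con 1) := a :* a :* (M :* M)) refl a M ⟩
      a * a * (M * M)      ≤⟨ ℕ.*-monoʳ-≤ (a * a) M²≤ ⟩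
      a * a * (4 * N)      ≡⟨ ℕ.*-assoc (a * a) 4 N ⟨
      a * a * 4 * N        ∎

  module _ (q N L : ℕ) .{{_ : NonZero q}} .{{N≢0 : NonZero N}} .{{L≢0 : NonZero L}} (q-prime : Prime q)
      (N<2^L : N < 2 ^ L)
           (j : 𝔽 q) (j≢0 : j ≢ ⟦ 0 ⟧) where
    open Energy q N j
    open ℕ.≤-Reasoning
    open +-*-Solver

    private
      M = proj₁ (sqrtAbove N)
      M²≤4N = proj₂ (proj₂ (sqrtAbove N))
      instance LN≢0 = ℕ.m*n≢0 L N
      e = proj₁ (sqrtAbove (L * N))
      e²≤4LN = proj₂ (proj₂ (sqrtAbove (L * N)))
      open SmallEnergy q-prime j≢0 L M e N<2^L (proj₁ (proj₂ (sqrtAbove N))) (proj₁ (proj₂ (sqrtAbove (L * N))))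

      T = T₄₂ N q j

    bound-from-energy : ∀ k l m n → k + l ≡ 4 → k + k ≡ suc (suc m) → suc (suc m) ≡ 2 * n → Large m →
      T ≤ (N * 2) ^ l * ((N * 2) ^ l * (coverBound 0 (suc (suc m)) * (4 * (L * N)) ^ n * 2 ^ suc (suc m)))
    bound-from-energy k l m n k+l≡4 2k≡m+2 m+2≡2n large = ℕ.≤-trans
      (T₄₂-≤ k l k+l≡4 (energyCover k m 2k≡m+2 large) (energyCover-covers k m 2k≡m+2 large))
      (ℕ.*-mono-≤ Sˡ (ℕ.*-mono-≤ Sˡ (ℕ.≤-trans (length-energyCover k m 2k≡m+2 large)
        (ℕ.*-monoˡ-≤ (2 ^ suc (suc m)) (ℕ.*-monoʳ-≤ (coverBound 0 (suc (suc m))) e-power)))))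
      where
      Sˡ = ℕ.^-monoˡ-≤ l (length-S q-prime)
      e-power : e ^ suc (suc m) ≤ (4 * (L * N)) ^ n
      e-power = begin
        e ^ suc (suc m)      ≡⟨ cong (e ^_) m+2≡2n ⟩
        e ^ (2 * n)          ≡⟨ ℕ.^-*-assoc e 2 n ⟨
        (e * (e * 1)) ^ n    ≡⟨ cong (λ x → (e * x) ^ n) (ℕ.*-identityʳ e) ⟩
        (e * e) ^ n          ≤⟨ ℕ.^-monoˡ-≤ n e²≤4LN ⟩
        (4 * (L * N)) ^ n    ∎

    module _ (K : ℕ) where

      energy₂-bound : Large 2 → (2 ^ 4) * (coverBound 0 4 * 4 ^ 2 * 2 ^ 4) ≤ K → T ≤ K * (L ^ 2 * N ^ 6)
      energy₂-bound large c≤K = begin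
        T
          ≤⟨ bound-from-energy 2 2 2 2 refl refl refl large ⟩
        (N * 2) ^ 2 * ((N * 2) ^ 2 * (coverBound 0 4 * (4 * (L * N)) ^ 2 * 2 ^ 4))
          ≡⟨ regroup 2 4 (coverBound 0 4) L N ⟩
        (2 ^ 4) * (coverBound 0 4 * 4 ^ 2 * 2 ^ 4) * (L ^ 2 * N ^ 6)
          ≤⟨ ℕ.*-monoˡ-≤ (L ^ 2 * N ^ 6) c≤K ⟩
        K * (L ^ 2 * N ^ 6) ∎
        where
        regroup : ∀ t f c L N → (N * t) ^ 2 * ((N * t) ^ 2 * (c * (f * (L * N)) ^ 2 * t ^ 4)) ≡ (t ^ 4) *
            (c * f ^ 2 * t ^ 4) * (L ^ 2 * N ^ 6)
        regroup = solve 5 (λ t f c L N → (N :* t) :^ 2 :* ((N :* t) :^ 2 :* (c :* (f :* (L :* N)) :^ 2 :* t :^ 4))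
            := (t :^ 4) :* (c :* f :^ 2 :* t :^ 4) :* (L :^ 2 :* N :^ 6)) refl

      energy₃-bound : Large 4 → (2 ^ 2) * (coverBound 0 6 * 4 ^ 3 * 2 ^ 6) ≤ K → T ≤ K * (L ^ 3 * N ^ 5)
      energy₃-bound large c≤K = begin
        T
          ≤⟨ bound-from-energy 3 1 4 3 refl refl refl large ⟩
        (N * 2) ^ 1 * ((N * 2) ^ 1 * (coverBound 0 6 * (4 * (L * N)) ^ 3 * 2 ^ 6))
          ≡⟨ regroup 2 4 (coverBound 0 6) L N ⟩
        (2 ^ 2) * (coverBound 0 6 * 4 ^ 3 * 2 ^ 6) * (L ^ 3 * N ^ 5)
          ≤⟨ ℕ.*-monoˡ-≤ (L ^ 3 * N ^ 5) c≤K ⟩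
        K * (L ^ 3 * N ^ 5) ∎
        where
        regroup : ∀ t f c L N → (N * t) ^ 1 * ((N * t) ^ 1 * (c * (f * (L * N)) ^ 3 * t ^ 6)) ≡ (t ^ 2) *
            (c * f ^ 3 * t ^ 6) * (L ^ 3 * N ^ 5)
        regroup = solve 5 (λ t f c L N → (N :* t) :^ 1 :* ((N :* t) :^ 1 :* (c :* (f :* (L :* N)) :^ 3 :* t :^ 6))
            := (t :^ 2) :* (c :* f :^ 3 :* t :^ 6) :* (L :^ 3 :* N :^ 5)) refl

    -- The constants stay variables so that large powers are never evaluated. In q ≤ d₂ N⁴ and q ≤
    -- d₃ N¹⁶, the bases 4 · 4 · 4 and 6 · 6 · 4 are (2k)² times the 4 of M² ≤ 4 N; s stands for the
    -- 2¹⁶ in the square of (2 N)⁸.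
    module _ (c₂ c₃ : ℕ) (c₂≥ : (2 ^ 4) * (coverBound 0 4 * 4 ^ 2 * 2 ^ 4) ≤ c₂)
             (c₃≥ : (2 ^ 2) * (coverBound 0 6 * 4 ^ 3 * 2 ^ 6) ≤ c₃)
             (d₂ d₃ : ℕ) (d₂≥ : (4 * 4 * 4) ^ 4 ≤ d₂) (d₃≥ : (6 * 6 * 4) ^ 16 ≤ d₃)
             (s : ℕ) (s≥ : 2 ^ 16 ≤ s) where

      large? : ∀ m → Dec (Large m)
      large? m = (suc (suc m) * M) ^ (2 ^ suc m) ℕ.<? q

      ¬large⇒q≤ : ∀ m n → 2 ^ suc m ≡ 2 * n → ¬ Large m → q ≤ (suc (suc m) * suc (suc m) * 4) ^ n * N ^ n
      ¬large⇒q≤ m n e ¬large = ℕ.≤-trans (ℕ.≮⇒≥ ¬large) (even-power-≤ (suc (suc m)) M N n e M²≤4N)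

      -- The bound on T q^(1/2) is kept squared so as to remain in ℕ. Here 28 = 2 · 6 + 16 = 2 · 14.
      large₂⇒ : Large 2 → ¬ Large 4 → T * T * q ≤ c₂ * c₂ * d₃ * (L ^ 4 * N ^ 28)
      large₂⇒ q>₂ q≯₃ = begin
        T * T * q
          ≤⟨ ℕ.*-mono-≤ (ℕ.*-mono-≤ T≤ T≤) (ℕ.≤-trans (¬large⇒q≤ 4 16 refl q≯₃) (ℕ.*-monoˡ-≤ (N ^ 16) d₃≥)) ⟩
        c₂ * (L ^ 2 * N ^ 6) * (c₂ * (L ^ 2 * N ^ 6)) * (d₃ * N ^ 16)
          ≡⟨ regroup c₂ d₃ L N ⟩
        c₂ * c₂ * d₃ * (L ^ 4 * N ^ 28) ∎
        where
        T≤ : T ≤ c₂ * (L ^ 2 * N ^ 6)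
        T≤ = energy₂-bound c₂ q>₂ c₂≥
        regroup : ∀ c d L N → c * (L ^ 2 * N ^ 6) * (c * (L ^ 2 * N ^ 6)) * (d * N ^ 16) ≡ c * c * d * (L ^ 4 * N ^ 28)
        regroup c d L N = trans
          (solve 5 (λ c d l n n′ → c :* (l :* n) :* (c :* (l :* n)) :* (d :* n′)
              := c :* c :* d :* (l :* l :* (n :* n :* n′)))
            refl c d (L ^ 2) (N ^ 6) (N ^ 16))
          (≡.cong₂ (λ l n → c * c * d * (l * n)) (sym (ℕ.^-distribˡ-+-* L 2 2))
            (sym (trans (ℕ.^-distribˡ-+-* N 12 16) (cong (_* N ^ 16) (ℕ.^-distribˡ-+-* N 6 6)))))

      small⇒ : ¬ Large 2 → T * T * q ≤ s * d₂ * (L ^ 4 * N ^ 28)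
      small⇒ q≯₂ = begin
        T * T * q
          ≤⟨ ℕ.*-mono-≤ (ℕ.*-mono-≤ (T₄₂-trivial q-prime) (T₄₂-trivial q-prime))
              (ℕ.≤-trans (¬large⇒q≤ 2 4 refl q≯₂) (ℕ.*-monoˡ-≤ (N ^ 4) d₂≥)) ⟩
        (N * 2) ^ 4 * ((N * 2) ^ 4 * 1) * ((N * 2) ^ 4 * ((N * 2) ^ 4 * 1)) * (d₂ * N ^ 4)
          ≡⟨ regroup 2 d₂ N ⟩
        2 ^ 16 * d₂ * N ^ 20
          -- There is room to spare: N²⁰ ≤ N²⁸ and 1 ≤ L⁴ bring this range to the form of the middle
          -- one.
          ≤⟨ ℕ.*-mono-≤ (ℕ.*-monoˡ-≤ d₂ s≥)
               (ℕ.≤-trans (ℕ.^-monoʳ-≤ N {20} {28} (ℕ.m≤m+n 20 8)) (ℕ.m≤n*m (N ^ 28) (L ^ 4) {{ℕ.m^n≢0 L 4}})) ⟩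
        s * d₂ * (L ^ 4 * N ^ 28) ∎
        where
        regroup : ∀ t d N → (N * t) ^ 4 * ((N * t) ^ 4 * 1) * ((N * t) ^ 4 * ((N * t) ^ 4 * 1)) *
            (d * N ^ 4) ≡ t ^ 16 * d * N ^ 20
        regroup t d N = trans
          (cong (λ x → x * (x * 1) * (x * (x * 1)) * (d * N ^ 4)) (^-distribʳ-* 4 N t))
          (trans (solve 3 (λ n t d → n :* t :* (n :* t :* con 1) :* (n :* t :* (n :* t :* con 1)) :* (d :* n)
                       := t :* t :* (t :* t) :* d :* (n :* n :* (n :* n) :* n)) refl (N ^ 4) (t ^ 4) d)
            (≡.cong₂ (λ t n → t * d * n) (fourth t)
                (trans (cong (_* N ^ 4) (fourth N)) (sym (ℕ.^-distribˡ-+-* N 16 4)))))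
          where
          fourth : ∀ x → x ^ 4 * x ^ 4 * (x ^ 4 * x ^ 4) ≡ x ^ 16
          fourth x = sym (trans (ℕ.^-distribˡ-+-* x 8 8)
              (≡.cong₂ _*_ (ℕ.^-distribˡ-+-* x 4 4) (ℕ.^-distribˡ-+-* x 4 4)))

      T-dichotomy : T ≤ c₃ * (L ^ 3 * N ^ 5) ⊎
                    T * T * q ≤ (c₂ * c₂ * d₃ + s * d₂) * (L ^ 4 * N ^ 28)
      T-dichotomy = split (large? 2) (large? 4)
        where
        split : Dec (Large 2) → Dec (Large 4) → _
        split _ (yes q>₃)         = inj₁ (energy₃-bound c₃ q>₃ c₃≥)
        split (yes q>₂) (no q≯₃)  = inj₂ (ℕ.≤-trans (large₂⇒ q>₂ q≯₃)
          (ℕ.*-monoˡ-≤ (L ^ 4 * N ^ 28) (ℕ.m≤m+n (c₂ * c₂ * d₃) (s * d₂))))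
        split (no q≯₂) (no _)     = inj₂ (ℕ.≤-trans (small⇒ q≯₂)
          (ℕ.*-monoˡ-≤ (L ^ 4 * N ^ 28) (ℕ.m≤n+m (s * d₂) (c₂ * c₂ * d₃))))

-- Powers of log N are absorbed by N^ε.

module Absorption where
  open import Data.Nat.Base as ℕ using (ℕ; zero; suc; _+_; _*_; _^_; _≤_; _<_; z≤n; s≤s; ⌊_/2⌋; ⌈_/2⌉)
  import Data.Nat.Properties as ℕ
  open import Data.Nat.Solver using (module +-*-Solver)
  open import Data.Product.Base using (_,_; ∃)
  open import Relation.Binary.PropositionalEquality as ≡ using (_≡_; refl; sym; trans; cong)
  open IntegerBounds

  n<2^n : ∀ n → n < 2 ^ n
  n<2^n zero    = s≤s z≤n
  n<2^n (suc n) = ℕ.≤-trans (ℕ.+-mono-≤ (ℕ.m^n>0 2 n) (n<2^n n)) (ℕ.+-monoʳ-≤ (2 ^ n) (ℕ.m≤m+n (2 ^ n) 0))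

  -- Halving L turns Lᵈ⁺¹ ≤ 2ᴸ into hᵈ ≤ 2ʰ with h = ⌊L/2⌋, since h ≤ 2ʰ.
  exponential-dominates : ∀ d C → ∃ λ L₀ → ∀ L → L₀ ≤ L → C * L ^ d ≤ 2 ^ L
  exponential-dominates zero C = C , λ L C≤L → ℕ.≤-trans (ℕ.≤-reflexive (ℕ.*-identityʳ C))
      (ℕ.≤-trans C≤L (ℕ.<⇒≤ (n<2^n L)))
  exponential-dominates (suc d) C with exponential-dominates d (C * 3 ^ suc d)
  -- h₀ + 1 instead of h₀ makes h = ⌊L / 2⌋ positive, so that L ≤ 2 h + 1 ≤ 3 h; this 3 is the one
  -- in `3 ^ suc d`.
  ... | h₀ , dom = suc h₀ * 2 , λ L L₀≤L → bound L (half-≥ L L₀≤L)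
    where
    half-≥ : ∀ L → suc h₀ * 2 ≤ L → suc h₀ ≤ ⌊ L /2⌋
    half-≥ L L₀≤L = ℕ.≤-trans (ℕ.≤-reflexive (trans (ℕ.n≡⌊n+n/2⌋ (suc h₀)) (cong ⌊_/2⌋ double))) (ℕ.⌊n/2⌋-mono L₀≤L)
      where
      double : suc h₀ + suc h₀ ≡ suc h₀ * 2
      double = trans (cong (suc h₀ +_) (sym (ℕ.+-identityʳ _))) (ℕ.*-comm 2 (suc h₀))
    bound : ∀ L → suc h₀ ≤ ⌊ L /2⌋ → C * L ^ suc d ≤ 2 ^ L
    bound L h₀<h = begin
      C * L ^ suc d                          ≤⟨ ℕ.*-monoʳ-≤ C (ℕ.^-monoˡ-≤ (suc d) L≤3h) ⟩
      C * (3 * h) ^ suc d                    ≡⟨ cong (C *_) (^-distribʳ-* (suc d) 3 h) ⟩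
      C * (3 ^ suc d * (h * h ^ d))
          ≡⟨ solve 4 (λ c t h p → c :* (t :* (h :* p)) := c :* t :* p :* h) refl C (3 ^ suc d) h (h ^ d) ⟩
      C * 3 ^ suc d * h ^ d * h              ≤⟨ ℕ.*-mono-≤ (dom h (ℕ.<⇒≤ h₀<h)) (ℕ.<⇒≤ (n<2^n h)) ⟩
      2 ^ h * 2 ^ h                          ≡⟨ ℕ.^-distribˡ-+-* 2 h h ⟨
      2 ^ (h + h)
          ≤⟨ ℕ.^-monoʳ-≤ 2 (ℕ.≤-trans (ℕ.+-monoʳ-≤ h (ℕ.⌊n/2⌋≤⌈n/2⌉ L)) (ℕ.≤-reflexive (ℕ.⌊n/2⌋+⌈n/2⌉≡n L))) ⟩
      2 ^ L                                  ∎
      where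
      open ℕ.≤-Reasoning
      open +-*-Solver
      h = ⌊ L /2⌋
      L≤3h : L ≤ 3 * h
      L≤3h = begin
        L                  ≡⟨ ℕ.⌊n/2⌋+⌈n/2⌉≡n L ⟨
        h + ⌈ L /2⌉        ≤⟨ ℕ.+-monoʳ-≤ h (ℕ.⌊n/2⌋-mono (ℕ.≤-refl {suc L})) ⟩
        h + ⌊ suc L /2⌋    ≤⟨ ℕ.+-monoʳ-≤ h (ℕ.⌊n/2⌋-mono (ℕ.n≤1+n (suc L))) ⟩
        h + suc h          ≤⟨ ℕ.+-monoʳ-≤ h (ℕ.+-monoˡ-≤ h (ℕ.≤-trans (s≤s z≤n) h₀<h)) ⟩
        h + (h + h)        ≡⟨ solve 1 (λ h → h :+ (h :+ h) := con 3 :* h) refl h ⟩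
        3 * h              ∎

  -- K (log N)^a ≤ N^(1/r), with the root cleared; r will be the denominator of ε. The hypotheses
  -- make L the number of binary digits of N, and the factor 2 lost in 2 ^ L ≤ 2 N is paid for by
  -- asking for the constant 2 K^r.
  absorb : ∀ K a r → ∃ λ N₀ → ∀ N L → N₀ ≤ N → N < 2 ^ L → 2 ^ L ≤ 2 * N → (K * L ^ a) ^ r ≤ N
  absorb K a r with exponential-dominates (a * r) (2 * K ^ r)
  ... | L₀ , dom = 2 ^ L₀ , λ N L N₀≤N N<2^L 2^L≤2N → ℕ.*-cancelˡ-≤ 2 (begin
    2 * (K * L ^ a) ^ r
        ≡⟨ cong (2 *_) (trans (^-distribʳ-* r K (L ^ a)) (cong (K ^ r *_) (ℕ.^-*-assoc L a r))) ⟩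
    2 * (K ^ r * L ^ (a * r))    ≡⟨ ℕ.*-assoc 2 (K ^ r) _ ⟨
    2 * K ^ r * L ^ (a * r)      ≤⟨ dom L (ℕ.≮⇒≥ λ L<L₀ → ℕ.<⇒≱ (ℕ.≤-<-trans N₀≤N N<2^L) (ℕ.^-monoʳ-≤ 2 (ℕ.<⇒≤ L<L₀))) ⟩
    2 ^ L                        ≤⟨ 2^L≤2N ⟩
    2 * N                        ∎)
    where open ℕ.≤-Reasoning

-- From inequalities of integers to upper Dedekind cuts.

module CutBounds where
  open import Defs
  open import Algebra.Bundles using (CommutativeRing)
  import Algebra.Solver.Ring.NaturalCoefficients.Default as SemiringSolver
  import Algebra.Properties.CommutativeSemiring.Exp as Exp
  import Algebra.Definitions.RawSemiring
  open import Data.Integer.Base as ℤ using (ℤ; +_; +[1+_])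
  import Data.Integer.Properties as ℤ
  open import Data.Nat.Base as ℕ using (ℕ; zero; suc; NonZero)
  import Data.Nat.Properties as ℕ
  open import Data.Product.Base using (_,_)
  open import Data.Sum.Base using (_⊎_; inj₁; inj₂)
  open import Data.Rational.Unnormalised.Base as ℚᵘ
    using (ℚᵘ; mkℚᵘ; 0ℚᵘ; _/_; _+_; _*_; -_; _≤_; _<_; _≃_; *≡*; *≤*; *<*; ↥_)
  import Data.Rational.Unnormalised.Properties as ℚᵘ
  open import Relation.Binary.PropositionalEquality as ≡ using (_≡_; sym; trans; cong; subst)

  open Algebra.Definitions.RawSemiring ℚᵘ.+-*-rawSemiring using () renaming (_^_ to _^ℚ_)
  private
    module ℚExp = Exp (CommutativeRing.commutativeSemiring ℚᵘ.+-*-commutativeRing)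

  fromℕ : ℕ → ℚᵘ
  fromℕ n = + n / 1

  fromℕ-* : ∀ m n → fromℕ m * fromℕ n ≃ fromℕ (m ℕ.* n)
  fromℕ-* m n = *≡* (cong (ℤ._* (+ 1)) (sym (ℤ.pos-* m n)))

  fromℕ-mono : ∀ {m n} → m ℕ.≤ n → fromℕ m ≤ fromℕ n
  fromℕ-mono m≤n = *≤* (ℤ.*-monoʳ-≤-nonNeg (+ 1) (ℤ.+≤+ m≤n))

  fromℕ-cancel : ∀ {m n} → fromℕ m ≤ fromℕ n → m ℕ.≤ n
  fromℕ-cancel {m} {n} (*≤* h) = ℤ.drop‿+≤+ (≡.subst₂ ℤ._≤_ (ℤ.*-identityʳ (+ m)) (ℤ.*-identityʳ (+ n)) h)

  *-mono : ∀ {p q r s} → 0ℚᵘ ≤ p → p ≤ q → 0ℚᵘ ≤ r → r ≤ s → p * r ≤ q * s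
  *-mono 0≤p p≤q 0≤r r≤s = ℚᵘ.*-mono-≤-nonNeg {{ℚᵘ.nonNegative 0≤p}} {{ℚᵘ.nonNegative 0≤r}} p≤q r≤s

  *-nonNeg : ∀ {p q} → 0ℚᵘ ≤ p → 0ℚᵘ ≤ q → 0ℚᵘ ≤ p * q
  *-nonNeg {p} {q} 0≤p 0≤q = ℚᵘ.nonNegative⁻¹ (p * q)
    {{ℚᵘ.nonNeg*nonNeg⇒nonNeg p {{ℚᵘ.nonNegative 0≤p}} q {{ℚᵘ.nonNegative 0≤q}}}}

  ≤-+ʳ : ∀ {p q} → 0ℚᵘ ≤ q → p ≤ p + q
  ≤-+ʳ {p} {q} 0≤q = ℚᵘ.p≤p+q p q {{ℚᵘ.nonNegative 0≤q}}

  ≤-+ˡ : ∀ {p q} → 0ℚᵘ ≤ q → p ≤ q + p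
  ≤-+ˡ {p} {q} 0≤q = ℚᵘ.p≤q+p p q {{ℚᵘ.nonNegative 0≤q}}

  0≤fromℕ : ∀ n → 0ℚᵘ ≤ fromℕ n
  0≤fromℕ n = fromℕ-mono ℕ.z≤n

  ^-nonNeg : ∀ {a} n → 0ℚᵘ ≤ a → 0ℚᵘ ≤ a ^ℚ n
  ^-nonNeg zero    _   = 0≤fromℕ 1
  ^-nonNeg (suc n) 0≤a = *-nonNeg 0≤a (^-nonNeg n 0≤a)

  ^-mono : ∀ {a b} n → 0ℚᵘ ≤ a → a ≤ b → a ^ℚ n ≤ b ^ℚ n
  ^-mono zero    _   _   = ℚᵘ.≤-refl
  ^-mono (suc n) 0≤a a≤b = *-mono 0≤a a≤b (^-nonNeg n 0≤a) (^-mono n 0≤a a≤b)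

  fromℕ-^ : ∀ m n → fromℕ m ^ℚ n ≃ fromℕ (m ℕ.^ n)
  fromℕ-^ m zero    = ℚᵘ.≃-refl
  fromℕ-^ m (suc n) = ℚᵘ.≃-trans (ℚᵘ.*-congˡ {fromℕ m} (fromℕ-^ m n)) (fromℕ-* m (m ℕ.^ n))

  open ℚᵘ.≤-Reasoning

  -- Were f < T, then f^r ≤ T^r ≤ n < f^r.
  ≤-root : ∀ {f} T r n → 0ℚᵘ < f → fromℕ n < f ^ℚ r → T ℕ.^ r ℕ.≤ n → fromℕ T ≤ f
  ≤-root {f} T r n 0<f n<fʳ Tʳ≤n = ℚᵘ.≮⇒≥ λ f<T → ℚᵘ.<-irrefl ℚᵘ.≃-refl (begin-strict
    f ^ℚ r             ≤⟨ ^-mono r (ℚᵘ.<⇒≤ 0<f) (ℚᵘ.<⇒≤ f<T) ⟩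
    fromℕ T ^ℚ r       ≃⟨ fromℕ-^ T r ⟩
    fromℕ (T ℕ.^ r)    ≤⟨ fromℕ-mono Tʳ≤n ⟩
    fromℕ n            <⟨ n<fʳ ⟩
    f ^ℚ r             ∎)

  1/n<y⇒1≤yn : ∀ n .{{_ : NonZero n}} {y} → + 1 / n < y → fromℕ 1 ≤ y * fromℕ n
  1/n<y⇒1≤yn n@(suc n-1) {y} h = begin
    fromℕ 1
        ≃⟨ *≡* (trans (ℤ.*-identityˡ (+ (n ℕ.* 1)))
            (trans (cong +_ (ℕ.*-comm n 1)) (sym (ℤ.*-identityʳ (+ (1 ℕ.* n)))))) ⟩
    (+ 1 / n) * fromℕ n    ≤⟨ *-mono (*≤* (ℤ.+≤+ ℕ.z≤n)) (ℚᵘ.<⇒≤ h) (0≤fromℕ n) ℚᵘ.≤-refl ⟩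
    y * fromℕ n            ∎

  -- Here c > n, d > Q^(-1/2) and e > k^(1/R). If c d e < T, squaring clears the root of Q, as d² Q
  -- ≥ 1, and the R-th power clears that of k; the result n^(2R) k² ≤ (T² Q)^R contradicts the
  -- strict hypothesis.
  ≤-product : ∀ {c d e} T n Q R k → .{{_ : NonZero Q}} → 0ℚᵘ < c → 0ℚᵘ < d → 0ℚᵘ < e →
              fromℕ n < c ^ℚ 1 → + 1 / Q < d ^ℚ 2 → fromℕ k < e ^ℚ R →
              (T ℕ.* T ℕ.* Q) ℕ.^ R ℕ.< (n ℕ.* n) ℕ.^ R ℕ.* (k ℕ.* k) → fromℕ T ≤ c * d * e
  ≤-product {c} {d} {e} T n Q R k 0<c 0<d 0<e n<c Q<d k<e small = ℚᵘ.≮⇒≥ λ x<T →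
    ℕ.<⇒≱ small (fromℕ-cancel (begin
      fromℕ ((n ℕ.* n) ℕ.^ R ℕ.* (k ℕ.* k))                ≃⟨ fromℕ-* ((n ℕ.* n) ℕ.^ R) (k ℕ.* k) ⟨
      fromℕ ((n ℕ.* n) ℕ.^ R) * fromℕ (k ℕ.* k)            ≃⟨ ℚᵘ.*-cong (fromℕ-^ (n ℕ.* n) R) (fromℕ-* k k) ⟨
      fromℕ (n ℕ.* n) ^ℚ R * (fromℕ k * fromℕ k)
        ≤⟨ *-mono (^-nonNeg R (0≤fromℕ (n ℕ.* n))) (^-mono R (0≤fromℕ (n ℕ.* n)) n²≤W)
             (*-nonNeg (0≤fromℕ k) (0≤fromℕ k)) (*-mono (0≤fromℕ k) k≤ (0≤fromℕ k) k≤) ⟩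
      W ^ℚ R * (e ^ℚ R * e ^ℚ R)                           ≃⟨ ℚᵘ.*-congˡ {W ^ℚ R} (ℚExp.^-distrib-* e e R) ⟨
      W ^ℚ R * (e * e) ^ℚ R                                ≃⟨ ℚExp.^-distrib-* W (e * e) R ⟨
      (W * (e * e)) ^ℚ R
        ≤⟨ ^-mono R (*-nonNeg (ℚᵘ.≤-trans (0≤fromℕ (n ℕ.* n)) n²≤W) (*-nonNeg 0≤e 0≤e)) (Y≤ x<T) ⟩
      fromℕ (T ℕ.* T ℕ.* Q) ^ℚ R                           ≃⟨ fromℕ-^ (T ℕ.* T ℕ.* Q) R ⟩
      fromℕ ((T ℕ.* T ℕ.* Q) ℕ.^ R)                        ∎))
    where
    open SemiringSolver (CommutativeRing.commutativeSemiring ℚᵘ.+-*-commutativeRing)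
    W = c * c * (d ^ℚ 2 * fromℕ Q)
    0≤c = ℚᵘ.<⇒≤ 0<c
    0≤d = ℚᵘ.<⇒≤ 0<d
    0≤e = ℚᵘ.<⇒≤ 0<e
    k≤ : fromℕ k ≤ e ^ℚ R
    k≤ = ℚᵘ.<⇒≤ k<e
    n≤c : fromℕ n ≤ c
    n≤c = ℚᵘ.≤-trans (ℚᵘ.<⇒≤ n<c) (ℚᵘ.≤-reflexive (ℚᵘ.*-identityʳ c))
    n²≤W : fromℕ (n ℕ.* n) ≤ W
    n²≤W = begin
      fromℕ (n ℕ.* n)              ≃⟨ fromℕ-* n n ⟨
      fromℕ n * fromℕ n            ≃⟨ ℚᵘ.*-identityʳ _ ⟨
      fromℕ n * fromℕ n * fromℕ 1
        ≤⟨ *-mono (*-nonNeg (0≤fromℕ n) (0≤fromℕ n)) (*-mono (0≤fromℕ n) n≤c (0≤fromℕ n) n≤c)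
             (0≤fromℕ 1) (1/n<y⇒1≤yn Q Q<d) ⟩
      c * c * (d ^ℚ 2 * fromℕ Q)   ∎
    Y≤ : c * d * e < fromℕ T → W * (e * e) ≤ fromℕ (T ℕ.* T ℕ.* Q)
    Y≤ x<T = begin
      W * (e * e)
        ≃⟨ solve 4 (λ c d e q → c :* c :* (d :* (d :* con 1) :* q) :* (e :* e) := c :* d :* e :* (c :* d :* e) :* q)
             ℚᵘ.≃-refl c d e (fromℕ Q) ⟩
      x * x * fromℕ Q
        ≤⟨ *-mono (*-nonNeg 0≤x 0≤x) (*-mono 0≤x x≤T 0≤x x≤T) (0≤fromℕ Q) ℚᵘ.≤-refl ⟩
      fromℕ T * fromℕ T * fromℕ Q     ≃⟨ ℚᵘ.*-congʳ {fromℕ Q} (fromℕ-* T T) ⟩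
      fromℕ (T ℕ.* T) * fromℕ Q       ≃⟨ fromℕ-* (T ℕ.* T) Q ⟩
      fromℕ (T ℕ.* T ℕ.* Q)           ∎
      where
      x = c * d * e
      0≤x = *-nonNeg (*-nonNeg 0≤c 0≤d) 0≤e
      x≤T = ℚᵘ.<⇒≤ x<T

  -- With ε = (p + 1) / d, the unnormalised sum a + ε is literally (a d + p + 1) / (1 · d); this is
  -- also why `R` below is `1 ℕ.* d`.
  ↥-natural+ : ∀ a p d-1 → ↥ (+ a / 1 + mkℚᵘ +[1+ p ] d-1) ≡ + (a ℕ.* suc d-1 ℕ.+ suc p)
  ↥-natural+ a p d-1 = ≡.cong₂ ℤ._+_ (sym (ℤ.pos-* a (suc d-1))) (ℤ.*-identityʳ +[1+ p ])

  module _ (N q : ℕ) .{{_ : NonZero N}} .{{_ : NonZero q}} (p d-1 : ℕ) where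
    private
      ε = mkℚᵘ +[1+ p ] d-1
      d = suc d-1
      R = 1 ℕ.* d

    -- An element of the target cut is a sum of nonnegative parts, so it is at least each of them,
    -- and either alternative suffices. The factor `q ℕ.^ 1` is the denominator that `_^ᶻ_` gives to
    -- q^(-1).
    ≤ᴿ-target : ∀ T →
      T ℕ.^ R ℕ.≤ N ℕ.^ (5 ℕ.* d ℕ.+ suc p) ⊎
      (T ℕ.* T ℕ.* q ℕ.^ 1) ℕ.^ R ℕ.< (N ℕ.^ 8 ℕ.* N ℕ.^ 8) ℕ.^ R ℕ.*
          (N ℕ.^ (6 ℕ.* d ℕ.+ suc p) ℕ.* N ℕ.^ (6 ℕ.* d ℕ.+ suc p)) →
      T ≤ᴿ (N ^ᴿ (+ 5 / 8) *ᴿ q ^ᴿ (- (+ 1 / 8)) +ᴿ N ^ᴿ (+ 8 / 1) *ᴿ q ^ᴿ (- (+ 1 / 2))) *ᴿ N ^ᴿ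
          (+ 6 / 1 + ε) +ᴿ N ^ᴿ (+ 5 / 1 + ε)
    ≤ᴿ-target T bounds x
      -- a, b, c, z, e and f lie in the cuts of N^(5/8), q^(-1/8), N^8, q^(-1/2), N^(6+ε) and
      -- N^(5+ε).
      (A , f , (B , e , (B₁ , B₂ , (a , b , (0<a , _) , (0<b , _) , B₁≃) ,
          (c , z , (0<c , n<c) , (0<z , q<z) , B₂≃) , B≃) , (0<e , k<e) , A≃) , (0<f , l<f) , x≃)
      = split bounds
      where
      0≤f = ℚᵘ.<⇒≤ 0<f
      0≤e = ℚᵘ.<⇒≤ 0<e
      0≤B₁ : 0ℚᵘ ≤ B₁
      0≤B₁ = ℚᵘ.≤-trans (*-nonNeg (ℚᵘ.<⇒≤ 0<a) (ℚᵘ.<⇒≤ 0<b)) (ℚᵘ.≤-reflexive (ℚᵘ.≃-sym B₁≃))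
      0≤cz : 0ℚᵘ ≤ c * z
      0≤cz = *-nonNeg (ℚᵘ.<⇒≤ 0<c) (ℚᵘ.<⇒≤ 0<z)
      cz≤B : c * z ≤ B
      cz≤B = begin
        c * z      ≃⟨ B₂≃ ⟨
        B₂         ≤⟨ ≤-+ˡ 0≤B₁ ⟩
        B₁ + B₂    ≃⟨ B≃ ⟨
        B          ∎
      cze≤A : c * z * e ≤ A
      cze≤A = ℚᵘ.≤-trans (*-mono 0≤cz cz≤B 0≤e ℚᵘ.≤-refl) (ℚᵘ.≤-reflexive (ℚᵘ.≃-sym A≃))
      0≤A : 0ℚᵘ ≤ A
      0≤A = ℚᵘ.≤-trans (*-nonNeg 0≤cz 0≤e) cze≤A
      split : _ ⊎ _ → fromℕ T ≤ x
      split (inj₁ small) = begin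
        fromℕ T    ≤⟨ ≤-root T R (N ℕ.^ (5 ℕ.* d ℕ.+ suc p)) 0<f
            (subst (λ E → (N ^ᶻ E) < f ^ℚ R) (↥-natural+ 5 p d-1) l<f) small ⟩
        f          ≤⟨ ≤-+ˡ 0≤A ⟩
        A + f      ≃⟨ x≃ ⟨
        x          ∎
      split (inj₂ small) = begin
        fromℕ T    ≤⟨ ≤-product T (N ℕ.^ 8) (q ℕ.^ 1) R (N ℕ.^ (6 ℕ.* d ℕ.+ suc p)) {{ℕ.m^n≢0 q 1}} 0<c 0<z 0<e n<c q<z
                        (subst (λ E → (N ^ᶻ E) < e ^ℚ R) (↥-natural+ 6 p d-1) k<e) small ⟩
        c * z * e  ≤⟨ cze≤A ⟩
        A          ≤⟨ ≤-+ʳ 0≤f ⟩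
        A + f      ≃⟨ x≃ ⟨
        x          ∎

-- Uniform constants and the comparison of exponents.

module Exponents where
  open import Defs
  open SquareClassCounting
  open IntegerBounds
  open import Data.Nat.Base as ℕ using (ℕ; suc; NonZero; _≤_; s≤s)
  import Data.Nat.Properties as ℕ
  open import Data.Nat.Primality using (Prime)
  open import Data.Nat.Solver using (module +-*-Solver)
  open import Data.Product.Base using (_,_; proj₁; proj₂; ∃; ∃₂)
  open import Data.Sum.Base using (_⊎_)
  open import Relation.Binary.PropositionalEquality using (_≡_; _≢_; refl; sym; trans; cong)

  -- Abstract, since unfolding constants such as 144¹⁶ exhausts the memory.
  abstract
    upperBound : ∀ n → ∃ λ c → n ≤ c
    upperBound n = n , ℕ.≤-refl

  Dichotomy : ℕ → ℕ → Set
  Dichotomy K₃ K₂ = ∀ q N L .{{_ : NonZero q}} .{{_ : NonZero N}} .{{_ : NonZero L}} →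
    Prime q → N ℕ.< 2 ℕ.^ L → (j : 𝔽 q) → j ≢ ⟦ 0 ⟧ →
    T₄₂ N q j ≤ K₃ ℕ.* (L ℕ.^ 3 ℕ.* N ℕ.^ 5) ⊎
    T₄₂ N q j ℕ.* T₄₂ N q j ℕ.* q ≤ K₂ ℕ.* (L ℕ.^ 4 ℕ.* N ℕ.^ 28)

  T₄₂-dichotomy : ∃₂ Dichotomy
  T₄₂-dichotomy = c₃ , c₂ ℕ.* c₂ ℕ.* d₃ ℕ.+ s ℕ.* d₂ , dichotomy
    where
    energy₂-constant = upperBound ((2 ℕ.^ 4) ℕ.* (coverBound 0 4 ℕ.* 4 ℕ.^ 2 ℕ.* 2 ℕ.^ 4))
    energy₃-constant = upperBound ((2 ℕ.^ 2) ℕ.* (coverBound 0 6 ℕ.* 4 ℕ.^ 3 ℕ.* 2 ℕ.^ 6))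
    modulus₂-constant = upperBound ((4 ℕ.* 4 ℕ.* 4) ℕ.^ 4)
    modulus₃-constant = upperBound ((6 ℕ.* 6 ℕ.* 4) ℕ.^ 16)
    trivial-constant = upperBound (2 ℕ.^ 16)
    c₂ = proj₁ energy₂-constant
    c₃ = proj₁ energy₃-constant
    d₂ = proj₁ modulus₂-constant
    d₃ = proj₁ modulus₃-constant
    s  = proj₁ trivial-constant
    dichotomy : Dichotomy c₃ (c₂ ℕ.* c₂ ℕ.* d₃ ℕ.+ s ℕ.* d₂)
    dichotomy q N L q-prime N<2^L j j≢0 = T-dichotomy q N L q-prime N<2^L j j≢0
      c₂ c₃ (proj₂ energy₂-constant) (proj₂ energy₃-constant)
      d₂ d₃ (proj₂ modulus₂-constant) (proj₂ modulus₃-constant) s (proj₂ trivial-constant)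

  module _ (K₃ K₂ : ℕ) (p d N L T Q : ℕ) .{{_ : NonZero N}} (2≤N : 2 ≤ N) where
    open ℕ.≤-Reasoning
    private R = 1 ℕ.* d

    R*k≡ : ∀ k → k ℕ.* R ≡ k ℕ.* d
    R*k≡ k = cong (k ℕ.*_) (ℕ.*-identityˡ d)

    -- After the R-th power, the constant and the logarithms cost one factor N. The exponent of the
    -- target leaves room for it, since ε d = p + 1 ≥ 1.
    T-small : (K₃ ℕ.* L ℕ.^ 3) ℕ.^ R ≤ N → T ≤ K₃ ℕ.* (L ℕ.^ 3 ℕ.* N ℕ.^ 5) →
              T ℕ.^ R ≤ N ℕ.^ (5 ℕ.* d ℕ.+ suc p)
    T-small absorbed T≤ = begin
      T ℕ.^ R                                      ≤⟨ ℕ.^-monoˡ-≤ R T≤ ⟩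
      (K₃ ℕ.* (L ℕ.^ 3 ℕ.* N ℕ.^ 5)) ℕ.^ R         ≡⟨ cong (ℕ._^ R) (ℕ.*-assoc K₃ (L ℕ.^ 3) (N ℕ.^ 5)) ⟨
      (K₃ ℕ.* L ℕ.^ 3 ℕ.* N ℕ.^ 5) ℕ.^ R           ≡⟨ ^-distribʳ-* R (K₃ ℕ.* L ℕ.^ 3) (N ℕ.^ 5) ⟩
      (K₃ ℕ.* L ℕ.^ 3) ℕ.^ R ℕ.* (N ℕ.^ 5) ℕ.^ R   ≤⟨ ℕ.*-monoˡ-≤ ((N ℕ.^ 5) ℕ.^ R) absorbed ⟩
      N ℕ.* (N ℕ.^ 5) ℕ.^ R
          ≡⟨ cong (N ℕ.*_) (trans (ℕ.^-*-assoc N 5 R) (cong (N ℕ.^_) (R*k≡ 5))) ⟩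
      N ℕ.^ suc (5 ℕ.* d)
          ≤⟨ ℕ.^-monoʳ-≤ N (ℕ.≤-trans (s≤s (ℕ.m≤m+n (5 ℕ.* d) p)) (ℕ.≤-reflexive (sym (ℕ.+-suc (5 ℕ.* d) p)))) ⟩
      N ℕ.^ (5 ℕ.* d ℕ.+ suc p)                    ∎

    T²q-small : (K₂ ℕ.* L ℕ.^ 4) ℕ.^ R ≤ N → T ℕ.* T ℕ.* Q ≤ K₂ ℕ.* (L ℕ.^ 4 ℕ.* N ℕ.^ 28) →
                (T ℕ.* T ℕ.* Q) ℕ.^ R ℕ.< (N ℕ.^ 8 ℕ.* N ℕ.^ 8) ℕ.^ R ℕ.*
                    (N ℕ.^ (6 ℕ.* d ℕ.+ suc p) ℕ.* N ℕ.^ (6 ℕ.* d ℕ.+ suc p))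
    T²q-small absorbed T²Q≤ = begin-strict
      (T ℕ.* T ℕ.* Q) ℕ.^ R                           ≤⟨ ℕ.^-monoˡ-≤ R T²Q≤ ⟩
      (K₂ ℕ.* (L ℕ.^ 4 ℕ.* N ℕ.^ 28)) ℕ.^ R           ≡⟨ cong (ℕ._^ R) (ℕ.*-assoc K₂ (L ℕ.^ 4) (N ℕ.^ 28)) ⟨
      (K₂ ℕ.* L ℕ.^ 4 ℕ.* N ℕ.^ 28) ℕ.^ R             ≡⟨ ^-distribʳ-* R (K₂ ℕ.* L ℕ.^ 4) (N ℕ.^ 28) ⟩
      (K₂ ℕ.* L ℕ.^ 4) ℕ.^ R ℕ.* (N ℕ.^ 28) ℕ.^ R     ≤⟨ ℕ.*-monoˡ-≤ ((N ℕ.^ 28) ℕ.^ R) absorbed ⟩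
      N ℕ.* (N ℕ.^ 28) ℕ.^ R
          ≡⟨ cong (N ℕ.*_) (trans (ℕ.^-*-assoc N 28 R) (cong (N ℕ.^_) (R*k≡ 28))) ⟩
      -- The exponent on the right is 28 d + 2 p + 2, hence greater than 28 d + 1; with N ≥ 2 the
      -- inequality of powers is strict, as the passage to cuts requires.
      N ℕ.^ suc (28 ℕ.* d)                            <⟨ ℕ.^-monoʳ-< N 2≤N exponent ⟩
      N ℕ.^ (16 ℕ.* d ℕ.+ (E ℕ.+ E))                  ≡⟨ ℕ.^-distribˡ-+-* N (16 ℕ.* d) (E ℕ.+ E) ⟩
      N ℕ.^ (16 ℕ.* d) ℕ.* N ℕ.^ (E ℕ.+ E)            ≡⟨ ≡.cong₂ ℕ._*_ sixteen (ℕ.^-distribˡ-+-* N E E) ⟩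
      (N ℕ.^ 8 ℕ.* N ℕ.^ 8) ℕ.^ R ℕ.* (N ℕ.^ E ℕ.* N ℕ.^ E) ∎
      where
      import Relation.Binary.PropositionalEquality as ≡
      E = 6 ℕ.* d ℕ.+ suc p
      sixteen : N ℕ.^ (16 ℕ.* d) ≡ (N ℕ.^ 8 ℕ.* N ℕ.^ 8) ℕ.^ R
      sixteen = trans (cong (N ℕ.^_) (sym (R*k≡ 16)))
          (trans (sym (ℕ.^-*-assoc N 16 R)) (cong (ℕ._^ R) (ℕ.^-distribˡ-+-* N 8 8)))
      exponent : suc (28 ℕ.* d) ℕ.< 16 ℕ.* d ℕ.+ (E ℕ.+ E)
      exponent = ℕ.≤-trans (ℕ.m≤m+n (suc (suc (28 ℕ.* d))) (p ℕ.+ p)) (ℕ.≤-reflexive (solve 2 (λ d p →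
        con 2 :+ con 28 :* d :+ (p :+ p)
            := con 16 :* d :+ ((con 6 :* d :+ (con 1 :+ p)) :+ (con 6 :* d :+ (con 1 :+ p)))) refl d p))
        where open +-*-Solver

-- Choice of L and conclusion.

open import Defs
open import Data.Integer.Base using (+_; +[1+_])
import Data.Nat.Base as ℕ
open import Data.Nat.Base using (ℕ; zero; suc; NonZero; _≤_)
import Data.Nat.Properties as ℕ
open import Data.Nat.Primality using (Prime)
open import Data.Product.Base using (_,_; proj₁; proj₂; ∃-syntax)
open import Data.Rational.Unnormalised.Base using (ℚᵘ; mkℚᵘ; Positive; _/_; _+_; -_)
open import Data.Sum.Base using (map)
open import Relation.Binary.PropositionalEquality using (_≢_; sym; subst)

open SquareClassCounting using (dyadic)
open Absorption using (n<2^n; absorb)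
open CutBounds using (≤ᴿ-target)
open Exponents

theorem1p2 : (ε : ℚᵘ) → Positive ε →
    ∃[ N₀ ] ((q N : ℕ) .{{_ : NonZero q}} .{{_ : NonZero N}} →
    Prime q → N ≤ q → N₀ ≤ N →
    (j : 𝔽 q) → j ≢ ⟦ 0 ⟧ →
    T₄₂ N q j ≤ᴿ
    (N ^ᴿ (+ 5 / 8) *ᴿ q ^ᴿ (- (+ 1 / 8)) +ᴿ N ^ᴿ (+ 8 / 1) *ᴿ q ^ᴿ (- (+ 1 / 2)))
    *ᴿ N ^ᴿ (+ 6 / 1 + ε)
    +ᴿ N ^ᴿ (+ 5 / 1 + ε))
theorem1p2 (mkℚᵘ (+ zero) _) record { pos = () }
-- The summand 2 secures N ≥ 2; the others are the thresholds of the two absorptions, L³ in the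
-- bound for T and L⁴ in the bound for T² q.
theorem1p2 (mkℚᵘ +[1+ p ] d-1) _ = 2 ℕ.+ (proj₁ absorb₃ ℕ.+ proj₁ absorb₂) , bound
  where
  d = suc d-1
  R = 1 ℕ.* d
  K₃ = proj₁ T₄₂-dichotomy
  K₂ = proj₁ (proj₂ T₄₂-dichotomy)
  absorb₃ = absorb K₃ 3 R
  absorb₂ = absorb K₂ 4 R
  bound : (q N : ℕ) .{{_ : NonZero q}} .{{_ : NonZero N}} → Prime q → N ≤ q →
          2 ℕ.+ (proj₁ absorb₃ ℕ.+ proj₁ absorb₂) ≤ N → (j : 𝔽 q) → j ≢ ⟦ 0 ⟧ → T₄₂ N q j ≤ᴿ _
  -- The leading binary digit 2ⁱ of N gives L = i + 1 with N < 2 ^ L ≤ 2 N; N < 2 ^ N merely starts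
  -- the search.
  bound q N q-prime _ N₀≤N j j≢0 with dyadic N N (n<2^n N)
  ... | i , t , _ , t<2^i , N≡ = ≤ᴿ-target N q p d-1 (T₄₂ N q j)
    (map (T-small K₃ K₂ p d N L (T₄₂ N q j) (q ℕ.^ 1) 2≤N
           (proj₂ absorb₃ N L (ℕ.≤-trans (ℕ.m≤m+n _ _) absorb≤) N<2^L 2^L≤2N))
         (λ T²q≤ → T²q-small K₃ K₂ p d N L (T₄₂ N q j) (q ℕ.^ 1) 2≤N
           (proj₂ absorb₂ N L (ℕ.≤-trans (ℕ.m≤n+m _ (proj₁ absorb₃)) absorb≤) N<2^L 2^L≤2N)
           (subst (λ Q → T₄₂ N q j ℕ.* T₄₂ N q j ℕ.* Q ≤ K₂ ℕ.* (L ℕ.^ 4 ℕ.* N ℕ.^ 28))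
             (sym (ℕ.*-identityʳ q)) T²q≤))
         (proj₂ (proj₂ T₄₂-dichotomy) q N L q-prime N<2^L j j≢0))
    where
    L = suc i
    2≤N : 2 ≤ N
    2≤N = ℕ.m+n≤o⇒m≤o 2 N₀≤N
    absorb≤ : proj₁ absorb₃ ℕ.+ proj₁ absorb₂ ≤ N
    absorb≤ = ℕ.m+n≤o⇒n≤o 2 N₀≤N
    N<2^L : N ℕ.< 2 ℕ.^ L
    N<2^L = subst (ℕ._< 2 ℕ.^ L) (sym N≡) (ℕ.+-monoʳ-< (2 ℕ.^ i) (ℕ.≤-trans t<2^i (ℕ.m≤m+n (2 ℕ.^ i) 0)))
    2^L≤2N : 2 ℕ.^ L ≤ 2 ℕ.* N
    2^L≤2N = ℕ.*-monoʳ-≤ 2 (subst (2 ℕ.^ i ≤_) (sym N≡) (ℕ.m≤m+n (2 ℕ.^ i) t))
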